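{- Let $n$ denote a positive integer. (1) Let $c\ge11$ be an integer. Then $B(n,2n-c)\ne\emptyset$ if and only if $n=c/2$ or $c-4\le n\le c-2$. (2) $B(n,2n-10)\ne\emptyset$ if and only if $n\ge5$. Further, if $n\ge9$ and $\mathcal{B}\in B(n,2n-10)$, then $\mathcal{B}\simeq\mathcal{T}_{n,i}$ for some $1\le i\le\lceil\frac{n-5}{2}\rceil$. (3) For all $6\le n<9$, there exists a betweenness structure $\mathcal{B}\in B(n,2n-10)$ such that $\mathcal{B}\not\simeq\mathcal{T}_{n,i}$ for any $1\le i\le\lceil\frac{n-5}{2}\rceil$.
   Context: A betweenness structure is a pair $\mathcal{B}=(X,\beta)$ where $X$ is a nonempty finite set and $\beta\subseteq X^3$; write $(x\ y\ z)$ for $(x,y,z)\in\beta$. All betweenness structures are assumed to be almost-metrizable, i.e. for all $x,y,z,w\in X$: (P1) $(x\ x\ z)$; (P2) $(x\ y\ z)\Rightarrow(z\ y\ x)$; (P3) $(x\ y\ z)\wedge(y\ x\ z)\Rightarrow x=y$; (P4) $(x\ y\ z)\wedge(x\ w\ y)\Rightarrow(x\ w\ z)\wedge(w\ y\ z)$. The order of $\mathcal{B}$ is $|X|$. A set of three distinct points is collinear if some ordering of it is in $\beta$; otherwise it is a triangle. The co-size of $\mathcal{B}$ is its number of triangles. $B(n,m)$ is the set of betweenness structures of order $n$ and co-size $m$ (empty if $m<0$). $\simeq$ denotes isomorphism, i.e. existence of a bijection of ground sets preserving betweenness in both directions. For $n\ge6$ and $1\le i\le\lceil\frac{n-5}{2}\rceil$,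 $T_{n,i}$ is the simple (unit-weight) graph with vertices $x_1,\dots,x_{n-4},y,z,u,v$ and edges $\{x_j,x_{j+1}\}$ for $1\le j\le n-5$, $j\ne i$, together with $\{x_i,y\},\{x_i,z\},\{y,u\},\{y,v\},\{z,u\},\{z,v\},\{u,x_{i+1}\},\{v,x_{i+1}\}$. $\mathcal{T}_{n,i}$ is the betweenness structure induced by $T_{n,i}$: its ground set is the vertex set, and $(x\ y\ z)$ holds iff $d(x,z)=d(x,y)+d(y,z)$ for the graph distance $d$ of $T_{n,i}$. -}

module Defs where

open import Data.Empty using (⊥-elim)
open import Data.Fin.Base as Fin using (Fin; zero; suc; toℕ; fromℕ<)
import Data.Fin.Properties as Fin
open import Data.Integer.Base as ℤ using (ℤ)
open import Data.List.Base using (List; length; filter; allFin; cartesianProduct)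
open import Data.Nat.Base
open import Data.Nat.Properties
open import Data.Product using (Σ; Σ-syntax; ∃; _×_; _,_; proj₁; proj₂)
open import Data.Sum.Base using (_⊎_; inj₁; inj₂; swap)
open import Function.Base using (_∘_)
open import Function.Bundles using (_↔_; _⇔_; Inverse; mk↔ₛ′)
open import Function.Construct.Composition using (_↔-∘_)
open import Function.Construct.Symmetry using (↔-sym)
open import Function.Properties.Inverse using (Inverse⇒Injection)
open import Relation.Binary.Definitions using (DecidableEquality)
open import Relation.Binary.PropositionalEquality
open import Relation.Nullary using (Dec; yes; no; ¬_)
open import Relation.Nullary.Decidable using (map′; via-injection; _×-dec_; _⊎-dec_; ¬?)
import Relation.Unary as U

-- A finite set is a type with an enumeration, and β is decidable, as every
-- subset of X³ is classically.
record BetweennessStructure : Set₁ where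
  field
    X        : Set
    order    : ℕ
    enum     : X ↔ Fin order
    nonEmpty : NonZero order
    β        : X → X → X → Set
    β?       : ∀ x y z → Dec (β x y z)
    P1       : ∀ x z → β x x z
    P2       : ∀ x y z → β x y z → β z y x
    P3       : ∀ x y z → β x y z → β y x z → x ≡ y
    P4       : ∀ x y z w → β x y z → β x w y → β x w z × β w y z

  Collinear : X → X → X → Set
  Collinear x y z =
    β x y z ⊎ β x z y ⊎ β y x z ⊎ β y z x ⊎ β z x y ⊎ β z y x

  collinear? : ∀ x y z → Dec (Collinear x y z)
  collinear? x y z =
    β? x y z ⊎-dec β? x z y ⊎-dec β? y x z ⊎-dec
    β? y z x ⊎-dec β? z x y ⊎-dec β? z y x

  point : Fin order → X
  point = Inverse.from enum

  -- A set of three distinct points is represented by its unique increasing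
  -- triple of positions in the enumeration.
  IsTriangle : Fin order × Fin order × Fin order → Set
  IsTriangle (i , j , k) =
    i Fin.< j × j Fin.< k × ¬ Collinear (point i) (point j) (point k)

  isTriangle? : U.Decidable IsTriangle
  isTriangle? (i , j , k) =
    i Fin.<? j ×-dec j Fin.<? k ×-dec
    ¬? (collinear? (point i) (point j) (point k))

  triangles : List (Fin order × Fin order × Fin order)
  triangles = filter isTriangle?
    (cartesianProduct (allFin order)
      (cartesianProduct (allFin order) (allFin order)))

  coSize : ℕ
  coSize = length triangles

open BetweennessStructure using (X; order; β; coSize)

-- The second argument is an integer, so that B n m is empty for m < 0.
B : ℕ → ℤ → Set₁
B n m = Σ[ 𝓑 ∈ BetweennessStructure ] (order 𝓑 ≡ n × ℤ.+ coSize 𝓑 ≡ m)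

infix 4 _≃_

_≃_ : BetweennessStructure → BetweennessStructure → Set
𝓐 ≃ 𝓑 = Σ[ f ∈ X 𝓐 ↔ X 𝓑 ]
  (∀ x y z → β 𝓐 x y z ⇔ β 𝓑 (Inverse.to f x) (Inverse.to f y) (Inverse.to f z))

record Graph : Set₁ where
  infix 4 _~_ _~?_ _≟ⱽ_
  field
    V      : Set
    size   : ℕ
    enum   : V ↔ Fin size
    _~_    : V → V → Set
    _~?_   : ∀ x y → Dec (x ~ y)
    ~-sym  : ∀ {x y} → x ~ y → y ~ x
    ~-irr  : ∀ {x} → ¬ x ~ x

  _≟ⱽ_ : DecidableEquality V
  _≟ⱽ_ = via-injection (Inverse⇒Injection enum) Fin._≟_

  infixr 5 _∷_ _++_

  data Walk : V → V → ℕ → Set where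
    []  : ∀ {x} → Walk x x 0
    _∷_ : ∀ {x y z k} → x ~ y → Walk y z k → Walk x z (suc k)

  _++_ : ∀ {x y z k l} → Walk x y k → Walk y z l → Walk x z (k + l)
  []      ++ q = q
  (e ∷ p) ++ q = e ∷ (p ++ q)

  reverse : ∀ {x y k} → Walk x y k → Walk y x k
  reverse [] = []
  reverse {k = suc k} (e ∷ p) =
    subst (Walk _ _) (+-comm k 1) (reverse p ++ (~-sym e ∷ []))

  walk? : ∀ x y → U.Decidable (Walk x y)
  walk? x y zero    = map′ (λ { refl → [] }) (λ { [] → refl }) (x ≟ⱽ y)
  walk? x y (suc k) = map′
    (λ { (_ , e , p) → e ∷ p })
    (λ { (_∷_ {y = w} e p) →
         Inverse.to enum w ,
         subst (λ v → x ~ v × Walk v y k)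
               (sym (Inverse.strictlyInverseʳ enum w)) (e , p) })
    (Fin.any? (λ i → let w = Inverse.from enum i in (x ~? w) ×-dec walk? w y k))

  Connected : Set
  Connected = ∀ x y → ∃ (Walk x y)

least : ∀ {P : ℕ → Set} → U.Decidable P → ∀ k → P k →
        Σ[ m ∈ ℕ ] (P m × (∀ j → P j → m ≤ j))
least P? zero    p = 0 , p , λ _ _ → z≤n
least P? (suc k) p with P? 0
... | yes p₀ = 0 , p₀ , λ _ _ → z≤n
... | no ¬p₀ with least (P? ∘ suc) k p
...   | m , pm , min = suc m , pm , λ where
        zero    q → ⊥-elim (¬p₀ q)
        (suc j) q → s≤s (min j q)

module Distance (G : Graph) (conn : Graph.Connected G) where
  open Graph G

  private
    shortest : ∀ x y → Σ[ m ∈ ℕ ] (Walk x y m × (∀ j → Walk x y j → m ≤ j))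
    shortest x y = least (walk? x y) (proj₁ (conn x y)) (proj₂ (conn x y))

  d : V → V → ℕ
  d x y = proj₁ (shortest x y)

  d-walk : ∀ x y → Walk x y (d x y)
  d-walk x y = proj₁ (proj₂ (shortest x y))

  d-min : ∀ x y {k} → Walk x y k → d x y ≤ k
  d-min x y {k} = proj₂ (proj₂ (shortest x y)) k

  d-refl : ∀ x → d x x ≡ 0
  d-refl x = n≤0⇒n≡0 (d-min x x [])

  d-sym : ∀ x y → d x y ≡ d y x
  d-sym x y = ≤-antisym (d-min x y (reverse (d-walk y x)))
                        (d-min y x (reverse (d-walk x y)))

  d-triangle : ∀ x y z → d x z ≤ d x y + d y z
  d-triangle x y z = d-min x z (d-walk x y ++ d-walk y z)

  d≡0⇒≡ : ∀ x y → d x y ≡ 0 → x ≡ y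
  d≡0⇒≡ x y eq with d x y | d-walk x y
  d≡0⇒≡ x .x refl | .0 | [] = refl

  Between : V → V → V → Set
  Between x y z = d x z ≡ d x y + d y z

  between-sym : ∀ x y z → Between x y z → Between z y x
  between-sym x y z p = begin
    d z x          ≡⟨ d-sym z x ⟩
    d x z          ≡⟨ p ⟩
    d x y + d y z  ≡⟨ +-comm (d x y) (d y z) ⟩
    d y z + d x y  ≡⟨ cong₂ _+_ (d-sym y z) (d-sym x y) ⟩
    d z y + d y x  ∎
    where open ≡-Reasoning

  between-antisym : ∀ x y z → Between x y z → Between y x z → x ≡ y
  between-antisym x y z p q = d≡0⇒≡ x y (m+n≡0⇒m≡0 (d x y) both≡0)
    where
    open ≡-Reasoning
    both≡0 : d x y + d y x ≡ 0
    both≡0 = +-cancelʳ-≡ (d x z) (d x y + d y x) 0 (begin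
      (d x y + d y x) + d x z  ≡⟨ +-assoc (d x y) (d y x) (d x z) ⟩
      d x y + (d y x + d x z)  ≡⟨ cong (d x y +_) q ⟨
      d x y + d y z            ≡⟨ p ⟨
      d x z                    ∎)

  between-trans : ∀ x y z w → Between x y z → Between x w y →
                  Between x w z × Between w y z
  between-trans x y z w p q =
    ≤-antisym (d-triangle x w z) lower ,
    ≤-antisym (d-triangle w y z) lower′
    where
    open ≤-Reasoning
    split : d x z ≡ d x w + (d w y + d y z)
    split = trans p (trans (cong (_+ d y z) q) (+-assoc (d x w) (d w y) (d y z)))
    lower : d x w + d w z ≤ d x z
    lower = begin
      d x w + d w z            ≤⟨ +-monoʳ-≤ (d x w) (d-triangle w y z) ⟩
      d x w + (d w y + d y z)  ≡⟨ split ⟨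
      d x z                    ∎
    lower′ : d w y + d y z ≤ d w z
    lower′ = +-cancelˡ-≤ (d x w) _ _ (begin
      d x w + (d w y + d y z)  ≡⟨ split ⟨
      d x z                    ≤⟨ d-triangle x w z ⟩
      d x w + d w z            ∎)

  induced : NonZero size → BetweennessStructure
  induced nz = record
    { X        = V
    ; order    = size
    ; enum     = enum
    ; nonEmpty = nz
    ; β        = Between
    ; β?       = λ x y z → d x z ≟ d x y + d y z
    ; P1       = λ x z → cong (_+ d x z) (sym (d-refl x))
    ; P2       = between-sym
    ; P3       = between-antisym
    ; P4       = between-trans
    }

-- The vertex x j stands for the 1-based x_{toℕ j + 1}.
data TVertex (n : ℕ) : Set where
  x       : Fin (n ∸ 4) → TVertex n
  y z u v : TVertex n

index : ∀ {m} → Fin m → ℕ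
index j = suc (toℕ j)

-- Each edge in one orientation.
data TEdge (n i : ℕ) : TVertex n → TVertex n → Set where
  xx : ∀ {j k} → index k ≡ suc (index j) → index j ≢ i → TEdge n i (x j) (x k)
  xy : ∀ {j} → index j ≡ i → TEdge n i (x j) y
  xz : ∀ {j} → index j ≡ i → TEdge n i (x j) z
  yu : TEdge n i y u
  yv : TEdge n i y v
  zu : TEdge n i z u
  zv : TEdge n i z v
  ux : ∀ {j} → index j ≡ suc i → TEdge n i u (x j)
  vx : ∀ {j} → index j ≡ suc i → TEdge n i v (x j)

tEdge? : ∀ n i a b → Dec (TEdge n i a b)
tEdge? n i (x j) (x k) =
  map′ (λ { (p , q) → xx p q }) (λ { (xx p q) → p , q })
       ((index k ≟ suc (index j)) ×-dec ¬? (index j ≟ i))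
tEdge? n i (x j) y = map′ xy (λ { (xy p) → p }) (index j ≟ i)
tEdge? n i (x j) z = map′ xz (λ { (xz p) → p }) (index j ≟ i)
tEdge? n i (x j) u = no λ ()
tEdge? n i (x j) v = no λ ()
tEdge? n i y (x j) = no λ ()
tEdge? n i y y = no λ ()
tEdge? n i y z = no λ ()
tEdge? n i y u = yes yu
tEdge? n i y v = yes yv
tEdge? n i z (x j) = no λ ()
tEdge? n i z y = no λ ()
tEdge? n i z z = no λ ()
tEdge? n i z u = yes zu
tEdge? n i z v = yes zv
tEdge? n i u (x j) = map′ ux (λ { (ux p) → p }) (index j ≟ suc i)
tEdge? n i u y = no λ ()
tEdge? n i u z = no λ ()
tEdge? n i u u = no λ ()
tEdge? n i u v = no λ ()
tEdge? n i v (x j) = map′ vx (λ { (vx p) → p }) (index j ≟ suc i)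
tEdge? n i v y = no λ ()
tEdge? n i v z = no λ ()
tEdge? n i v u = no λ ()
tEdge? n i v v = no λ ()

tEdge-irr : ∀ {n i a} → ¬ TEdge n i a a
tEdge-irr (xx p _) = 1+n≢n (sym p)

tEnum : ∀ n → TVertex n ↔ Fin (4 + (n ∸ 4))
tEnum n = ↔-sym Fin.+↔⊎ ↔-∘ mk↔ₛ′ to from to-from from-to
  where
  to : TVertex n → Fin 4 ⊎ Fin (n ∸ 4)
  to (x j) = inj₂ j
  to y     = inj₁ zero
  to z     = inj₁ (suc zero)
  to u     = inj₁ (suc (suc zero))
  to v     = inj₁ (suc (suc (suc zero)))
  from : Fin 4 ⊎ Fin (n ∸ 4) → TVertex n
  from (inj₂ j)                      = x j
  from (inj₁ zero)                   = y
  from (inj₁ (suc zero))             = z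
  from (inj₁ (suc (suc zero)))       = u
  from (inj₁ (suc (suc (suc zero)))) = v
  to-from : ∀ s → to (from s) ≡ s
  to-from (inj₂ j)                      = refl
  to-from (inj₁ zero)                   = refl
  to-from (inj₁ (suc zero))             = refl
  to-from (inj₁ (suc (suc zero)))       = refl
  to-from (inj₁ (suc (suc (suc zero)))) = refl
  from-to : ∀ a → from (to a) ≡ a
  from-to (x j) = refl
  from-to y     = refl
  from-to z     = refl
  from-to u     = refl
  from-to v     = refl

-- For n ≥ 4 the size 4 + (n ∸ 4) is n.
T : ℕ → ℕ → Graph
T n i = record
  { V     = TVertex n
  ; size  = 4 + (n ∸ 4)
  ; enum  = tEnum n
  ; _~_   = λ a b → TEdge n i a b ⊎ TEdge n i b a
  ; _~?_  = λ a b → tEdge? n i a b ⊎-dec tEdge? n i b a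
  ; ~-sym = swap
  ; ~-irr = λ { (inj₁ e) → tEdge-irr e ; (inj₂ e) → tEdge-irr e }
  }

i<n∸4 : ∀ n i → 1 ≤ i → i ≤ ⌈ n ∸ 5 /2⌉ → i < n ∸ 4
i<n∸4 0 i 1≤i i≤ with () ← ≤-trans 1≤i i≤
i<n∸4 1 i 1≤i i≤ with () ← ≤-trans 1≤i i≤
i<n∸4 2 i 1≤i i≤ with () ← ≤-trans 1≤i i≤
i<n∸4 3 i 1≤i i≤ with () ← ≤-trans 1≤i i≤
i<n∸4 4 i 1≤i i≤ with () ← ≤-trans 1≤i i≤
i<n∸4 (suc (suc (suc (suc (suc m))))) i 1≤i i≤ = s≤s (≤-trans i≤ (⌈n/2⌉≤n m))

T-connected : ∀ n i → 1 ≤ i → i ≤ ⌈ n ∸ 5 /2⌉ → Graph.Connected (T n i)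
T-connected n (suc i) 1≤i i≤ a b = _ , reverse (proj₂ (reach a)) ++ proj₂ (reach b)
  where
  open Graph (T n (suc i)) hiding (V)
  i<N : suc i < n ∸ 4
  i<N = i<n∸4 n (suc i) 1≤i i≤
  root : TVertex n
  root = x (fromℕ< (≤-trans z<s i<N))
  infixl 5 _▷_
  _▷_ : ∀ {a b} → ∃ (Walk root a) → a ~ b → ∃ (Walk root b)
  (_ , p) ▷ e = _ , p ++ (e ∷ [])
  index-fromℕ< : ∀ {k} (k< : k < n ∸ 4) → index (fromℕ< k<) ≡ suc k
  index-fromℕ< k< = cong suc (Fin.toℕ-fromℕ< k<)
  reachₓ : ∀ k (k< : k < n ∸ 4) → ∃ (Walk root (x (fromℕ< k<)))
  reachₓ zero    k< = 0 , []
  reachₓ (suc k) k< with k ≟ i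
  ... | yes refl = reachₓ k k<′ ▷ inj₁ (xy (index-fromℕ< k<′)) ▷ inj₁ yu
                     ▷ inj₁ (ux (index-fromℕ< k<))
    where k<′ = <-trans (n<1+n k) k<
  ... | no k≢i = reachₓ k k<′ ▷ inj₁ (xx
      (trans (index-fromℕ< k<) (cong suc (sym (index-fromℕ< k<′))))
      (λ eq → k≢i (suc-injective (trans (sym (index-fromℕ< k<′)) eq))))
    where k<′ = <-trans (n<1+n k) k<
  i<N′ : i < n ∸ 4
  i<N′ = <-trans (n<1+n i) i<N
  reach-y : ∃ (Walk root y)
  reach-y = reachₓ i i<N′ ▷ inj₁ (xy (index-fromℕ< i<N′))
  reach : ∀ c → ∃ (Walk root c)
  reach (x j) = subst (λ k → ∃ (Walk root (x k))) (Fin.fromℕ<-toℕ j (Fin.toℕ<n j))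
                  (reachₓ (toℕ j) (Fin.toℕ<n j))
  reach y = reach-y
  reach z = reachₓ i i<N′ ▷ inj₁ (xz (index-fromℕ< i<N′))
  reach u = reach-y ▷ inj₁ yu
  reach v = reach-y ▷ inj₁ yv

-- The bounds on i already force 6 ≤ n.
𝓣 : ∀ n i → 1 ≤ i → i ≤ ⌈ n ∸ 5 /2⌉ → BetweennessStructure
𝓣 n i 1≤i i≤ = Distance.induced (T n i) (T-connected n i 1≤i i≤) _

{-# OPTIONS --safe #-}

module Submission where

-- Call a set of points with β along one linear order a line. For a line c of m ≥ 5
-- points and a point p outside it, consider the graph on c of the pairs not collinear
-- with p. If the graph is a star with centre w, then w and p can each be added to the
-- line c without w, and comparing their positions shows that the star has 0 or at
-- least m − 3 edges; with m − 3 edges, w and p are opposite in a 4-cycle. If it is not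
-- a star, it has at least 2m − 7 edges, by induction on m from m = 5 and m = 6, where
-- all positions of p that P1–P4 permit are enumerated.
--
-- Let n be the order. Without a 5-point line, averaging over 5-point subsets makes the
-- co-size at least 2n − 10, and larger for n ≥ 8. Otherwise let c be a maximal line, of
-- m points. With one point outside, the co-size is that of a graph as above; with
-- k ≥ 2 points outside, it is at least k (m − 3) ≥ 2n − 10. In case of equality,
-- exchanging a point outside for its centre gives further maximal lines, and comparing
-- them forces k = 2 and two 4-cycles at neighbouring points of c, which is 𝓣.

open import Defs renaming (x to xᵥ; y to yᵥ; z to zᵥ; u to uᵥ; v to vᵥ)
open import Data.Bool.Base using (Bool; true; false; _∧_; _∨_; if_then_else_) renaming (T to True)
open import Data.Fin.Base as Fin using (Fin; toℕ; fromℕ<)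
import Data.Fin.Properties as Fin
open import Data.List.Base as List using (List; []; _∷_; _++_; map; length; filter; cartesianProduct; concatMap; zipWith; reverse; allFin; tabulate; initLast)
open import Data.List.Membership.Propositional using (_∈_; find; lose)
open import Data.List.Membership.Propositional.Properties using (∈-++⁺ˡ; ∈-++⁺ʳ; ∈-++⁻; ∈-map⁺; ∈-concatMap⁺; ∈-allFin; ∈-tabulate⁻)
open import Data.List.Properties
  using (map-++; map-id; length-++; length-map; length-reverse; length-tabulate; ++-assoc; ++-identityʳ; reverse-++; reverse-involutive; unfold-reverse; ∷-injectiveˡ; ∷-injectiveʳ; ∷ʳ-injective)
open import Data.List.Relation.Binary.Permutation.Propositional using (_↭_; refl; prep; swap; trans; ↭-sym; ↭-trans; ↭-reflexive)
import Data.List.Relation.Binary.Permutation.Propositional.Properties as Perm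
open import Data.List.Relation.Binary.Pointwise using (Pointwise; []; _∷_)
open import Data.List.Relation.Binary.Sublist.Propositional using (_⊆_; []; _∷_; _∷ʳ_; ⊆-refl; ⊆-trans; from∈; to∈; minimum)
open import Data.List.Relation.Binary.Sublist.Propositional.Properties using (++⁺; ++⁺ˡ; ++⁺ʳ; reverse⁺; Any-resp-⊆)
open import Data.List.Relation.Unary.All as All using (All; []; _∷_)
import Data.List.Relation.Unary.All.Properties as All
open import Data.List.Relation.Unary.AllPairs using (AllPairs; []; _∷_)
import Data.List.Relation.Unary.AllPairs.Properties as AllPairs
open import Data.List.Relation.Unary.Any as Any using (Any; here; there)
open import Data.Nat.Base
open import Data.Nat.ListAction using (sum)
open import Data.Nat.ListAction.Properties using (sum-++; sum-↭)
open import Data.Nat.Properties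
open import Data.Nat.Tactic.RingSolver using (solve-∀)
open import Data.Product using (Σ-syntax; ∃-syntax; _×_; _,_; proj₁; proj₂)
open import Data.Sum.Base as Sum using (_⊎_; inj₁; inj₂; [_,_]′)
open import Data.Unit.Base using (⊤)
open import Data.Empty using (⊥; ⊥-elim)
open import Function.Base using (_∘_; id)
open import Function.Bundles using (_⇔_; Inverse; Equivalence; mk↔ₛ′; mk⇔)
open import Function.Construct.Identity using (↔-id)
open import Relation.Binary.Definitions using (DecidableEquality; tri<; tri≈; tri>)
open import Relation.Binary.PropositionalEquality using (_≡_; _≢_; refl; sym; cong; cong₂; subst; subst₂; module ≡-Reasoning)
import Relation.Binary.PropositionalEquality as ≡
open import Relation.Nullary using (Dec; yes; no; ¬_; contradiction)
open import Relation.Nullary.Decidable using (toWitness; _⊎-dec_; ¬?)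
import Relation.Unary as U

-- Counting triangles

-- The obstacle behind the small sizes is the 4-cycle: all its triples are collinear, yet it is not
-- a line. A point collinear with all pairs of a line can be inserted once the line has four points;
-- with five, four remain after the removal of a centre.
--
-- The constants come from a line that misses a single point. Then m = n - 1, and a star has no edge
-- or between m - 3 and m - 1 edges, so the co-size is 0 or between n - 4 and n - 2. Now 2n - c is
-- one of these values exactly when n = c/2 or c - 4 ≤ n ≤ c - 2. A graph that is not a star has at
-- least 2m - 7 = 2n - 9 edges, so every co-size not due to a line or a star is at least 2n - 10.
-- The three nonzero star values are realised by a path with a 4-cycle, a fork or a triangle at its
-- end.
--
-- Equality in 2n - 10 with two points outside leaves no slack: each of them has the minimal star,
-- and no triangle contains both of them and a point of the line. This is why exchanging a point for
-- its centre loses nothing and the new lines can be compared.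

∑ : ∀ {A : Set} → List A → (A → ℕ) → ℕ
∑ l f = sum (map f l)

module _ {A : Set} where

  ∑-cong : ∀ (l : List A) {f g : A → ℕ} → (∀ {x} → x ∈ l → f x ≡ g x) → ∑ l f ≡ ∑ l g
  ∑-cong []      eq = refl
  ∑-cong (x ∷ l) eq = cong₂ _+_ (eq (here refl)) (∑-cong l (eq ∘ there))

  ∑-zero : ∀ (l : List A) {f : A → ℕ} → (∀ {x} → x ∈ l → f x ≡ 0) → ∑ l f ≡ 0
  ∑-zero []      eq = refl
  ∑-zero (x ∷ l) eq = cong₂ _+_ (eq (here refl)) (∑-zero l (eq ∘ there))

  ∑-++ : ∀ (k l : List A) (f : A → ℕ) → ∑ (k ++ l) f ≡ ∑ k f + ∑ l f
  ∑-++ k l f = ≡.trans (cong sum (map-++ f k l)) (sum-++ (map f k) (map f l))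

  ∑-↭ : ∀ {k l : List A} (f : A → ℕ) → k ↭ l → ∑ k f ≡ ∑ l f
  ∑-↭ f p = sum-↭ (Perm.map⁺ f p)

  ∑-+ : ∀ (l : List A) (f g : A → ℕ) → ∑ l (λ x → f x + g x) ≡ ∑ l f + ∑ l g
  ∑-+ []      f g = refl
  ∑-+ (x ∷ l) f g = ≡.trans (cong (f x + g x +_) (∑-+ l f g)) (interchange (f x) (g x) (∑ l f) (∑ l g))
    where
    interchange : ∀ a b c d → a + b + (c + d) ≡ (a + c) + (b + d)
    interchange = solve-∀

  ∑-≤ : ∀ (l : List A) {f : A → ℕ} k → (∀ {x} → x ∈ l → f x ≤ k) → ∑ l f ≤ length l * k
  ∑-≤ []      k le = z≤n
  ∑-≤ (x ∷ l) k le = +-mono-≤ (le (here refl)) (∑-≤ l k (le ∘ there))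

  indicator : ∀ {P : A → Set} → U.Decidable P → A → ℕ
  indicator P? x with P? x
  ... | yes _ = 1
  ... | no  _ = 0

  length-filter : ∀ {P : A → Set} (P? : U.Decidable P) (l : List A) →
                  length (filter P? l) ≡ ∑ l (indicator P?)
  length-filter P? []      = refl
  length-filter P? (x ∷ l) with P? x
  ... | yes _ = cong suc (length-filter P? l)
  ... | no  _ = length-filter P? l

∑-cartesianProduct : ∀ {A C : Set} (f : A × C → ℕ) (k : List A) (l : List C) →
                     ∑ (cartesianProduct k l) f ≡ ∑ k (λ x → ∑ l (λ y → f (x , y)))
∑-cartesianProduct f []      l = refl
∑-cartesianProduct f (x ∷ k) l = begin
  ∑ (map (x ,_) l ++ cartesianProduct k l) f
    ≡⟨ ∑-++ (map (x ,_) l) _ f ⟩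
  ∑ (map (x ,_) l) f + ∑ (cartesianProduct k l) f
    ≡⟨ cong₂ _+_ (∑-map l) (∑-cartesianProduct f k l) ⟩
  ∑ l (λ y → f (x , y)) + ∑ k (λ x → ∑ l (λ y → f (x , y))) ∎
  where
  open ≡-Reasoning
  ∑-map : ∀ l → ∑ (map (x ,_) l) f ≡ ∑ l (λ y → f (x , y))
  ∑-map []      = refl
  ∑-map (y ∷ l) = cong (f (x , y) +_) (∑-map l)

-- Pick x l k: deleting one occurrence of x from l leaves k.
data Pick {A : Set} (x : A) : List A → List A → Set where
  here  : ∀ {l} → Pick x (x ∷ l) l
  there : ∀ {y l k} → Pick x l k → Pick x (y ∷ l) (y ∷ k)

module _ {A : Set} where

  pick-↭ : ∀ {x : A} {l k} → Pick x l k → l ↭ x ∷ k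
  pick-↭ here      = refl
  pick-↭ (there p) = trans (prep _ (pick-↭ p)) (swap _ _ refl)

  pick-length : ∀ {x : A} {l k} → Pick x l k → length l ≡ suc (length k)
  pick-length p = Perm.↭-length (pick-↭ p)

  pick-split : ∀ {x : A} {l k} → Pick x l k → ∃[ u ] ∃[ v ] (l ≡ u ++ x ∷ v × k ≡ u ++ v)
  pick-split {l = x ∷ l} here      = [] , l , refl , refl
  pick-split {l = y ∷ l} (there p) with pick-split p
  ... | u , v , refl , refl = y ∷ u , v , refl , refl

  pick-∈ : ∀ {x : A} {l} → x ∈ l → ∃[ k ] Pick x l k
  pick-∈ (here refl) = _ , here
  pick-∈ (there x∈l) with pick-∈ x∈l
  ... | k , p = _ , there p

  pick-mid : ∀ u {x : A} {v} → Pick x (u ++ x ∷ v) (u ++ v)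
  pick-mid []      = here
  pick-mid (y ∷ u) = there (pick-mid u)

  ∈-pick : ∀ {x : A} {l k} → Pick x l k → x ∈ l
  ∈-pick here      = here refl
  ∈-pick (there p) = there (∈-pick p)

  pick-commute : ∀ {x y : A} {l k j} → Pick x l k → Pick y k j →
                 ∃[ i ] (Pick y l i × Pick x i j)
  pick-commute here      q         = _ , there q , here
  pick-commute (there p) here      = _ , here , p
  pick-commute (there p) (there q) with pick-commute p q
  ... | i , p′ , q′ = _ , there p′ , there q′

  pick-or : ∀ {P Q : A → List A → Set} l → (∀ {x k} → Pick x l k → P x k ⊎ Q x k) →
            (∃[ x ] ∃[ k ] (Pick x l k × P x k)) ⊎ (∀ {x k} → Pick x l k → Q x k)
  pick-or []      f = inj₂ λ ()
  pick-or (y ∷ l) f with f here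
  ... | inj₁ p = inj₁ (_ , _ , here , p)
  ... | inj₂ q with pick-or l (f ∘ there)
  ...   | inj₁ (x , k , i , p) = inj₁ (x , y ∷ k , there i , p)
  ...   | inj₂ qs = inj₂ λ { here → q ; (there i) → qs i }

  -- A summand sees the deleted point together with what is left, so that `D x k` and `τ k` can be
  -- summed over all deletions from one list.
  ∑ₚ : (A → List A → ℕ) → List A → ℕ
  ∑ₚ f []      = 0
  ∑ₚ f (x ∷ l) = f x l + ∑ₚ (λ y k → f y (x ∷ k)) l

  ∑ₚ-cong : ∀ {f g : A → List A → ℕ} l → (∀ {x k} → Pick x l k → f x k ≡ g x k) → ∑ₚ f l ≡ ∑ₚ g l
  ∑ₚ-cong []      eq = refl
  ∑ₚ-cong (x ∷ l) eq = cong₂ _+_ (eq here) (∑ₚ-cong l (eq ∘ there))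

  ∑ₚ-+ : ∀ (f g : A → List A → ℕ) l → ∑ₚ (λ x k → f x k + g x k) l ≡ ∑ₚ f l + ∑ₚ g l
  ∑ₚ-+ f g []      = refl
  ∑ₚ-+ f g (x ∷ l) = ≡.trans (cong (f x l + g x l +_) (∑ₚ-+ (λ y k → f y (x ∷ k)) (λ y k → g y (x ∷ k)) l))
                           (interchange (f x l) _ _ _)
    where
    interchange : ∀ a b c d → a + b + (c + d) ≡ (a + c) + (b + d)
    interchange = solve-∀

  ∑ₚ-point : ∀ (f : A → ℕ) l → ∑ₚ (λ x _ → f x) l ≡ ∑ l f
  ∑ₚ-point f []      = refl
  ∑ₚ-point f (x ∷ l) = cong (f x +_) (∑ₚ-point f l)

  ∑ₚ-const : ∀ c l → ∑ₚ (λ _ _ → c) l ≡ length l * c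
  ∑ₚ-const c []      = refl
  ∑ₚ-const c (x ∷ l) = cong (c +_) (∑ₚ-const c l)

  ∑ₚ-mono : ∀ {f g : A → List A → ℕ} l → (∀ {x k} → Pick x l k → f x k ≤ g x k) → ∑ₚ f l ≤ ∑ₚ g l
  ∑ₚ-mono []      le = z≤n
  ∑ₚ-mono (x ∷ l) le = +-mono-≤ (le here) (∑ₚ-mono l (le ∘ there))

module Count {A : Set} (χ : A → A → A → ℕ)
  (χ-swapˡ : ∀ a b c → χ a b c ≡ χ b a c) (χ-swapʳ : ∀ a b c → χ a b c ≡ χ a c b) where

  -- Numbers of triples of weight χ with two, one and no prescribed members.
  S : A → A → List A → ℕ
  S a b l = ∑ l (χ a b)

  D : A → List A → ℕ
  D a []      = 0
  D a (b ∷ l) = S a b l + D a l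

  τ : List A → ℕ
  τ []      = 0
  τ (a ∷ l) = D a l + τ l

  S-sym : ∀ a b l → S a b l ≡ S b a l
  S-sym a b l = ∑-cong l (λ {x} _ → χ-swapˡ a b x)

  S-↭ : ∀ a b {k l} → k ↭ l → S a b k ≡ S a b l
  S-↭ a b = ∑-↭ (χ a b)

  D-↭ : ∀ a {k l} → k ↭ l → D a k ≡ D a l
  D-↭ a refl         = refl
  D-↭ a (prep x p)   = cong₂ _+_ (S-↭ a x p) (D-↭ a p)
  D-↭ a {_ ∷ _ ∷ k} {_ ∷ _ ∷ l} (swap x y p) = begin
    χ a x y + S a x k + (S a y k + D a k)  ≡⟨ cong₂ _+_ (cong₂ _+_ (χ-swapʳ a x y) (S-↭ a x p)) (cong₂ _+_ (S-↭ a y p) (D-↭ a p)) ⟩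
    χ a y x + S a x l + (S a y l + D a l)  ≡⟨ rearrange (χ a y x) _ _ _ ⟩
    χ a y x + S a y l + (S a x l + D a l)  ∎
    where
    open ≡-Reasoning
    rearrange : ∀ p q r s → p + q + (r + s) ≡ p + r + (q + s)
    rearrange = solve-∀
  D-↭ a (trans p q)  = ≡.trans (D-↭ a p) (D-↭ a q)

  τ-↭ : ∀ {k l} → k ↭ l → τ k ≡ τ l
  τ-↭ refl        = refl
  τ-↭ (prep x p)  = cong₂ _+_ (D-↭ x p) (τ-↭ p)
  τ-↭ {_ ∷ _ ∷ k} {_ ∷ _ ∷ l} (swap x y p) = begin
    S x y k + D x k + (D y k + τ k)  ≡⟨ cong₂ _+_ (cong₂ _+_ (≡.trans (S-sym x y k) (S-↭ y x p)) (D-↭ x p)) (cong₂ _+_ (D-↭ y p) (τ-↭ p)) ⟩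
    S y x l + D x l + (D y l + τ l)  ≡⟨ rearrange (S y x l) _ _ _ ⟩
    S y x l + D y l + (D x l + τ l)  ∎
    where
    open ≡-Reasoning
    rearrange : ∀ p q r s → p + q + (r + s) ≡ p + r + (q + s)
    rearrange = solve-∀
  τ-↭ (trans p q) = ≡.trans (τ-↭ p) (τ-↭ q)

  D-pick : ∀ a {x l k} → Pick x l k → D a l ≡ S a x k + D a k
  D-pick a p = D-↭ a (pick-↭ p)

  τ-pick : ∀ {x l k} → Pick x l k → τ l ≡ D x k + τ k
  τ-pick p = τ-↭ (pick-↭ p)

  -- The handshake lemma for the graph with edge weights `χ a`: each edge is met from both ends. In
  -- `handshake₃` each triple is met from its three members.
  handshake₂ : ∀ a l → ∑ₚ (S a) l ≡ 2 * D a l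
  handshake₂ a []      = refl
  handshake₂ a (x ∷ l) = begin
    S a x l + ∑ₚ (λ y k → χ a y x + S a y k) l                 ≡⟨ cong (S a x l +_) (∑ₚ-+ (λ y _ → χ a y x) (S a) l) ⟩
    S a x l + (∑ₚ (λ y _ → χ a y x) l + ∑ₚ (S a) l)             ≡⟨ cong (S a x l +_) (cong₂ _+_ (≡.trans (∑ₚ-point (λ y → χ a y x) l) (∑-cong l (λ {y} _ → χ-swapʳ a y x))) (handshake₂ a l)) ⟩
    S a x l + (S a x l + 2 * D a l)                            ≡⟨ rearrange (S a x l) (D a l) ⟩
    2 * (S a x l + D a l)                                      ∎
    where
    open ≡-Reasoning
    rearrange : ∀ p q → p + (p + 2 * q) ≡ 2 * (p + q)
    rearrange = solve-∀

  handshake₃ : ∀ l → ∑ₚ D l ≡ 3 * τ l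
  handshake₃ []      = refl
  handshake₃ (x ∷ l) = begin
    D x l + ∑ₚ (λ y k → S y x k + D y k) l        ≡⟨ cong (D x l +_) (∑ₚ-+ (λ y k → S y x k) D l) ⟩
    D x l + (∑ₚ (λ y k → S y x k) l + ∑ₚ D l)     ≡⟨ cong (D x l +_) (cong₂ _+_ (≡.trans (∑ₚ-cong l (λ {y} {k} _ → S-sym y x k)) (handshake₂ x l)) (handshake₃ l)) ⟩
    D x l + (2 * D x l + 3 * τ l)                 ≡⟨ rearrange (D x l) (τ l) ⟩
    3 * (D x l + τ l)                             ∎
    where
    open ≡-Reasoning
    rearrange : ∀ p q → p + (2 * p + 3 * q) ≡ 3 * (p + q)
    rearrange = solve-∀

  -- Summing τ l = D x k + τ k over the deletions of l.
  average : ∀ l c → (∀ {x k} → Pick x l k → c ≤ τ k) → 3 * τ l + length l * c ≤ length l * τ l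
  average l c h = begin
    3 * τ l + length l * c       ≡⟨ cong₂ _+_ (handshake₃ l) (∑ₚ-const c l) ⟨
    ∑ₚ D l + ∑ₚ (λ _ _ → c) l     ≤⟨ +-monoʳ-≤ (∑ₚ D l) (∑ₚ-mono l h) ⟩
    ∑ₚ D l + ∑ₚ (λ _ k → τ k) l   ≡⟨ ∑ₚ-+ D (λ _ k → τ k) l ⟨
    ∑ₚ (λ x k → D x k + τ k) l   ≡⟨ ∑ₚ-cong l (λ p → sym (τ-pick p)) ⟩
    ∑ₚ (λ _ _ → τ l) l           ≡⟨ ∑ₚ-const (τ l) l ⟩
    length l * τ l               ∎
    where open ≤-Reasoning

module Increasing {n : ℕ} (F : Fin n → Fin n → Fin n → ℕ)
  (F-zero : ∀ i j k → ¬ (i Fin.< j × j Fin.< k) → F i j k ≡ 0) where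

  private
    D′ : Fin n → List (Fin n) → ℕ
    D′ i []      = 0
    D′ i (j ∷ l) = ∑ l (F i j) + D′ i l

  τ′ : List (Fin n) → ℕ
  τ′ []      = 0
  τ′ (i ∷ l) = D′ i l + τ′ l

  private
    ∑∑ : ∀ i l → AllPairs Fin._<_ l → ∑ l (λ j → ∑ l (F i j)) ≡ D′ i l
    ∑∑ i []      _          = refl
    ∑∑ i (j ∷ l) (j<l ∷ l<) = begin
      F i j j + ∑ l (F i j) + ∑ l (λ j′ → F i j′ j + ∑ l (F i j′))
        ≡⟨ cong₂ _+_ (cong (_+ ∑ l (F i j)) (F-zero i j j (Fin.<-irrefl refl ∘ proj₂)))
                     (∑-cong l (λ {j′} ∈l → cong (_+ ∑ l (F i j′)) (F-zero i j′ j (Fin.<-asym (All.lookup j<l ∈l) ∘ proj₂)))) ⟩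
      ∑ l (F i j) + ∑ l (λ j′ → ∑ l (F i j′))
        ≡⟨ cong (∑ l (F i j) +_) (∑∑ i l l<) ⟩
      D′ i (j ∷ l) ∎
      where open ≡-Reasoning

  -- The list ascends, so a triple of nonzero weight contains its first point i at most once and
  -- only in the first place. Splitting i off leaves `D′ i l` and the sum over the tail.
  ∑∑∑ : ∀ l → AllPairs Fin._<_ l → ∑ l (λ i → ∑ l (λ j → ∑ l (F i j))) ≡ τ′ l
  ∑∑∑ []      _          = refl
  ∑∑∑ (i ∷ l) (i<l ∷ l<) = cong₂ _+_ head (≡.trans (∑-cong l tail) (∑∑∑ l l<))
    where
    head : ∑ (i ∷ l) (λ j → ∑ (i ∷ l) (F i j)) ≡ D′ i l
    head = ≡.trans
      (cong₂ _+_ (∑-zero (i ∷ l) (λ {k} _ → F-zero i i k (Fin.<-irrefl refl ∘ proj₁)))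
                 (∑-cong l (λ {j} j∈ → cong (_+ ∑ l (F i j)) (F-zero i j i (Fin.<-asym (All.lookup i<l j∈) ∘ proj₂)))))
      (∑∑ i l l<)
    tail : ∀ {i′} → i′ ∈ l → ∑ (i ∷ l) (λ j → ∑ (i ∷ l) (F i′ j)) ≡ ∑ l (λ j → ∑ l (F i′ j))
    tail {i′} i′∈ = cong₂ _+_
      (∑-zero (i ∷ l) (λ {k} _ → F-zero i′ i k (Fin.<-asym (All.lookup i<l i′∈) ∘ proj₁)))
      (∑-cong l (λ {j} j∈ → cong (_+ ∑ l (F i′ j)) (F-zero i′ j i (Fin.<-asym (All.lookup i<l j∈) ∘ proj₂))))

  module _ {A : Set} (χ : A → A → A → ℕ) (f : Fin n → A)
    (χ-swapˡ : ∀ a b c → χ a b c ≡ χ b a c) (χ-swapʳ : ∀ a b c → χ a b c ≡ χ a c b)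
    (F-χ : ∀ i j k → i Fin.< j → j Fin.< k → F i j k ≡ χ (f i) (f j) (f k)) where
    open Count χ χ-swapˡ χ-swapʳ

    private
      ∑-χ : ∀ i j l → i Fin.< j → All (j Fin.<_) l → ∑ l (F i j) ≡ S (f i) (f j) (map f l)
      ∑-χ i j []      i<j _         = refl
      ∑-χ i j (k ∷ l) i<j (lt ∷ j<) = cong₂ _+_ (F-χ i j k i<j lt) (∑-χ i j l i<j j<)

      D′-χ : ∀ i l → All (i Fin.<_) l → AllPairs Fin._<_ l → D′ i l ≡ D (f i) (map f l)
      D′-χ i []      _          _         = refl
      D′-χ i (j ∷ l) (i<j ∷ i<) (j< ∷ l<) = cong₂ _+_ (∑-χ i j l i<j j<) (D′-χ i l i< l<)

    τ′-χ : ∀ l → AllPairs Fin._<_ l → τ′ l ≡ τ (map f l)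
    τ′-χ []      _         = refl
    τ′-χ (i ∷ l) (i< ∷ l<) = cong₂ _+_ (D′-χ i l i< l<) (τ′-χ l l<)

-- Lines

module Plane (𝓑 : BetweennessStructure) where
  open BetweennessStructure 𝓑

  col-cases : ∀ {a b c} → Collinear a b c → β a b c ⊎ β b a c ⊎ β a c b
  col-cases (inj₁ p)                             = inj₁ p
  col-cases (inj₂ (inj₁ p))                      = inj₂ (inj₂ p)
  col-cases (inj₂ (inj₂ (inj₁ p)))               = inj₂ (inj₁ p)
  col-cases (inj₂ (inj₂ (inj₂ (inj₁ p))))        = inj₂ (inj₂ (P2 _ _ _ p))
  col-cases (inj₂ (inj₂ (inj₂ (inj₂ (inj₁ p))))) = inj₂ (inj₁ (P2 _ _ _ p))
  col-cases (inj₂ (inj₂ (inj₂ (inj₂ (inj₂ p))))) = inj₁ (P2 _ _ _ p)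

  col-swapˡ : ∀ {a b c} → Collinear a b c → Collinear b a c
  col-swapˡ p with col-cases p
  ... | inj₁ q        = inj₂ (inj₂ (inj₁ q))
  ... | inj₂ (inj₁ q) = inj₁ q
  ... | inj₂ (inj₂ q) = inj₂ (inj₂ (inj₂ (inj₁ q)))

  col-swapʳ : ∀ {a b c} → Collinear a b c → Collinear a c b
  col-swapʳ p with col-cases p
  ... | inj₁ q        = inj₂ (inj₁ q)
  ... | inj₂ (inj₁ q) = inj₂ (inj₂ (inj₂ (inj₂ (inj₁ q))))
  ... | inj₂ (inj₂ q) = inj₁ q

  col-degenerate : ∀ {a b} → Collinear a a b
  col-degenerate = inj₁ (P1 _ _)

  -- The four betweennesses of four points in the order w x y z.
  outˡ : ∀ {w x y z} → β w x y → β w y z → β w x z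
  outˡ p q = proj₁ (P4 _ _ _ _ q p)

  outʳ : ∀ {w x y z} → β w x y → β w y z → β x y z
  outʳ p q = proj₂ (P4 _ _ _ _ q p)

  inʳ : ∀ {w x y z} → β x y z → β w x z → β w y z
  inʳ p q = P2 _ _ _ (outˡ (P2 _ _ _ p) (P2 _ _ _ q))

  inˡ : ∀ {w x y z} → β x y z → β w x z → β w x y
  inˡ p q = P2 _ _ _ (outʳ (P2 _ _ _ p) (P2 _ _ _ q))

  χ : X → X → X → ℕ
  χ a b c = indicator (λ t → ¬? (collinear? (proj₁ t) (proj₁ (proj₂ t)) (proj₂ (proj₂ t)))) (a , b , c)

  χ-col : ∀ {a b c} → Collinear a b c → χ a b c ≡ 0
  χ-col {a} {b} {c} p with collinear? a b c
  ... | yes _ = refl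
  ... | no ¬p = contradiction p ¬p

  χ-¬col : ∀ {a b c} → ¬ Collinear a b c → χ a b c ≡ 1
  χ-¬col {a} {b} {c} ¬p with collinear? a b c
  ... | yes p = contradiction p ¬p
  ... | no  _ = refl

  col-χ : ∀ {a b c} → χ a b c ≡ 0 → Collinear a b c
  col-χ {a} {b} {c} eq with collinear? a b c
  ... | yes p = p
  col-χ () | no _

  χ≤1 : ∀ a b c → χ a b c ≤ 1
  χ≤1 a b c with collinear? a b c
  ... | yes _ = z≤n
  ... | no  _ = ≤-refl

  χ-cong : ∀ {a b c d e f} → (Collinear a b c → Collinear d e f) →
           (Collinear d e f → Collinear a b c) → χ a b c ≡ χ d e f
  χ-cong {a} {b} {c} f g with collinear? a b c
  ... | yes p = sym (χ-col (f p))
  ... | no ¬p = sym (χ-¬col (¬p ∘ g))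

  χ-swapˡ : ∀ a b c → χ a b c ≡ χ b a c
  χ-swapˡ a b c = χ-cong col-swapˡ col-swapˡ

  χ-swapʳ : ∀ a b c → χ a b c ≡ χ a c b
  χ-swapʳ a b c = χ-cong col-swapʳ col-swapʳ

  open Count χ χ-swapˡ χ-swapʳ public

  points : List X
  points = map point (allFin order)

  -- `coSize` is tied to the enumeration, while `τ` is invariant under `↭`; from here on the points
  -- can be rearranged freely.
  coSize≡τ : BetweennessStructure.coSize 𝓑 ≡ τ points
  coSize≡τ = begin
    length triangles
      ≡⟨ length-filter isTriangle? (cartesianProduct′ (cartesianProduct′ (allFin order))) ⟩
    ∑ (cartesianProduct′ (cartesianProduct′ (allFin order))) (indicator isTriangle?)
      ≡⟨ ∑-cartesianProduct (indicator isTriangle?) (allFin order) _ ⟩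
    ∑ (allFin order) (λ i → ∑ (cartesianProduct′ (allFin order)) (λ t → indicator isTriangle? (i , t)))
      ≡⟨ ∑-cong (allFin order) (λ {i} _ → ∑-cartesianProduct (λ t → indicator isTriangle? (i , t)) (allFin order) (allFin order)) ⟩
    ∑ (allFin order) (λ i → ∑ (allFin order) (λ j → ∑ (allFin order) (F i j)))
      ≡⟨ ∑∑∑ (allFin order) sorted ⟩
    τ′ (allFin order)
      ≡⟨ τ′-χ χ point χ-swapˡ χ-swapʳ F-χ (allFin order) sorted ⟩
    τ points ∎
    where
    open ≡-Reasoning
    cartesianProduct′ : ∀ {C : Set} → List C → List (Fin.Fin order × C)
    cartesianProduct′ = cartesianProduct (allFin order)
    sorted : AllPairs Fin._<_ (allFin order)
    sorted = AllPairs.tabulate⁺-< id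
    F : (i j k : Fin.Fin order) → ℕ
    F i j k = indicator isTriangle? (i , j , k)
    F-zero : ∀ i j k → ¬ (i Fin.< j × j Fin.< k) → F i j k ≡ 0
    F-zero i j k ¬lt with isTriangle? (i , j , k)
    ... | yes (i<j , j<k , _) = contradiction (i<j , j<k) ¬lt
    ... | no  _               = refl
    F-χ : ∀ i j k → i Fin.< j → j Fin.< k → F i j k ≡ χ (point i) (point j) (point k)
    F-χ i j k i<j j<k with isTriangle? (i , j , k)
    ... | yes (_ , _ , ¬c) = sym (χ-¬col ¬c)
    ... | no ¬t with collinear? (point i) (point j) (point k)
    ...   | yes _ = refl
    ...   | no ¬c = contradiction (i<j , j<k , ¬c) ¬t
    open Increasing F F-zero

  Distinct : List X → Set
  Distinct l = ∀ {a b} → a ∷ b ∷ [] ⊆ l → a ≢ b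

  Fresh : X → List X → Set
  Fresh p l = ∀ {a} → a ∈ l → p ≢ a

  -- Sublists of two and three elements stand for pairs and triples in the order of the line, so
  -- passing to a part of a line is transitivity of `⊆`.
  record Line (l : List X) : Set where
    field
      distinct : Distinct l
      between  : ∀ {a b c} → a ∷ b ∷ c ∷ [] ⊆ l → β a b c
  open Line public

  line-⊆ : ∀ {k l} → k ⊆ l → Line l → Line k
  line-⊆ σ L = record { distinct = λ τ → distinct L (⊆-trans τ σ) ; between = λ τ → between L (⊆-trans τ σ) }

  distinct-⊆ : ∀ {k l} → k ⊆ l → Distinct l → Distinct k
  distinct-⊆ σ d τ = d (⊆-trans τ σ)

  pick-⊆ : ∀ {x : X} {l k} → Pick x l k → k ⊆ l
  pick-⊆ here      = _ ∷ʳ ⊆-refl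
  pick-⊆ (there p) = refl ∷ pick-⊆ p

  line-pick : ∀ {x l k} → Pick x l k → Line l → Line k
  line-pick = line-⊆ ∘ pick-⊆

  fresh-pick : ∀ {p x l k} → Pick x l k → Fresh p l → Fresh p k
  fresh-pick i f = f ∘ Any-resp-⊆ (pick-⊆ i)

  ∷-line : ∀ {a l} → Fresh a l → (∀ {x y} → x ∷ y ∷ [] ⊆ l → β a x y) → Line l → Line (a ∷ l)
  ∷-line f h L .distinct (refl ∷ τ) = f (to∈ τ)
  ∷-line f h L .distinct (_ ∷ʳ τ)   = distinct L τ
  ∷-line f h L .between (refl ∷ τ)  = h τ
  ∷-line f h L .between (_ ∷ʳ τ)    = between L τ

  head< : ∀ {b y : X} {l} → y ∈ l → b ∷ y ∷ [] ⊆ b ∷ l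
  head< y∈ = refl ∷ from∈ y∈

  -- It is enough to compare a with b and each later y: for x between b and y on the line, β b x y
  -- and β a b y give β a x y.
  extend : ∀ {a b l} → Fresh a (b ∷ l) → (∀ {y} → y ∈ l → β a b y) → Line (b ∷ l) → Line (a ∷ b ∷ l)
  extend {a} {b} {l} f h L = ∷-line f ord L
    where
    ord : ∀ {x y} → x ∷ y ∷ [] ⊆ b ∷ l → β a x y
    ord (refl ∷ τ) = h (to∈ τ)
    ord (_ ∷ʳ τ)   = inʳ (between L (refl ∷ τ)) (h (to∈ (⊆-trans (_ ∷ʳ ⊆-refl) τ)))

  Fresh-∷ : ∀ {a b l} → a ≢ b → Fresh a l → Fresh a (b ∷ l)
  Fresh-∷ ne f (here refl) = ne
  Fresh-∷ ne f (there i)   = f i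

  line-fresh : ∀ {a l} → Line (a ∷ l) → Fresh a l
  line-fresh L i = distinct L (refl ∷ from∈ i)

  line-tail : ∀ {a l} → Line (a ∷ l) → Line l
  line-tail = line-⊆ (_ ∷ʳ ⊆-refl)

  fresh-insert : ∀ {a p} u {v} → a ≢ p → Fresh a (u ++ v) → Fresh a (u ++ p ∷ v)
  fresh-insert u ne f i with ∈-++⁻ u i
  ... | inj₁ j           = f (∈-++⁺ˡ j)
  ... | inj₂ (here refl) = ne
  ... | inj₂ (there j)   = f (∈-++⁺ʳ u j)

  middle-unique : ∀ {a b c} → β a b c → β b a c → a ≡ b
  middle-unique = P3 _ _ _

  middle-uniqueʳ : ∀ {a b c} → β a b c → β a c b → b ≡ c
  middle-uniqueʳ p q = P3 _ _ _ (P2 _ _ _ q) (P2 _ _ _ p)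

  ColWith : X → List X → Set
  ColWith p l = ∀ {a b} → a ∷ b ∷ [] ⊆ l → Collinear p a b

  Insertion : X → List X → Set
  Insertion p l = ∃[ u ] ∃[ v ] (l ≡ u ++ v × Line (u ++ p ∷ v))

  line-singleton : ∀ {a} → Line (a ∷ [])
  line-singleton .distinct (_ ∷ʳ ())
  line-singleton .distinct (refl ∷ ())
  line-singleton .between (_ ∷ʳ ())
  line-singleton .between (refl ∷ ())

  line-pair : ∀ {a b} → a ≢ b → Line (a ∷ b ∷ [])
  line-pair ne = extend (Fresh-∷ ne λ ()) (λ ()) line-singleton

  -- β a b p places p beyond b, and the next point c tells whether p belongs before c or further on.
  insert-after : ∀ {p a b} l → Line (a ∷ b ∷ l) → Fresh p (a ∷ b ∷ l) → ColWith p (a ∷ b ∷ l) → β a b p →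
                 ∃[ u ] ∃[ v ] (l ≡ u ++ v × Line (a ∷ b ∷ u ++ p ∷ v))
  insert-after {p} {a} {b} [] L f col abp =
    [] , [] , refl , extend (Fresh-∷ (distinct L ⊆-refl) (Fresh-∷ (f (here refl) ∘ sym) λ ()))
                       (λ { (here refl) → abp }) (line-pair (f (there (here refl)) ∘ sym))
  insert-after {p} {a} {b} (c ∷ l) L f col abp with col-cases (col (a ∷ʳ refl ∷ refl ∷ minimum l))
  -- Here b lies between any two of a, c and p, which is incompatible with each of the three orders
  -- of p, a, c.
  ... | inj₁ pbc = ⊥-elim (absurd (col-cases (col (refl ∷ b ∷ʳ refl ∷ minimum l))))
    where
    abc = between L (refl ∷ refl ∷ refl ∷ minimum l)
    absurd : β p a c ⊎ β a p c ⊎ β p c a → ⊥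
    absurd (inj₁ pac)        = distinct L (refl ∷ refl ∷ minimum _) (middle-unique abc (outʳ (P2 _ _ _ abp) pac))
    absurd (inj₂ (inj₁ apc)) = f (there (here refl)) (middle-unique pbc (outʳ abp apc))
    absurd (inj₂ (inj₂ pca)) = distinct L (a ∷ʳ refl ∷ refl ∷ minimum l)
      (middle-uniqueʳ pbc (P2 _ _ _ (outʳ abc (P2 _ _ _ pca))))
  ... | inj₂ (inj₁ bpc) = [] , c ∷ l , refl ,
    extend (fresh-insert (b ∷ []) (f (here refl) ∘ sym) (line-fresh L)) aby
      (extend (Fresh-∷ (f (there (here refl)) ∘ sym) (line-fresh L′)) bpx
        (extend (λ i → f (there (there i))) (λ i → outʳ bpc (between L′ (refl ∷ refl ∷ from∈ i))) (line-tail L′)))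
    where
    L′ = line-tail L
    bpx : ∀ {x} → x ∈ c ∷ l → β b p x
    bpx (here refl) = bpc
    bpx (there i)   = outˡ bpc (between L′ (refl ∷ refl ∷ from∈ i))
    aby : ∀ {y} → y ∈ p ∷ c ∷ l → β a b y
    aby (here refl) = abp
    aby (there i)   = between L (refl ∷ refl ∷ from∈ i)
  ... | inj₂ (inj₂ pcb) with insert-after l (line-tail L) (f ∘ there) (λ τ → col (a ∷ʳ τ)) (P2 _ _ _ pcb)
  ...   | u , v , refl , L′ = c ∷ u , v , refl , extend (fresh-insert (b ∷ c ∷ u) (f (here refl) ∘ sym) (line-fresh L)) aby L′
    where
    aby : ∀ {y} → y ∈ c ∷ u ++ p ∷ v → β a b y
    aby i with ∈-++⁻ (c ∷ u) i
    ... | inj₁ j           = between L (refl ∷ refl ∷ from∈ (∈-++⁺ˡ j))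
    ... | inj₂ (here refl) = abp
    ... | inj₂ (there j)   = between L (refl ∷ refl ∷ from∈ (∈-++⁺ʳ (c ∷ u) j))

  insert-middle : ∀ {p a b} l → Line (a ∷ b ∷ l) → Fresh p (a ∷ b ∷ l) → β a p b → Line (a ∷ p ∷ b ∷ l)
  insert-middle {p} {a} {b} l L f apb = extend (Fresh-∷ (f (here refl) ∘ sym) (line-fresh L)) apy
    (extend (f ∘ there) (λ i → outʳ apb (between L (refl ∷ refl ∷ from∈ i))) (line-tail L))
    where
    apy : ∀ {y} → y ∈ b ∷ l → β a p y
    apy (here refl) = apb
    apy (there i)   = outˡ apb (between L (refl ∷ refl ∷ from∈ i))

  -- The second alternative is the 4-cycle p a b x, in which p is opposite to b.
  before : ∀ {p a b l} → Line (a ∷ b ∷ l) → Fresh p (a ∷ b ∷ l) → ColWith p (a ∷ b ∷ l) → β p a b →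
           ∀ {x} → x ∈ l → β p a x ⊎ (β a p x × β b x p)
  before {p} {a} {b} L f col pab {x} i with col-cases (col (refl ∷ b ∷ʳ from∈ i))
  ... | inj₁ pax        = inj₁ pax
  ... | inj₂ (inj₂ pxa) = contradiction (middle-uniqueʳ pab (P2 _ _ _ (outˡ abx (P2 _ _ _ pxa)))) (distinct L (refl ∷ refl ∷ minimum _))
    where abx = between L (refl ∷ refl ∷ from∈ i)
  ... | inj₂ (inj₁ apx) with col-cases (col (a ∷ʳ refl ∷ from∈ i))
  ...   | inj₁ pbx        = contradiction (middle-unique pab (inˡ pbx apx)) (f (here refl))
  ...   | inj₂ (inj₁ bpx) = contradiction (middle-uniqueʳ pab (P2 _ _ _ (inˡ bpx abx))) (distinct L (refl ∷ refl ∷ minimum _))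
    where abx = between L (refl ∷ refl ∷ from∈ i)
  ...   | inj₂ (inj₂ pxb) = inj₂ (apx , P2 _ _ _ pxb)

  -- The 4-cycle a b c p, with p opposite to b.
  Cycle : X → X → X → X → Set
  Cycle a b c p = β p a b × β a p c × β b c p

  insert₃ : ∀ {p a b c} → Line (a ∷ b ∷ c ∷ []) → Fresh p (a ∷ b ∷ c ∷ []) → ColWith p (a ∷ b ∷ c ∷ []) →
            Insertion p (a ∷ b ∷ c ∷ []) ⊎ Cycle a b c p
  insert₃ {p} {a} {b} {c} L f col with col-cases (col (refl ∷ refl ∷ minimum _))
  ... | inj₂ (inj₁ apb) = inj₁ (a ∷ [] , b ∷ c ∷ [] , refl , insert-middle _ L f apb)
  ... | inj₂ (inj₂ pba) with insert-after _ L f col (P2 _ _ _ pba)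
  ...   | u , v , eq , L′ = inj₁ (a ∷ b ∷ u , v , cong (λ l → a ∷ b ∷ l) eq , L′)
  insert₃ {p} {a} {b} {c} L f col | inj₁ pab with before L f col pab (here refl)
  ...   | inj₁ pac         = inj₁ ([] , a ∷ b ∷ c ∷ [] , refl , extend f (λ { (here refl) → pab ; (there (here refl)) → pac }) L)
  ...   | inj₂ (apc , bcp) = inj₂ (pab , apc , bcp)

  -- A fourth point excludes the 4-cycle left open by `insert₃`. If p precedes a and b, take two
  -- later points x and y: whether one or both of them close a 4-cycle with p, a, b, their order on
  -- the line is contradicted.
  insert : ∀ {p} l → 4 ≤ length l → Line l → Fresh p l → ColWith p l → Insertion p l
  insert {p} (a ∷ b ∷ l@(_ ∷ _ ∷ _)) (s≤s (s≤s (s≤s (s≤s z≤n)))) L f col with col-cases (col (refl ∷ refl ∷ minimum _))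
  ... | inj₂ (inj₁ apb) = a ∷ [] , b ∷ l , refl , insert-middle _ L f apb
  ... | inj₂ (inj₂ pba) with insert-after _ L f col (P2 _ _ _ pba)
  ...   | u , v , eq , L′ = a ∷ b ∷ u , v , cong (λ l → a ∷ b ∷ l) eq , L′
  insert {p} (a ∷ b ∷ l@(c ∷ d ∷ l′)) _ L f col | inj₁ pab = [] , a ∷ b ∷ l , refl , extend f pay L
    where
    far : ∀ {x y} → x ∷ y ∷ [] ⊆ l → β p a x × β p a y
    far {x} {y} τ with before L f col pab (to∈ τ) | before L f col pab (to∈ (⊆-trans (_ ∷ʳ ⊆-refl) τ))
    ... | inj₁ pax         | inj₁ pay         = pax , pay
    ... | inj₁ pax         | inj₂ (_ , byp)   = contradiction
      (middle-uniqueʳ (between L (refl ∷ refl ∷ from∈ (to∈ τ))) (outʳ pax (P2 _ _ _ (outˡ (between L (a ∷ʳ refl ∷ τ)) byp))))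
      (distinct L (a ∷ʳ refl ∷ from∈ (to∈ τ)))
    ... | inj₂ (apx , _)   | inj₁ pay         = contradiction
      (middle-unique pay (outˡ apx (between L (refl ∷ b ∷ʳ τ)))) (f (here refl))
    ... | inj₂ (apx , bxp) | inj₂ (apy , byp) = contradiction
      (middle-uniqueʳ (outʳ apx (between L (refl ∷ b ∷ʳ τ))) (P2 _ _ _ (outʳ (between L (a ∷ʳ refl ∷ τ)) byp)))
      (distinct L (a ∷ʳ b ∷ʳ τ))
    pay : ∀ {y} → y ∈ b ∷ l → β p a y
    pay (here refl)         = pab
    pay (there (here refl)) = proj₁ (far (refl ∷ refl ∷ minimum l′))
    pay (there (there i))   = proj₂ (far (refl ∷ from∈ i))

-- Stars: a point collinear with all pairs of a line that avoid one point w

module Star (𝓑 : BetweennessStructure) where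
  open BetweennessStructure 𝓑
  open Plane 𝓑

  S-col : ∀ {p w} l → (∀ {x} → x ∈ l → Collinear p w x) → S p w l ≡ 0
  S-col l c = ∑-zero l (χ-col ∘ c)

  col-S : ∀ {p w} l → S p w l ≡ 0 → ∀ {x} → x ∈ l → Collinear p w x
  col-S (y ∷ l) eq (here refl) = col-χ (m+n≡0⇒m≡0 _ eq)
  col-S (y ∷ l) eq (there i)   = col-S l (m+n≡0⇒n≡0 (χ _ _ y) eq) i

  S-¬col : ∀ {p w} l → (∀ {x} → x ∈ l → ¬ Collinear p w x) → S p w l ≡ length l
  S-¬col []      c = refl
  S-¬col (x ∷ l) c = cong₂ _+_ (χ-¬col (c (here refl))) (S-¬col l (c ∘ there))

  S≤length : ∀ p w l → S p w l ≤ length l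
  S≤length p w l = subst (S p w l ≤_) (*-identityʳ _) (∑-≤ l 1 (λ {x} _ → χ≤1 p w x))

  D⇒colWith : ∀ {p} l → D p l ≡ 0 → ColWith p l
  D⇒colWith (a ∷ l) eq (refl ∷ τ) = col-S l (m+n≡0⇒m≡0 _ eq) (to∈ τ)
  D⇒colWith (a ∷ l) eq (_ ∷ʳ τ)   = D⇒colWith l (m+n≡0⇒n≡0 (S _ a l) eq) τ

  colWith⇒D : ∀ {p} l → ColWith p l → D p l ≡ 0
  colWith⇒D []      c = refl
  colWith⇒D (a ∷ l) c = cong₂ _+_ (S-col l (λ i → c (head< i))) (colWith⇒D l (λ τ → c (a ∷ʳ τ)))

  line-τ : ∀ {l} → Line l → τ l ≡ 0
  line-τ {[]}    L = refl
  line-τ {a ∷ l} L = cong₂ _+_ (colWith⇒D l (λ τ → inj₁ (between L (refl ∷ τ)))) (line-τ (line-tail L))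

  Free : List X → Set
  Free l = ∀ {x y z} → x ∈ l → y ∈ l → z ∈ l → Collinear x y z

  D⇒free : ∀ {p} l → D p l ≡ 0 → ∀ {x y} → x ∈ l → y ∈ l → Collinear p x y
  D⇒free (a ∷ l) eq (here refl) (here refl) = col-swapˡ (col-swapʳ col-degenerate)
  D⇒free (a ∷ l) eq (here refl) (there j)   = col-S l (m+n≡0⇒m≡0 _ eq) j
  D⇒free (a ∷ l) eq (there i)   (here refl) = col-swapʳ (col-S l (m+n≡0⇒m≡0 _ eq) i)
  D⇒free (a ∷ l) eq (there i)   (there j)   = D⇒free l (m+n≡0⇒n≡0 (S _ a l) eq) i j

  τ⇒free : ∀ l → τ l ≡ 0 → Free l
  τ⇒free (a ∷ l) eq (here refl) (here refl) k           = col-degenerate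
  τ⇒free (a ∷ l) eq (here refl) (there j)   (here refl) = col-swapʳ col-degenerate
  τ⇒free (a ∷ l) eq (here refl) (there j)   (there k)   = D⇒free l (m+n≡0⇒m≡0 _ eq) j k
  τ⇒free (a ∷ l) eq (there i)   (here refl) (here refl) = col-swapˡ (col-swapʳ col-degenerate)
  τ⇒free (a ∷ l) eq (there i)   (here refl) (there k)   = col-swapˡ (D⇒free l (m+n≡0⇒m≡0 _ eq) i k)
  τ⇒free (a ∷ l) eq (there i)   (there j)   (here refl) = col-swapʳ (col-swapˡ (D⇒free l (m+n≡0⇒m≡0 _ eq) i j))
  τ⇒free (a ∷ l) eq (there i)   (there j)   (there k)   = τ⇒free l (m+n≡0⇒n≡0 (D a l) eq) i j k

  distinct-∷ : ∀ {a l} → Fresh a l → Distinct l → Distinct (a ∷ l)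
  distinct-∷ f d (refl ∷ τ) = f (to∈ τ)
  distinct-∷ f d (_ ∷ʳ τ)   = d τ

  distinct-fresh : ∀ {a l} → Distinct (a ∷ l) → Fresh a l
  distinct-fresh d i = d (head< i)

  distinct-tail : ∀ {a l} → Distinct (a ∷ l) → Distinct l
  distinct-tail = distinct-⊆ (_ ∷ʳ ⊆-refl)

  distinct-↭ : ∀ {k l} → k ↭ l → Distinct k → Distinct l
  distinct-↭ refl         d = d
  distinct-↭ (prep x p)   d = distinct-∷ (distinct-fresh d ∘ Perm.∈-resp-↭ (↭-sym p)) (distinct-↭ p (distinct-tail d))
  distinct-↭ (swap x y p) d = distinct-∷
    (Fresh-∷ (distinct-fresh d (here refl) ∘ sym) (distinct-fresh (distinct-tail d) ∘ Perm.∈-resp-↭ (↭-sym p)))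
    (distinct-∷ (λ i → distinct-fresh d (there (Perm.∈-resp-↭ (↭-sym p) i))) (distinct-↭ p (distinct-tail (distinct-tail d))))
  distinct-↭ (trans p q)  d = distinct-↭ q (distinct-↭ p d)

  Linear : List X → Set
  Linear k = ∃[ l ] (Line l × l ↭ k)

  linear-↭ : ∀ {k l} → k ↭ l → Linear k → Linear l
  linear-↭ p (l , L , q) = l , L , ↭-trans q p

  free-colWith : ∀ {p l k} → Free k → p ∈ k → (∀ {x} → x ∈ l → x ∈ k) → ColWith p l
  free-colWith fr i inc τ = fr i (inc (to∈ τ)) (inc (to∈ (⊆-trans (_ ∷ʳ ⊆-refl) τ)))

  insert-linear : ∀ {p l k} → 4 ≤ length l → Line l → p ∷ l ↭ k → Distinct k → Free k → Linear k
  insert-linear {p} {l} 4≤ L perm d fr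
    with insert l 4≤ L (distinct-fresh (distinct-↭ (↭-sym perm) d))
           (free-colWith fr (Perm.∈-resp-↭ perm (here refl)) (λ i → Perm.∈-resp-↭ perm (there i)))
  ... | u , v , refl , L′ = u ++ p ∷ v , L′ , ↭-trans (Perm.shift p u v) perm

  insert₃-linear : ∀ {p q a b c k} → Line (a ∷ b ∷ c ∷ []) → p ∷ q ∷ a ∷ b ∷ c ∷ [] ↭ k → Distinct k → Free k →
                   Linear k ⊎ Cycle a b c q
  insert₃-linear {p} {q} {a} {b} {c} L perm d fr
    with insert₃ L (distinct-fresh (distinct-tail (distinct-↭ (↭-sym perm) d)))
           (free-colWith fr (Perm.∈-resp-↭ perm (there (here refl))) (λ i → Perm.∈-resp-↭ perm (there (there i))))
  ... | inj₂ cycle              = inj₂ cycle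
  ... | inj₁ (u , v , eq , L′) = inj₁ (insert-linear
    (≤-reflexive (sym (Perm.↭-length perm₄))) L′ (↭-trans (prep p perm₄) perm) d fr)
    where
    perm₄ : u ++ q ∷ v ↭ q ∷ a ∷ b ∷ c ∷ []
    perm₄ = subst (λ l → u ++ q ∷ v ↭ q ∷ l) (sym eq) (Perm.shift q u v)

  -- If both d and e are opposite to b in 4-cycles on a b c, then insert a and e into b c d.
  five-linear : ∀ {a b c d e} → Distinct (a ∷ b ∷ c ∷ d ∷ e ∷ []) → Free (a ∷ b ∷ c ∷ d ∷ e ∷ []) → β a b c →
                Linear (a ∷ b ∷ c ∷ d ∷ e ∷ [])
  five-linear {a} {b} {c} {d} {e} dis fr abc = step₁
    where
    L₃ : ∀ {i j k} → i ∷ j ∷ k ∷ [] ⊆ a ∷ b ∷ c ∷ d ∷ e ∷ [] → β i j k → Line (i ∷ j ∷ k ∷ [])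
    L₃ σ ijk = extend (distinct-fresh (distinct-⊆ σ dis)) (λ { (here refl) → ijk })
                 (line-pair (dis (⊆-trans (_ ∷ʳ ⊆-refl) σ)))
    step₁ : Linear (a ∷ b ∷ c ∷ d ∷ e ∷ [])
    step₁ with insert₃-linear (L₃ (refl ∷ refl ∷ refl ∷ minimum _) abc)
                 (trans (swap e d refl) (Perm.++-comm (d ∷ e ∷ []) (a ∷ b ∷ c ∷ []))) dis fr
             | insert₃-linear (L₃ (refl ∷ refl ∷ refl ∷ minimum _) abc)
                 (Perm.++-comm (d ∷ e ∷ []) (a ∷ b ∷ c ∷ [])) dis fr
    ... | inj₁ lin           | _        = lin
    ... | inj₂ _             | inj₁ lin = lin
    ... | inj₂ (_ , _ , bcd) | inj₂ (_ , _ , bce)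
      with insert₃-linear (L₃ (a ∷ʳ refl ∷ refl ∷ refl ∷ minimum _) bcd) (prep a (Perm.∷↭∷ʳ e (b ∷ c ∷ d ∷ []))) dis fr
    ...   | inj₁ lin           = lin
    ...   | inj₂ (ebc , _ , _) = contradiction
      (middle-uniqueʳ ebc (P2 _ _ _ bce)) (dis (a ∷ʳ refl ∷ refl ∷ minimum _))

  free-↭ : ∀ {k l} → k ↭ l → Free k → Free l
  free-↭ {k} {l} p fr i j h = fr (back i) (back j) (back h)
    where
    back : ∀ {x} → x ∈ l → x ∈ k
    back = Perm.∈-resp-↭ (↭-sym p)

  -- The statement fails for four points, because of the 4-cycle. A permutation brings the collinear
  -- triple a, b, c into the order that `five-linear` assumes.
  linear₅ : ∀ l → length l ≡ 5 → Distinct l → τ l ≡ 0 → Linear l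
  linear₅ (a ∷ b ∷ c ∷ d ∷ e ∷ []) refl dis eq = go (τ⇒free _ eq)
    where
    go : Free (a ∷ b ∷ c ∷ d ∷ e ∷ []) → Linear (a ∷ b ∷ c ∷ d ∷ e ∷ [])
    go fr with col-cases (fr (here refl) (there (here refl)) (there (there (here refl))))
    ... | inj₁ abc        = five-linear dis fr abc
    ... | inj₂ (inj₁ bac) = linear-↭ (swap b a refl)
      (five-linear (distinct-↭ (swap a b refl) dis) (free-↭ (swap a b refl) fr) bac)
    ... | inj₂ (inj₂ acb) = linear-↭ (prep a (swap c b refl))
      (five-linear (distinct-↭ (prep a (swap b c refl)) dis) (free-↭ (prep a (swap b c refl)) fr) acb)

  Ray : X → List X → Set
  Ray w l = ∀ {x y} → x ∷ y ∷ [] ⊆ l → β w x y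

  NoneCol AllCol : X → X → List X → Set
  NoneCol p w l = ∀ {x} → x ∈ l → ¬ Collinear p w x
  AllCol  p w l = ∀ {x} → x ∈ l → Collinear p w x

  data Side (p w : X) : List X → Set where
    none : ∀ {l} → NoneCol p w l → Side p w l
    one  : ∀ {a l} → β w a p → NoneCol p w l → Side p w (a ∷ l)

  ordered : ∀ {l : List X} {x y} → x ∈ l → y ∈ l → x ≡ y ⊎ (x ∷ y ∷ [] ⊆ l) ⊎ (y ∷ x ∷ [] ⊆ l)
  ordered (here refl) (here refl) = inj₁ refl
  ordered (here refl) (there j)   = inj₂ (inj₁ (head< j))
  ordered (there i)   (here refl) = inj₂ (inj₂ (head< i))
  ordered (there i)   (there j)   = Sum.map₂ (Sum.map (_ ∷ʳ_) (_ ∷ʳ_)) (ordered i j)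

  col-middle : ∀ {p w x} → β x w p → Collinear p w x
  col-middle xwp = inj₁ (P2 _ _ _ xwp)

  col-between : ∀ {p w x} → β w x p → Collinear p w x
  col-between wxp = inj₂ (inj₁ (P2 _ _ _ wxp))

  -- P4 carries β p w x outward to the points after x, and β x w p back to the points before x.
  spread : ∀ {p w x} l → Ray w l → Ray p l → x ∈ l → β x w p → AllCol p w l
  spread l rw rp i xwp j with ordered i j
  ... | inj₁ refl     = col-middle xwp
  ... | inj₂ (inj₁ τ) = inj₁ (proj₁ (P4 _ _ _ _ (rp τ) (P2 _ _ _ xwp)))
  ... | inj₂ (inj₂ τ) = col-middle (proj₂ (P4 _ _ _ _ xwp (P2 _ _ _ (rw τ))))

  spread-across : ∀ {p w x l} → β x w p → (∀ {c} → c ∈ l → β x p c) → AllCol p w l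
  spread-across xwp cross j = inj₂ (inj₂ (inj₁ (proj₂ (P4 _ _ _ _ (cross j) xwp))))

  -- If neither w nor p is ever the middle of w, p and a point x, every point collinear with both
  -- lies between them. Past the first point a there is none: β w x p and β w a x put x between a
  -- and p, while the ray of p puts a between p and x.
  side : ∀ {p w} l → Distinct l → Ray w l → Ray p l →
         (∃[ x ] (x ∈ l × (β x w p ⊎ β x p w))) ⊎ Side p w l
  side {p} {w} l dis rw rp with Any.any? (λ x → β? x w p ⊎-dec β? x p w) l
  ... | yes some = inj₁ (find some)
  side {p} {w} []      dis rw rp | no ¬some = inj₂ (none λ ())
  side {p} {w} (a ∷ l) dis rw rp | no ¬some = inj₂ (go (β? w a p))
    where
    only-between : ∀ {x} → x ∈ a ∷ l → Collinear p w x → β w x p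
    only-between i c with col-cases c
    ... | inj₁ pwx        = contradiction (lose i (inj₁ (P2 _ _ _ pwx))) ¬some
    ... | inj₂ (inj₁ wpx) = contradiction (lose i (inj₂ (P2 _ _ _ wpx))) ¬some
    ... | inj₂ (inj₂ pxw) = P2 _ _ _ pxw
    tail-none : NoneCol p w l
    tail-none i c = distinct-fresh dis i
      (middle-uniqueʳ (rp (head< i)) (P2 _ _ _ (proj₂ (P4 _ _ _ _ (only-between (there i) c) (rw (head< i))))))
    go : Dec (β w a p) → Side p w (a ∷ l)
    go (yes wap) = one wap tail-none
    go (no ¬wap) = none λ { (here refl) → ¬wap ∘ only-between (here refl) ; (there i) → tail-none i }

  S-reverse : ∀ p w u → S p w (reverse u) ≡ S p w u
  S-reverse p w u = S-↭ p w (Perm.↭-reverse u)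

  S-++ : ∀ p w u v → S p w (u ++ v) ≡ S p w u + S p w v
  S-++ p w u v = ∑-++ u v (χ p w)

  ∈-reverse : ∀ {x : X} u → x ∈ u → x ∈ reverse u
  ∈-reverse u = Perm.∈-resp-↭ (↭-sym (Perm.↭-reverse u))

  reverse-∈ : ∀ {x : X} u → x ∈ reverse u → x ∈ u
  reverse-∈ u = Perm.∈-resp-↭ (Perm.↭-reverse u)

  ⊆-unreverse : ∀ {a b : X} u → a ∷ b ∷ [] ⊆ reverse u → b ∷ a ∷ [] ⊆ u
  ⊆-unreverse u τ = subst (_ ⊆_) (reverse-involutive u) (reverse⁺ τ)

  side-length : ∀ {p w l} → Side p w l → length l ≤ suc (S p w l)
  side-length {p} {w} {l}     (none n)    = ≤-trans (≤-reflexive (sym (S-¬col l n))) (n≤1+n _)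
  side-length {p} {w} {a ∷ l} (one wap n) = s≤s (≤-trans (≤-reflexive (sym (S-¬col l n))) (m≤n+m _ _))

  -- The possible positions of p relative to the line u ++ w ∷ v when p is collinear
  -- with all pairs avoiding w and with exactly two of those containing w: either w
  -- and p belong into the same gap of u ++ v, or to the opposite ends of u ++ v.
  data Centre (p w : X) (u v : List X) : Set where
    twin   : ∀ {u₁ a b v₁} → u ≡ u₁ ++ a ∷ [] → v ≡ b ∷ v₁ → β w a p → β w b p →
             NoneCol p w u₁ → NoneCol p w v₁ → Line (u ++ p ∷ v) → Centre p w u v
    cycleˡ : ∀ {a s b} → u ≡ [] → v ≡ a ∷ s ++ b ∷ [] → β a w p → β w p b →
             NoneCol p w s → Line (v ++ p ∷ []) → Centre p w u v
    cycleʳ : ∀ {b s a} → u ≡ b ∷ s ++ a ∷ [] → v ≡ [] → β a w p → β w p b →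
             NoneCol p w s → Line (p ∷ u) → Centre p w u v

  -- Let m be the number of points of the line including w, so that `u ++ v` has m - 1. The
  -- alternatives are a star without edges, with exactly m - 3 edges and a known position of p, and
  -- with at least m - 2 edges.
  Outcome : X → X → List X → List X → Set
  Outcome p w u v = S p w (u ++ v) ≡ 0 ⊎ (Centre p w u v × length (u ++ v) ≡ 2 + S p w (u ++ v)) ⊎
                    length (u ++ v) ≤ suc (S p w (u ++ v))

  private
    all-++ : ∀ {P : X → Set} u {v} → (∀ {x} → x ∈ u → P x) → (∀ {x} → x ∈ v → P x) → ∀ {x} → x ∈ u ++ v → P x
    all-++ u f g i = [ f , g ]′ (∈-++⁻ u i)

    two-long : ∀ {m n s t} → m ≤ s → n ≤ suc t → m + n ≤ suc (s + t)
    two-long {s = s} {t} p q = ≤-trans (+-mono-≤ p q) (≤-reflexive (+-suc s t))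

  ray-left : ∀ {w} u {v} → Line (u ++ w ∷ v) → Ray w (reverse u)
  ray-left u L τ = P2 _ _ _ (between L (++⁺ (⊆-unreverse u τ) (refl ∷ minimum _)))

  ray-right : ∀ {w} u {v} → Line (u ++ w ∷ v) → Ray w v
  ray-right u L τ = between L (++⁺ˡ u (refl ∷ τ))

  across : ∀ {w} u {v b c} → Line (u ++ w ∷ v) → b ∈ u → c ∈ v → β b w c
  across u L i j = between L (++⁺ (from∈ i) (refl ∷ from∈ j))

  -- The list r is `reverse u`, generalised so that `Side` can be matched; it runs outward from w.
  -- One collinear neighbour on each side makes a twin; if a side has none, at most one point is not
  -- a leaf.
  both-sides : ∀ {p w} u v → Line (u ++ p ∷ v) → ∀ r → r ≡ reverse u → Side p w r → Side p w v → Outcome p w u v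
  both-sides {p} {w} u v Lp r eq (none m) s = inj₂ (inj₂ (≤-trans (≤-reflexive (length-++ u))
    (≤-trans (two-long (≤-reflexive (sym (S-¬col u (λ i → m (subst (_ ∈_) (sym eq) (∈-reverse u i)))))) (side-length s))
             (≤-reflexive (cong suc (sym (S-++ p w u v)))))))
  both-sides {p} {w} u v Lp r eq s (none n) = inj₂ (inj₂ (≤-trans (≤-reflexive (≡.trans (length-++ u) (+-comm (length u) _)))
    (≤-trans (two-long (≤-reflexive (sym (S-¬col v n)))
                       (≤-trans (≤-reflexive (sym (length-reverse u))) (≤-trans (side-length (subst (Side p w) eq s)) (s≤s (≤-reflexive (S-reverse p w u))))))
             (≤-reflexive (cong suc (≡.trans (+-comm (S p w v) _) (sym (S-++ p w u v))))))))
  both-sides {p} {w} u v Lp (a ∷ r) eq (one wap m) (one {b} {v₁} wbp n) =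
    inj₂ (inj₁ (twin u≡ refl wap wbp (m ∘ reverse-∈ r) n Lp , count))
    where
    u≡ : u ≡ reverse r ++ a ∷ []
    u≡ = ≡.trans (sym (reverse-involutive u)) (≡.trans (cong reverse (sym eq)) (unfold-reverse a r))
    exact : ∀ {c l} → β w c p → NoneCol p w l → suc (S p w (c ∷ l)) ≡ length (c ∷ l)
    exact {c} {l} wcp n = cong suc (≡.trans (cong (_+ S p w l) (χ-col (col-between wcp))) (S-¬col l n))
    count : length (u ++ v) ≡ 2 + S p w (u ++ v)
    count = begin
      length (u ++ v)                       ≡⟨ length-++ u ⟩
      length u + length v                   ≡⟨ cong (_+ length v) (≡.trans (sym (length-reverse u)) (cong length (sym eq))) ⟩
      length (a ∷ r) + length v             ≡⟨ cong₂ _+_ (sym (exact wap m)) (sym (exact wbp n)) ⟩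
      suc (S p w (a ∷ r)) + suc (S p w v)   ≡⟨ cong suc (+-suc _ _) ⟩
      2 + (S p w (a ∷ r) + S p w v)         ≡⟨ cong (λ l → 2 + (S p w l + S p w v)) eq ⟩
      2 + (S p w (reverse u) + S p w v)     ≡⟨ cong (λ n → 2 + (n + S p w v)) (S-reverse p w u) ⟩
      2 + (S p w u + S p w v)               ≡⟨ cong (2 +_) (sym (S-++ p w u v)) ⟩
      2 + S p w (u ++ v)                    ∎
      where open ≡-Reasoning

  same-gap : ∀ {p w} u v → Line (u ++ w ∷ v) → Line (u ++ p ∷ v) → Outcome p w u v
  same-gap {p} {w} u v Lw Lp
    with side (reverse u) dis-u (ray-left u Lw) (ray-left u Lp) | side v dis-v (ray-right u Lw) (ray-right u Lp)
    where
    dis-u : Distinct (reverse u)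
    dis-u = distinct-↭ (↭-sym (Perm.↭-reverse u)) (distinct (line-⊆ (++⁺ʳ _ ⊆-refl) Lw))
    dis-v : Distinct v
    dis-v = distinct (line-⊆ (++⁺ˡ u (w ∷ʳ ⊆-refl)) Lw)
  ... | inj₁ (x , i , inj₁ xwp) | _ = inj₁ (S-col (u ++ v) (all-++ u
          (λ j → spread (reverse u) (ray-left u Lw) (ray-left u Lp) i xwp (∈-reverse u j))
          (spread-across xwp (across u Lp (reverse-∈ u i)))))
  ... | inj₁ (x , i , inj₂ xpw) | _ = inj₁ (S-col (u ++ v) (all-++ u
          (λ j → col-swapˡ (spread (reverse u) (ray-left u Lp) (ray-left u Lw) i xpw (∈-reverse u j)))
          (λ j → col-swapˡ (spread-across xpw (across u Lw (reverse-∈ u i)) j))))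
  ... | inj₂ _ | inj₁ (x , i , inj₁ xwp) = inj₁ (S-col (u ++ v) (all-++ u
          (spread-across xwp (λ j → P2 _ _ _ (across u Lp j i)))
          (spread v (ray-right u Lw) (ray-right u Lp) i xwp)))
  ... | inj₂ _ | inj₁ (x , i , inj₂ xpw) = inj₁ (S-col (u ++ v) (all-++ u
          (λ j → col-swapˡ (spread-across xpw (λ j′ → P2 _ _ _ (across u Lw j′ i)) j))
          (λ j → col-swapˡ (spread v (ray-right u Lp) (ray-right u Lw) i xpw j))))
  ... | inj₂ s | inj₂ s′ = both-sides u v Lp (reverse u) refl s s′

  -- A point d beyond w or p lies on both lines and ties their orders together: for d in u and x in
  -- t, β d w x and β d x p give β w x p, and symmetrically for d in v. For the points of u and v
  -- the point c of t does the same.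
  different-gap : ∀ {p w} u t v → ∃[ c ] c ∈ t → ∃[ d ] d ∈ u ++ v → Line (u ++ w ∷ t ++ v) → Line (u ++ t ++ p ∷ v) →
                  AllCol p w (u ++ t ++ v)
  different-gap {p} {w} u t v (c , i) (d , j) Lw Lp = all-++ u on-u (all-++ t on-t on-v)
    where
    wtv : ∀ {c d} → c ∈ t → d ∈ v → β w c d
    wtv i j = between Lw (++⁺ˡ u (refl ∷ ++⁺ (from∈ i) (from∈ j)))
    tpv : ∀ {c d} → c ∈ t → d ∈ v → β c p d
    tpv i j = between Lp (++⁺ˡ u (++⁺ (from∈ i) (refl ∷ from∈ j)))
    uwt : ∀ {b c} → b ∈ u → c ∈ t → β b w c
    uwt i j = across u Lw i (∈-++⁺ˡ j)
    utp : ∀ {b c} → b ∈ u → c ∈ t → β b c p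
    utp i j = between Lp (++⁺ (from∈ i) (++⁺ (from∈ j) (refl ∷ minimum _)))
    on-u : AllCol p w u
    on-u k = col-middle (outˡ (uwt k i) (utp k i))
    on-v : AllCol p w v
    on-v k = inj₂ (inj₂ (inj₁ (inʳ (tpv i k) (wtv i k))))
    on-t : AllCol p w t
    on-t k with ∈-++⁻ u j
    ... | inj₁ j∈u = col-between (outʳ (uwt j∈u k) (utp j∈u k))
    ... | inj₂ j∈v = col-between (inˡ (tpv k j∈v) (wtv k j∈v))

  -- This is the case that `different-gap` leaves out, with nothing beyond w and p. If some point
  -- lies between w and p, all do. Otherwise the points of s are leaves, and either a or b is one
  -- too, or w a b p is a 4-cycle, with s strung along its side a b.
  opposite-ends : ∀ {p w} a s b → Line (w ∷ a ∷ s ++ b ∷ []) → Line ((a ∷ s ++ b ∷ []) ++ p ∷ []) →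
                  AllCol p w (a ∷ s ++ b ∷ []) ⊎ (β a w p × β w p b × NoneCol p w s) ⊎
                  length (a ∷ s ++ b ∷ []) ≤ suc (S p w (a ∷ s ++ b ∷ []))
  opposite-ends {p} {w} a s b Lw Lp with Any.any? (λ x → β? w x p) (a ∷ s ++ b ∷ [])
  ... | yes some with find some
  ...   | x , i , wxp = inj₁ all
    where
    all : AllCol p w (a ∷ s ++ b ∷ [])
    all j with ordered i j
    ... | inj₁ refl     = col-between wxp
    ... | inj₂ (inj₁ τ) = col-between (P2 _ _ _ (proj₁ (P4 _ _ _ _ (P2 _ _ _ wxp) (P2 _ _ _ (between Lp (++⁺ τ (refl ∷ [])))))))
    ... | inj₂ (inj₂ τ) = col-between (proj₁ (P4 _ _ _ _ wxp (between Lw (refl ∷ τ))))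
  opposite-ends {p} {w} a s b Lw Lp | no ¬some = inj₂ (ends (β? a w p) (β? w p b))
    where
    l = a ∷ s ++ b ∷ []
    dis : Distinct l
    dis = distinct (line-tail Lw)
    b∈ : b ∈ s ++ b ∷ []
    b∈ = ∈-++⁺ʳ s (here refl)
    not-after : ∀ {x} → x ∈ s ++ b ∷ [] → ¬ β x w p
    not-after i xwp = dis (head< i)
      (middle-unique (between Lp (refl ∷ ++⁺ (from∈ i) (refl ∷ []))) (proj₁ (P4 _ _ _ _ xwp (P2 _ _ _ (between Lw (refl ∷ head< i))))))
    not-before : ∀ {x} → x ∷ b ∷ [] ⊆ l → ¬ β w p x
    not-before τ wpx = dis τ
      (sym (middle-unique (P2 _ _ _ (between Lw (refl ∷ τ))) (proj₁ (P4 _ _ _ _ (P2 _ _ _ wpx) (between Lp (++⁺ τ (refl ∷ [])))))))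
    not-between : ∀ {x} → x ∈ l → ¬ β w x p
    not-between i wxp = ¬some (lose i wxp)
    inner : NoneCol p w s
    inner i c with col-cases c
    ... | inj₁ pwx        = not-after (∈-++⁺ˡ i) (P2 _ _ _ pwx)
    ... | inj₂ (inj₁ wpx) = not-before (a ∷ʳ ++⁺ (from∈ i) (refl ∷ [])) wpx
    ... | inj₂ (inj₂ pxw) = not-between (there (∈-++⁺ˡ i)) (P2 _ _ _ pxw)
    S-l : S p w l ≡ χ p w a + (length s + (χ p w b + 0))
    S-l = cong (χ p w a +_) (≡.trans (S-++ p w s (b ∷ [])) (cong (_+ (χ p w b + 0)) (S-¬col s inner)))
    length-l : length l ≡ suc (length s + 1)
    length-l = cong suc (length-++ s)
    ends : Dec (β a w p) → Dec (β w p b) → (β a w p × β w p b × NoneCol p w s) ⊎ length l ≤ suc (S p w l)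
    ends (yes awp) (yes wpb) = inj₁ (awp , wpb , inner)
    ends (no ¬awp) _         = inj₂ (begin
      length l                                 ≡⟨ length-l ⟩
      suc (length s + 1)                       ≡⟨ cong suc (+-comm (length s) 1) ⟩
      2 + length s                             ≤⟨ s≤s (+-mono-≤ (≤-reflexive (sym (χ-¬col a-not))) (m≤m+n (length s) _)) ⟩
      suc (χ p w a + (length s + (χ p w b + 0))) ≡⟨ cong suc S-l ⟨
      suc (S p w l)                            ∎)
      where
      open ≤-Reasoning
      a-not : ¬ Collinear p w a
      a-not c with col-cases c
      ... | inj₁ pwa        = ¬awp (P2 _ _ _ pwa)
      ... | inj₂ (inj₁ wpa) = not-before (refl ∷ from∈ b∈) wpa
      ... | inj₂ (inj₂ paw) = not-between (here refl) (P2 _ _ _ paw)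
    ends _ (no ¬wpb)         = inj₂ (begin
      length l                                 ≡⟨ length-l ⟩
      suc (length s + 1)                       ≤⟨ s≤s (+-monoʳ-≤ (length s) (≤-trans (≤-reflexive (sym (χ-¬col b-not))) (m≤m+n _ 0))) ⟩
      suc (length s + (χ p w b + 0))           ≤⟨ s≤s (m≤n+m _ (χ p w a)) ⟩
      suc (χ p w a + (length s + (χ p w b + 0))) ≡⟨ cong suc S-l ⟨
      suc (S p w l)                            ∎)
      where
      open ≤-Reasoning
      b-not : ¬ Collinear p w b
      b-not c with col-cases c
      ... | inj₁ pwb        = not-after b∈ (P2 _ _ _ pwb)
      ... | inj₂ (inj₁ wpb) = ¬wpb wpb
      ... | inj₂ (inj₂ pbw) = not-between (there b∈) (P2 _ _ _ pbw)

  ends-count : ∀ {p w} a s b → β a w p → β w p b → NoneCol p w s →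
               length (a ∷ s ++ b ∷ []) ≡ 2 + S p w (a ∷ s ++ b ∷ [])
  ends-count {p} {w} a s b awp wpb n = begin
    suc (length (s ++ b ∷ []))                       ≡⟨ cong suc (length-++ s) ⟩
    suc (length s + 1)                               ≡⟨ cong suc (+-comm (length s) 1) ⟩
    2 + length s                                     ≡⟨ cong (2 +_) (sym (≡.trans (S-++ p w s (b ∷ [])) (≡.trans (cong₂ _+_ (S-¬col s n) (cong (_+ 0) (χ-col (inj₂ (inj₂ (inj₁ wpb)))))) (+-identityʳ _)))) ⟩
    2 + S p w (s ++ b ∷ [])                          ≡⟨ cong (λ n → 2 + (n + S p w (s ++ b ∷ []))) (χ-col (col-middle awp)) ⟨
    2 + S p w (a ∷ s ++ b ∷ [])                      ∎
    where open ≡-Reasoning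

  split-compare : ∀ (u u′ : List X) {v v′} → u ++ v ≡ u′ ++ v′ →
                  (u ≡ u′ × v ≡ v′) ⊎
                  (∃[ y ] ∃[ t ] (u′ ≡ u ++ y ∷ t × v ≡ y ∷ t ++ v′)) ⊎
                  (∃[ y ] ∃[ t ] (u ≡ u′ ++ y ∷ t × v′ ≡ y ∷ t ++ v))
  split-compare []      []       eq   = inj₁ (refl , eq)
  split-compare []      (y ∷ u′) eq   = inj₂ (inj₁ (y , u′ , refl , eq))
  split-compare (y ∷ u) []       eq   = inj₂ (inj₂ (y , u , refl , sym eq))
  split-compare (y ∷ u) (y′ ∷ u′) eq with split-compare u u′ (∷-injectiveʳ eq) | ∷-injectiveˡ eq
  ... | inj₁ (refl , eq′)                     | refl = inj₁ (refl , eq′)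
  ... | inj₂ (inj₁ (x , t , refl , refl)) | refl = inj₂ (inj₁ (x , t , refl , refl))
  ... | inj₂ (inj₂ (x , t , refl , refl)) | refl = inj₂ (inj₂ (x , t , refl , refl))

  star : ∀ {p w} u v → 2 ≤ length (u ++ v) → Line (u ++ w ∷ v) → Insertion p (u ++ v) → Outcome p w u v
  star {p} {w} u v 2≤ Lw (u′ , v′ , eq , Lp) with split-compare u u′ eq
  ... | inj₁ (refl , refl) = same-gap u v Lw Lp
  star {p} {w} (c ∷ u) v 2≤ Lw (u′ , v′ , eq , Lp) | inj₂ (inj₁ (y , t , refl , refl)) =
    inj₁ (S-col _ (different-gap (c ∷ u) (y ∷ t) v′ (y , here refl) (c , here refl) Lw (subst Line (++-assoc (c ∷ u) (y ∷ t) _) Lp)))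
  star {p} {w} [] v 2≤ Lw (u′ , d ∷ v′ , eq , Lp) | inj₂ (inj₁ (y , t , refl , refl)) =
    inj₁ (S-col _ (different-gap [] (y ∷ t) (d ∷ v′) (y , here refl) (d , here refl) Lw Lp))
  star {p} {w} [] v 2≤ Lw (u′ , [] , eq , Lp) | inj₂ (inj₁ (y , t , refl , refl))
    rewrite ++-identityʳ t with initLast t
  ... | [] = contradiction 2≤ (<⇒≱ (s≤s (s≤s z≤n)))
  ... | s List.∷ʳ′ b with opposite-ends y s b Lw Lp
  ...   | inj₁ all                     = inj₁ (S-col _ all)
  ...   | inj₂ (inj₁ (ywp , wpb , n)) = inj₂ (inj₁ (cycleˡ refl refl ywp wpb n Lp , ends-count y s b ywp wpb n))
  ...   | inj₂ (inj₂ le)              = inj₂ (inj₂ le)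
  -- Now the gap of p comes before that of w; the same lemmas apply with p and w interchanged.
  star {p} {w} u v 2≤ Lw (c ∷ u′ , v′ , eq , Lp) | inj₂ (inj₂ (y , t , refl , refl)) =
    inj₁ (S-col _ (λ {x} i → col-swapˡ (different-gap (c ∷ u′) (y ∷ t) v (y , here refl) (c , here refl) Lp
      (subst Line (++-assoc (c ∷ u′) (y ∷ t) _) Lw) (subst (x ∈_) (++-assoc (c ∷ u′) (y ∷ t) v) i))))
  star {p} {w} u (d ∷ v) 2≤ Lw ([] , v′ , eq , Lp) | inj₂ (inj₂ (y , t , refl , refl)) =
    inj₁ (S-col _ (λ i → col-swapˡ (different-gap [] (y ∷ t) (d ∷ v) (y , here refl) (d , here refl) Lp Lw i)))
  star {p} {w} u [] 2≤ Lw ([] , v′ , eq , Lp) | inj₂ (inj₂ (y , t , refl , refl))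
    rewrite ++-identityʳ t with initLast t
  ... | [] = contradiction 2≤ (<⇒≱ (s≤s (s≤s z≤n)))
  ... | s List.∷ʳ′ b with opposite-ends y s b Lp Lw
  ...   | inj₁ all                     = inj₁ (S-col _ (λ i → col-swapˡ (all i)))
  ...   | inj₂ (inj₁ (ypw , pwb , n)) = inj₂ (inj₁
          ( cycleʳ refl refl (P2 _ _ _ pwb) (P2 _ _ _ ypw) (λ i → n i ∘ col-swapˡ) Lp
          , ends-count′))
    where
    ends-count′ = ≡.trans (ends-count y s b ypw pwb n) (cong (2 +_) (S-sym w p (y ∷ s ++ b ∷ [])))
  ...   | inj₂ (inj₂ le)              = inj₂ (inj₂ (≤-trans le (s≤s (≤-reflexive (S-sym w p (y ∷ s ++ b ∷ []))))))

-- The graph of pairs not collinear with a point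

-- The position of p relative to points a, b following each other on a line:
-- before them, between them, after them, or not collinear with them.
data Position : Set where
  pre mid post off : Position

-- For a, b, c in this order on a line: the positions of p with respect to
-- a b, to b c and to a c that P1-P4 permit.
permitted : Position → Position → Position → Bool
permitted post   post   post   = true
permitted pre  pre  pre  = true
permitted mid pre  mid = true
permitted post   mid mid = true
permitted pre  post   mid = true
permitted pre  off     mid = true
permitted off     post   mid = true
permitted off     off     mid = true
permitted pre  post   off     = true
permitted post   pre  off     = true
permitted pre  off     off     = true
permitted off     pre  off     = true
permitted post   off     off     = true
permitted off     post   off     = true
permitted off     off     off     = true
permitted _       _       _       = false

-- The rows of positions for the points of a line, each point with respect
-- to the points after it.
Table : Set
Table = List (List Position)

permittedRow : Position → List Position → List Position → Bool
permittedRow s (t ∷ ts) (r ∷ rs) = permitted s t r ∧ permittedRow s ts rs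
permittedRow s _        _        = true

extendRow : List Position → List Position → Position → List (List Position)
extendRow ts rs s = if permittedRow s ts rs then (s ∷ rs) ∷ [] else []

rows : Table → List (List Position)
rows []       = [] ∷ []
rows (ts ∷ c) = concatMap (λ rs → concatMap (extendRow ts rs) (pre ∷ mid ∷ post ∷ off ∷ [])) (rows c)

tables : ℕ → List Table
tables zero    = [] ∷ []
tables (suc m) = concatMap (λ c → map (_∷ c) (rows c)) (tables m)

weight : Position → ℕ
weight off = 1
weight _   = 0

weightᵣ : List Position → ℕ
weightᵣ r = sum (map weight r)

weightₜ : Table → ℕ
weightₜ []      = 0
weightₜ (r ∷ c) = weightᵣ r + weightₜ c

-- Is d the number of non-collinear pairs containing some point of the table,
-- where os are the numbers of those with a point before the table?
hasDegree : ℕ → List ℕ → Table → Bool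
hasDegree d (o ∷ os) (r ∷ c) = (o + weightᵣ r ≡ᵇ d) ∨ hasDegree d (zipWith _+_ os (map weight r)) c
hasDegree d _        _       = false

-- A vertex whose degree equals the number of all edges is a centre; the second alternative is the
-- bound 2m - 7.
starOrHeavy : ℕ → Table → Bool
starOrHeavy m c = hasDegree (weightₜ c) (map (λ _ → 0) c) c ∨ (2 * m ≤ᵇ weightₜ c + 7)

starOrHeavy₅ : All (True ∘ starOrHeavy 5) (tables 5)
starOrHeavy₅ = All.all⁺ (starOrHeavy 5) (tables 5) _

-- A second base case, because the induction step from 1 + q to 2 + q needs 5 ≤ q and so first
-- reaches 7.
starOrHeavy₆ : All (True ∘ starOrHeavy 6) (tables 6)
starOrHeavy₆ = All.all⁺ (starOrHeavy 6) (tables 6) _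

module Link (𝓑 : BetweennessStructure) where
  open BetweennessStructure 𝓑
  open Plane 𝓑
  open Star 𝓑

  -- The pairs of l not collinear with p are the edges of a graph on l: a star with centre w.
  IsStar : X → List X → Set
  IsStar p l = ∃[ w ] ∃[ k ] (Pick w l k × D p k ≡ 0)

  module _ (p : X) where

    At : Position → X → X → Set
    At pre  a b = β p a b
    At mid a b = β a p b
    At post   a b = β a b p
    At off     a b = ¬ Collinear p a b

    position : ∀ a b → ∃[ s ] At s a b
    position a b with collinear? p a b
    ... | no ¬c = off , ¬c
    ... | yes c with col-cases c
    ...   | inj₁ pab        = pre , pab
    ...   | inj₂ (inj₁ apb) = mid , apb
    ...   | inj₂ (inj₂ pba) = post , P2 _ _ _ pba

    at-unique : ∀ {s t a b} → p ≢ a → p ≢ b → a ≢ b → At s a b → At t a b → s ≡ t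
    at-unique {pre}  {pre}  _  _  _  _ _ = refl
    at-unique {mid} {mid} _  _  _  _ _ = refl
    at-unique {post}   {post}   _  _  _  _ _ = refl
    at-unique {off}     {off}     _  _  _  _ _ = refl
    at-unique {pre}  {mid} pa pb ab s t = contradiction (middle-unique s t) pa
    at-unique {mid} {pre}  pa pb ab s t = contradiction (middle-unique t s) pa
    at-unique {pre}  {post}   pa pb ab s t = contradiction (middle-uniqueʳ s (P2 _ _ _ t)) ab
    at-unique {post}   {pre}  pa pb ab s t = contradiction (middle-uniqueʳ t (P2 _ _ _ s)) ab
    at-unique {mid} {post}   pa pb ab s t = contradiction (middle-uniqueʳ s t) pb
    at-unique {post}   {mid} pa pb ab s t = contradiction (middle-uniqueʳ t s) pb
    at-unique {off}     {pre}  pa pb ab s t = contradiction (inj₁ t) s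
    at-unique {pre}  {off}     pa pb ab s t = contradiction (inj₁ s) t
    at-unique {off}     {mid} pa pb ab s t = contradiction (inj₂ (inj₂ (inj₁ t))) s
    at-unique {mid} {off}     pa pb ab s t = contradiction (inj₂ (inj₂ (inj₁ s))) t
    at-unique {off}     {post}   pa pb ab s t = contradiction (inj₂ (inj₁ (P2 _ _ _ t))) s
    at-unique {post}   {off}     pa pb ab s t = contradiction (inj₂ (inj₁ (P2 _ _ _ s))) t

    -- The rules `outˡ`, `outʳ`, `inˡ` and `inʳ` derive one position from others. A combination
    -- absent from `permitted` would give a pair two positions, against `at-unique`, or make a pair
    -- collinear that is `off`.
    at-permitted : ∀ {s t r a b c} → p ≢ a → p ≢ b → p ≢ c → a ≢ b → b ≢ c → β a b c →
                   At s a b → At t b c → At r a c → True (permitted s t r)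
    at-permitted {s} {t} {post} pa pb pc ab bc abc sab tbc acp
      with refl ← at-unique {s} {post} pa pb ab sab (outˡ abc acp)
         | refl ← at-unique {t} {post} pb pc bc tbc (outʳ abc acp) = _
    at-permitted {s} {t} {pre} pa pb pc ab bc abc sab tbc pac
      with refl ← at-unique {s} {pre} pa pb ab sab (inˡ abc pac)
         | refl ← at-unique {t} {pre} pb pc bc tbc (inʳ abc pac) = _
    at-permitted {pre} {pre} {mid} pa pb pc ab bc abc pab pbc apc
      with () ← at-unique {pre} {mid} pa pb ab pab (inˡ pbc apc)
    at-permitted {pre} {mid} {mid} pa pb pc ab bc abc pab bpc apc
      with () ← at-unique {pre} {post} pa pb ab pab (inˡ bpc abc)
    at-permitted {pre} {post} {mid} _ _ _ _ _ _ _ _ _ = _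
    at-permitted {pre} {off}   {mid} _ _ _ _ _ _ _ _ _ = _
    at-permitted {mid} {t} {mid} pa pb pc ab bc abc apb tbc apc
      with refl ← at-unique {t} {pre} pb pc bc tbc (outʳ apb abc) = _
    at-permitted {post} {t} {mid} pa pb pc ab bc abc abp tbc apc
      with refl ← at-unique {t} {mid} pb pc bc tbc (outʳ abp apc) = _
    at-permitted {off} {pre} {mid} pa pb pc ab bc abc ¬pab pbc apc
      with () ← at-unique {off} {mid} pa pb ab ¬pab (inˡ pbc apc)
    at-permitted {off} {mid} {mid} pa pb pc ab bc abc ¬pab bpc apc
      with () ← at-unique {off} {post} pa pb ab ¬pab (inˡ bpc abc)
    at-permitted {off} {post} {mid} _ _ _ _ _ _ _ _ _ = _
    at-permitted {off} {off}   {mid} _ _ _ _ _ _ _ _ _ = _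
    at-permitted {mid} {t} {off} pa pb pc ab bc abc apb tbc ¬pac =
      contradiction (inj₂ (inj₂ (inj₁ (outˡ apb abc)))) ¬pac
    at-permitted {s} {mid} {off} pa pb pc ab bc abc sab bpc ¬pac =
      contradiction (inj₂ (inj₂ (inj₁ (inʳ bpc abc)))) ¬pac
    at-permitted {pre} {pre} {off} pa pb pc ab bc abc pab pbc ¬pac =
      contradiction (inj₁ (outˡ pab pbc)) ¬pac
    at-permitted {post} {post} {off} pa pb pc ab bc abc abp bcp ¬pac =
      contradiction (inj₂ (inj₁ (P2 _ _ _ (inʳ bcp abp)))) ¬pac
    at-permitted {pre} {post}  {off} _ _ _ _ _ _ _ _ _ = _
    at-permitted {pre} {off}    {off} _ _ _ _ _ _ _ _ _ = _
    at-permitted {post}  {pre} {off} _ _ _ _ _ _ _ _ _ = _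
    at-permitted {post}  {off}    {off} _ _ _ _ _ _ _ _ _ = _
    at-permitted {off}    {pre} {off} _ _ _ _ _ _ _ _ _ = _
    at-permitted {off}    {post}  {off} _ _ _ _ _ _ _ _ _ = _
    at-permitted {off}    {off}    {off} _ _ _ _ _ _ _ _ _ = _

    AtRow : X → List X → List Position → Set
    AtRow a = Pointwise (λ b s → At s a b)

    data AtTable : List X → Table → Set where
      []  : AtTable [] []
      _∷_ : ∀ {a l r c} → AtRow a l r → AtTable l c → AtTable (a ∷ l) (r ∷ c)

    line-permittedRow : ∀ {a b l s ts rs} → Line (a ∷ b ∷ l) → Fresh p (a ∷ b ∷ l) →
                        At s a b → AtRow b l ts → AtRow a l rs → True (permittedRow s ts rs)
    line-permittedRow L f sab []         []         = _
    line-permittedRow {a} {b} {c ∷ l} {s} {t ∷ _} {r ∷ _} L f sab (t′ ∷ ts) (r′ ∷ rs)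
      with permitted s t r | at-permitted {s} {t} {r} (f (here refl)) (f (there (here refl))) (f (there (there (here refl))))
             (distinct L (refl ∷ refl ∷ minimum _)) (distinct L (a ∷ʳ refl ∷ refl ∷ minimum _))
             (between L (refl ∷ refl ∷ refl ∷ minimum _)) sab t′ r′
    ... | true | _ = line-permittedRow (line-⊆ (refl ∷ refl ∷ c ∷ʳ ⊆-refl) L) (f ∘ skip) sab ts rs
      where
      skip : ∀ {x} → x ∈ a ∷ b ∷ l → x ∈ a ∷ b ∷ c ∷ l
      skip (here e)          = here e
      skip (there (here e))  = there (here e)
      skip (there (there i)) = there (there (there i))

    row-exists : ∀ {a l c} → Line (a ∷ l) → Fresh p (a ∷ l) → AtTable l c → ∃[ r ] (r ∈ rows c × AtRow a l r)
    row-exists L f []        = [] , here refl , []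
    row-exists {a} {b ∷ l} {ts ∷ c} L f (ts′ ∷ c′)
      with row-exists (line-⊆ (refl ∷ b ∷ʳ ⊆-refl) L) (f ∘ skip) c′ | position a b
      where
      skip : ∀ {x} → x ∈ a ∷ l → x ∈ a ∷ b ∷ l
      skip (here e)  = here e
      skip (there i) = there (there i)
    ... | rs , rs∈ , rs′ | s , s′ = s ∷ rs , ∈-concatMap⁺ _ (Any.map (λ { refl → ∈-concatMap⁺ (extendRow ts rs) (Any.map (λ { refl → chosen }) (all-positions s)) }) rs∈) , s′ ∷ rs′
      where
      chosen : s ∷ rs ∈ extendRow ts rs s
      chosen with permittedRow s ts rs | line-permittedRow {s = s} L f s′ ts′ rs′
      ... | true | _ = here refl
      all-positions : ∀ s → s ∈ pre ∷ mid ∷ post ∷ off ∷ []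
      all-positions pre  = here refl
      all-positions mid = there (here refl)
      all-positions post   = there (there (here refl))
      all-positions off     = there (there (there (here refl)))

    table-exists : ∀ l → Line l → Fresh p l → ∃[ c ] (c ∈ tables (length l) × AtTable l c)
    table-exists []      L f = [] , here refl , []
    table-exists (a ∷ l) L f with table-exists l (line-tail L) (f ∘ there)
    ... | c , c∈ , c′ with row-exists L f c′
    ...   | r , r∈ , r′ = r ∷ c , ∈-concatMap⁺ _ (Any.map (λ { refl → ∈-map⁺ _ r∈ }) c∈) , r′ ∷ c′

    at-weight : ∀ {a b} s → At s a b → χ p a b ≡ weight s
    at-weight pre  t = χ-col (inj₁ t)
    at-weight mid t = χ-col (inj₂ (inj₂ (inj₁ t)))
    at-weight post   t = χ-col (inj₂ (inj₁ (P2 _ _ _ t)))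
    at-weight off     t = χ-¬col t

    row-weight : ∀ {a l r} → AtRow a l r → S p a l ≡ weightᵣ r
    row-weight []             = refl
    row-weight (_∷_ {y = s} t r) = cong₂ _+_ (at-weight s t) (row-weight r)

    table-weight : ∀ {l c} → AtTable l c → D p l ≡ weightₜ c
    table-weight []      = refl
    table-weight (r ∷ c) = cong₂ _+_ (row-weight r) (table-weight c)

    row-offsets : ∀ {a l r} (f : X → ℕ) → AtRow a l r →
                  zipWith _+_ (map f l) (map weight r) ≡ map (λ b → f b + χ p a b) l
    row-offsets f []                = refl
    row-offsets f (_∷_ {x = b} {y = s} t r) = cong₂ _∷_ (cong (f b +_) (sym (at-weight s t))) (row-offsets f r)

    degree-pick : ∀ {l c} d (f : X → ℕ) → AtTable l c → True (hasDegree d (map f l) c) →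
                  ∃[ w ] ∃[ k ] (Pick w l k × f w + S p w k ≡ d)
    degree-pick {a ∷ l} {r ∷ c} d f (r′ ∷ c′) t with f a + weightᵣ r ≡ᵇ d in eq
    ... | true  = a , l , here , ≡.trans (cong (f a +_) (row-weight r′)) (≡ᵇ⇒≡ _ d (subst True (sym eq) _))
    ... | false rewrite row-offsets f r′ with degree-pick d (λ b → f b + χ p a b) c′ t
    ...   | w , k , i , e = w , a ∷ k , there i ,
            ≡.trans (≡.trans (cong (λ n → f w + (n + S p w k)) (χ-swapʳ p w a)) (sym (+-assoc (f w) _ _))) e

    zero-offsets : ∀ {l c} → AtTable l c → map (λ _ → 0) c ≡ map (λ (_ : X) → 0) l
    zero-offsets []      = refl
    zero-offsets (_ ∷ c) = cong (0 ∷_) (zero-offsets c)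

    star-or-heavy : ∀ m {l} → All (True ∘ starOrHeavy m) (tables m) → length l ≡ m → Line l → Fresh p l →
                    IsStar p l ⊎ 2 * m ≤ D p l + 7
    star-or-heavy m {l} ok refl L f with table-exists l L f
    ... | c , c∈ , c′ with hasDegree (weightₜ c) (map (λ _ → 0) c) c in eq | All.lookup ok c∈
    ...   | false | heavy = inj₂ (subst (λ n → 2 * m ≤ n + 7) (sym (table-weight c′)) (≤ᵇ⇒≤ (2 * m) _ heavy))
    ...   | true  | _ with degree-pick (weightₜ c) (λ _ → 0) c′ (subst True (sym (≡.trans (cong (λ os → hasDegree (weightₜ c) os c) (sym (zero-offsets c′))) eq)) _)
    ...     | w , k , i , e = inj₁ (w , k , i , +-cancelˡ-≡ (S p w k) (D p k) 0
                (≡.trans (sym (D-pick p i)) (≡.trans (table-weight c′) (≡.trans (sym e) (sym (+-identityʳ _))))))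

-- Leaves a linear consequence to the ring solver; k is the slack.
linear : ∀ {A B C D} k → A ≤ B → C + B + k ≡ D + A → C ≤ D
linear {A} {B} {C} {D} k A≤B eq = +-cancelʳ-≤ B C D (begin
  C + B      ≤⟨ m≤m+n (C + B) k ⟩
  C + B + k  ≡⟨ eq ⟩
  D + A      ≤⟨ +-monoʳ-≤ D A≤B ⟩
  D + B      ∎)
  where open ≤-Reasoning

pick-compare : ∀ {A : Set} {x y : A} {l k j} → Pick x l k → Pick y l j →
               (x ≡ y × k ≡ j) ⊎ (∃[ i ] (Pick y k i × Pick x j i))
pick-compare here      here      = inj₁ (refl , refl)
pick-compare here      (there q) = inj₂ (_ , q , here)
pick-compare (there p) here      = inj₂ (_ , here , p)
pick-compare (there p) (there q) with pick-compare p q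
... | inj₁ (refl , refl) = inj₁ (refl , refl)
... | inj₂ (i , q′ , p′) = inj₂ (_ , there q′ , there p′)

module Degrees (𝓑 : BetweennessStructure) where
  open BetweennessStructure 𝓑
  open Plane 𝓑
  open Star 𝓑
  open Link 𝓑

  S-pick : ∀ a b {x l k} → Pick x l k → S a b l ≡ χ a b x + S a b k
  S-pick a b i = S-↭ a b (pick-↭ i)

  star-size : ∀ {p w l k} → Line l → Fresh p l → Pick w l k → D p k ≡ 0 → 4 ≤ length k →
              S p w k ≡ 0 ⊎ length k ≤ 2 + S p w k
  star-size {p} {w} L f i eq 4≤ with pick-split i
  ... | u , v , refl , refl
    with star u v (≤-trans (s≤s (s≤s z≤n)) 4≤) L
           (insert (u ++ v) 4≤ (line-pick i L) (fresh-pick i f) (D⇒colWith (u ++ v) eq))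
  ...   | inj₁ s≡0              = inj₁ s≡0
  ...   | inj₂ (inj₁ (_ , len)) = inj₂ (≤-reflexive len)
  ...   | inj₂ (inj₂ le)        = inj₂ (≤-trans le (n≤1+n _))

  module _ (p : X) where

    Dichotomy : ℕ → Set
    Dichotomy m = ∀ l → length l ≡ m → Line l → Fresh p l → IsStar p l ⊎ 2 * m ≤ D p l + 7

    private
      light : ∀ q d d′ → 5 ≤ q → 2 * (1 + q) ≤ d′ + 7 → d′ ≤ d → ¬ (2 * d ≤ (2 + q) * 1)
      light q d d′ 5≤q h₁ h₂ h₃ = <⇒≱ ≤-refl (linear {C = 5} {D = 4} 2
        (+-mono-≤ (*-monoʳ-≤ 3 5≤q) (+-mono-≤ (*-monoʳ-≤ 2 h₁) (+-mono-≤ (*-monoʳ-≤ 2 h₂) h₃))) (eq q d d′))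
        where
        eq : ∀ q d d′ → 5 + (3 * q + (2 * (d′ + 7) + (2 * d + (2 + q) * 1))) + 2 ≡
             4 + (3 * 5 + (2 * (2 * (1 + q)) + (2 * d′ + 2 * d)))
        eq = solve-∀

      heavier : ∀ q s d → 2 ≤ s → 2 * (1 + q) ≤ d + 7 → 2 * (2 + q) ≤ (s + d) + 7
      heavier q s d h₁ h₂ = linear 0 (+-mono-≤ h₁ h₂) (eq q s d)
        where
        eq : ∀ q s d → 2 * (2 + q) + (s + (d + 7)) + 0 ≡ (s + d) + 7 + (2 + 2 * (1 + q))
        eq = solve-∀

      two-stars : ∀ q c s t → q ≤ 2 + s → q ≤ 2 + t → (c ≡ 0 × q ≡ 2 + s × q ≡ 2 + t) ⊎ 2 * (2 + q) ≤ ((c + s) + t) + 7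
      two-stars q (suc c) s t h₁ h₂ = inj₂ (linear c (+-mono-≤ h₁ h₂) (eq q c s t))
        where
        eq : ∀ q c s t → 2 * (2 + q) + ((2 + s) + (2 + t)) + c ≡ ((suc c + s) + t) + 7 + (q + q)
        eq = solve-∀
      two-stars q zero s t h₁ h₂ with m≤n⇒m<n∨m≡n h₁ | m≤n⇒m<n∨m≡n h₂
      ... | inj₂ e₁ | inj₂ e₂ = inj₁ (refl , e₁ , e₂)
      ... | inj₁ l₁ | _       = inj₂ (linear 0 (+-mono-≤ l₁ h₂) (eq q s t))
        where
        eq : ∀ q s t → 2 * (2 + q) + ((2 + s) + (2 + t)) + 0 ≡ ((0 + s) + t) + 7 + (suc q + q)
        eq = solve-∀
      ... | inj₂ _  | inj₁ l₂ = inj₂ (linear 0 (+-mono-≤ h₁ l₂) (eq q s t))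
        where
        eq : ∀ q s t → 2 * (2 + q) + ((2 + s) + (2 + t)) + 0 ≡ ((0 + s) + t) + 7 + (q + suc q)
        eq = solve-∀

      both-one : ∀ {a b} → a ≤ 1 → b ≤ 1 → 2 ≤ a + b → a ≡ 1 × b ≡ 1
      both-one {suc zero} {suc zero} _         _         _        = refl , refl
      both-one {zero}     {suc zero} _         _         (s≤s ())
      both-one {suc zero} {zero}     _         _         (s≤s ())
      both-one {zero}     {zero}     _         _         ()
      both-one {suc (suc _)} (s≤s ())
      both-one {zero} {suc (suc _)} _ (s≤s ())
      both-one {suc zero} {suc (suc _)} _ (s≤s ())

      -- Pigeonhole: the two centres have 2(q - 2) leaves among q points, and 2(q - 2) > q for q ≥
      -- 5.
      common-leaf : ∀ q s t l → 5 ≤ q → q ≡ 2 + s → q ≡ 2 + t → length l ≡ q → ∀ {w b} → s ≡ S p w l → t ≡ S p b l →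
                ∃[ x ] (x ∈ l × χ p w x ≡ 1 × χ p b x ≡ 1)
      common-leaf q s t l 5≤q e₁ e₂ len {w} {b} refl refl with Any.any? (λ x → 2 ≤? χ p w x + χ p b x) l
      ... | yes some with find some
      ...   | x , i , le = x , i , both-one (χ≤1 p w x) (χ≤1 p b x) le
      common-leaf q s t l 5≤q e₁ e₂ len {w} {b} refl refl | no nowhere = contradiction
        (linear {C = 5} {D = 4} 0 (+-mono-≤ 5≤q (+-mono-≤ (≤-reflexive e₁) (+-mono-≤ (≤-reflexive e₂) sparse))) (eq q s t)) (<⇒≱ ≤-refl)
        where
        sparse : s + t ≤ q * 1
        sparse = subst (λ n → s + t ≤ n * 1) len (≤-trans (≤-reflexive (sym (∑-+ l (χ p w) (χ p b))))
                   (∑-≤ l 1 (λ i → ≤-pred (≰⇒> (λ le → nowhere (lose i le))))))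
        eq : ∀ q s t → 5 + (q + ((2 + s) + ((2 + t) + q * 1))) + 0 ≡ 4 + (5 + (q + (q + (s + t))))
        eq = solve-∀

      too-few : ∀ {q s n} c → 5 ≤ q → q ≡ 2 + s → s ≡ 1 + n → n ≡ c + 0 → ¬ c ≤ 1
      too-few c 5≤q refl refl refl le = <⇒≱ 5≤q (s≤s (s≤s (s≤s (≤-trans (≤-reflexive (+-identityʳ c)) le))))

      light-rest : ∀ {q s t m n d} → q ≡ 2 + s → q ≡ 2 + t → s ≡ 1 + m → t ≡ 1 + n → d ≡ n + m → ¬ 2 * (1 + q) ≤ d + 7
      light-rest {m = m} {n} e₁ e₂ refl refl refl h = <⇒≱ ≤-refl (linear {C = 1} {D = 0} 0
        (+-mono-≤ (≤-reflexive (sym e₁)) (+-mono-≤ (≤-reflexive (sym e₂)) h)) (eq _ m n))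
        where
        eq : ∀ q m n → 1 + (q + (q + (n + m + 7))) + 0 ≡ 0 + ((2 + (1 + m)) + ((2 + (1 + n)) + 2 * (1 + q)))
        eq = solve-∀

    -- A vertex b of degree at least 2 leaves a star with centre w; so does w, with
    -- centre b. Of these two stars, each missing at most two leaves, the only light
    -- one misses exactly two leaves of each, and then removing a common leaf
    -- leaves neither a star nor a heavy graph.
    dichotomy-step : ∀ q → 5 ≤ q → Dichotomy (1 + q) → Dichotomy (2 + q)
    dichotomy-step q 5≤q ih l len L f = [ (λ (b , l′ , i , 2≤) → high i 2≤) , low ]′
      (pick-or {P = λ b l′ → 2 ≤ S p b l′} {Q = λ b l′ → S p b l′ ≤ 1} l (λ {b} {l′} _ → split b l′))
      where
      Goal : Set
      Goal = IsStar p l ⊎ 2 * (2 + q) ≤ D p l + 7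

      split : ∀ b l′ → 2 ≤ S p b l′ ⊎ S p b l′ ≤ 1
      split b l′ with 2 ≤? S p b l′
      ... | yes le = inj₁ le
      ... | no ¬le = inj₂ (≤-pred (≰⇒> ¬le))

      ih′ : ∀ {b l′} → Pick b l l′ → IsStar p l′ ⊎ 2 * (1 + q) ≤ D p l′ + 7
      ih′ i = ih _ (suc-injective (≡.trans (sym (pick-length i)) len)) (line-pick i L) (fresh-pick i f)

      4≤ : 4 ≤ q
      4≤ = ≤-trans (n≤1+n 4) 5≤q

      twice-length : ∀ {b l′ w l″} → Pick b l l′ → Pick w l′ l″ → length l″ ≡ q
      twice-length i j = suc-injective (suc-injective (≡.trans (≡.trans (cong suc (sym (pick-length j))) (sym (pick-length i))) len))

      size : ∀ {b l′ w l″} (i : Pick b l l′) (j : Pick w l′ l″) → D p l″ ≡ 0 → S p w l″ ≡ 0 ⊎ q ≤ 2 + S p w l″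
      size {w = w} {l″} i j eq = subst (λ n → S p w l″ ≡ 0 ⊎ n ≤ 2 + S p w l″) (twice-length i j)
        (star-size (line-pick i L) (fresh-pick i f) j eq (≤-trans 4≤ (≤-reflexive (sym (twice-length i j)))))

      low : (∀ {b l′} → Pick b l l′ → S p b l′ ≤ 1) → Goal
      low deg≤1 with first l len
        where
        first : ∀ {n} l → length l ≡ suc n → ∃[ a ] ∃[ k ] Pick {A = X} a l k
        first (a ∷ k) _ = a , k , here
      ... | a , l′ , i with ih′ i
      -- Degrees at most 1 on q + 2 points allow at most (q + 2)/2 edges, fewer than the 2q - 5 of a
      -- heavy rest.
      ...   | inj₂ h = contradiction few (light q (D p l) (D p l′) 5≤q h (D-delete i))
          where
          D-delete : ∀ {x l k} → Pick x l k → D p k ≤ D p l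
          D-delete i = ≤-trans (m≤n+m _ _) (≤-reflexive (sym (D-pick p i)))
          few : 2 * D p l ≤ (2 + q) * 1
          few = subst (λ n → 2 * D p l ≤ n * 1) len (≤-trans (≤-reflexive (sym (handshake₂ p l)))
                  (≤-trans (∑ₚ-mono l deg≤1) (≤-reflexive (∑ₚ-const 1 l))))
      ...   | inj₁ (w , l″ , j , eq) with size i j eq
      ...     | inj₁ s≡0 = inj₁ (a , l′ , i , ≡.trans (D-pick p j) (cong₂ _+_ s≡0 eq))
      ...     | inj₂ q≤ with pick-commute i j
      -- A star with edges has at least q - 2 ≥ 3 of them at its centre, but all degrees are at most
      -- 1.
      ...       | d , i′ , j′ = contradiction (≤-trans 5≤q (≤-trans q≤ (+-monoʳ-≤ 2 (≤-trans le (deg≤1 i′))))) (<⇒≱ (n≤1+n 4))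
          where
          le : S p w l″ ≤ S p w d
          le = ≤-trans (m≤n+m _ _) (≤-reflexive (sym (S-pick p w j′)))

      high : ∀ {b l′} → Pick b l l′ → 2 ≤ S p b l′ → Goal
      high {b} {l′} i 2≤ with ih′ i
      ... | inj₂ h = inj₂ (≤-trans (heavier q _ _ 2≤ h) (≤-reflexive (cong (_+ 7) (sym (D-pick p i)))))
      ... | inj₁ (w , l″ , j , eq) with pick-commute i j
      ...   | d , j′ , i′ with size i j eq | size j′ i′ eq
      ...     | inj₁ s≡0 | _        = inj₁ (b , l′ , i , ≡.trans (D-pick p j) (cong₂ _+_ s≡0 eq))
      ...     | inj₂ _   | inj₁ t≡0 = inj₁ (w , d , j′ , ≡.trans (D-pick p i′) (cong₂ _+_ t≡0 eq))
      ...     | inj₂ q≤s | inj₂ q≤t with two-stars q (χ p w b) (S p w l″) (S p b l″) q≤s q≤t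
      ...       | inj₂ h = inj₂ (subst (λ n → 2 * (2 + q) ≤ n + 7) (sym total) h)
        where
        total : D p l ≡ χ p w b + S p w l″ + S p b l″
        total = ≡.trans (D-pick p j′) (cong₂ _+_ (S-pick p w i′) (≡.trans (D-pick p i′) (≡.trans (cong (S p b l″ +_) eq) (+-identityʳ _))))
      ...       | inj₁ (c≡0 , q≡s , q≡t) with common-leaf q _ _ l″ 5≤q q≡s q≡t (twice-length i j) {w} {b} refl refl
      ...         | x , x∈ , wx , bx with pick-∈ x∈
      ...           | e , k with pick-commute j k
      ...             | g , k′ , j₁ with pick-commute i k′
      ...               | h , k″ , i₁ = contradiction (ih′ k″) [ not-star , light-rest q≡s q≡t s-e t-e D-h ]′
        where
        s-e : S p w l″ ≡ 1 + S p w e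
        s-e = ≡.trans (S-pick p w k) (cong (_+ S p w e) wx)
        t-e : S p b l″ ≡ 1 + S p b e
        t-e = ≡.trans (S-pick p b k) (cong (_+ S p b e) bx)
        D-e : D p e ≡ 0
        D-e = m+n≡0⇒n≡0 (S p x e) (≡.trans (sym (D-pick p k)) eq)
        D-g : D p g ≡ S p w e
        D-g = ≡.trans (D-pick p j₁) (≡.trans (cong (S p w e +_) D-e) (+-identityʳ _))
        S-g : S p b g ≡ S p b e
        S-g = ≡.trans (S-pick p b j₁) (cong (_+ S p b e) (≡.trans (χ-swapʳ p b w) c≡0))
        D-h : D p h ≡ S p b e + S p w e
        D-h = ≡.trans (D-pick p i₁) (cong₂ _+_ S-g D-g)
        -- Both w and b keep q - 3 ≥ 2 edges. Deleting w leaves those at b, deleting b leaves those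
        -- at w, and deleting another point removes at most one of those at b.
        not-star : ¬ IsStar p h
        not-star (s , r , n , D-r) with pick-compare i₁ n
        ... | inj₁ (refl , refl) = too-few 0 5≤q q≡s s-e (≡.trans (sym D-g) D-r) z≤n
        ... | inj₂ (o , n′ , i₂) with pick-compare j₁ n′
        ...   | inj₁ (refl , refl) = too-few 0 5≤q q≡t t-e
                  (m+n≡0⇒m≡0 _ (≡.trans (sym (D-pick p i₂)) D-r)) z≤n
        ...   | inj₂ (o′ , n″ , j₂) = too-few (χ p b s) 5≤q q≡t t-e
                  (≡.trans (S-pick p b n″) (cong (χ p b s +_) (m+n≡0⇒n≡0 (χ p b w) (≡.trans (sym (S-pick p b j₂))
                    (m+n≡0⇒m≡0 _ (≡.trans (sym (D-pick p i₂)) D-r)))))) (χ≤1 p b s)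

    dichotomy : ∀ m → 5 ≤ m → Dichotomy m
    dichotomy 5 _ l len = star-or-heavy p 5 starOrHeavy₅ len
    dichotomy 6 _ l len = star-or-heavy p 6 starOrHeavy₆ len
    dichotomy (suc (suc m@(suc (suc (suc (suc (suc _))))))) _ =
      dichotomy-step m (s≤s (s≤s (s≤s (s≤s (s≤s z≤n))))) (dichotomy (suc m) (s≤s (s≤s (s≤s (s≤s (s≤s z≤n))))))
    dichotomy 0 ()
    dichotomy 1 (s≤s ())
    dichotomy 2 (s≤s (s≤s ()))
    dichotomy 3 (s≤s (s≤s (s≤s ())))
    dichotomy 4 (s≤s (s≤s (s≤s (s≤s ()))))

-- Two points outside a line

module Pairs (𝓑 : BetweennessStructure) where
  open BetweennessStructure 𝓑
  open Plane 𝓑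
  open Star 𝓑
  open Link 𝓑
  open Degrees 𝓑

  -- The weaker of the two bounds counts: for m ≥ 5 a heavy graph has 2m - 7 ≥ m - 2 edges, so the
  -- minimum m - 3 is left to stars.
  D-low : ∀ {p} l → 5 ≤ length l → Line l → Fresh p l → D p l ≡ 0 ⊎ length l ≤ 3 + D p l
  D-low {p} l 5≤ L f with dichotomy p (length l) 5≤ l refl L f
  ... | inj₂ heavy = inj₂ (linear 1 (+-mono-≤ heavy 5≤) (eq (length l) (D p l)))
    where
    eq : ∀ m d → m + (d + 7 + m) + 1 ≡ 3 + d + (2 * m + 5)
    eq = solve-∀
  ... | inj₁ (w , k , i , D≡0) with star-size L f i D≡0 (≤-pred (≤-trans 5≤ (≤-reflexive (pick-length i))))
  ...   | inj₁ s≡0 = inj₁ (≡.trans (D-pick p i) (cong₂ _+_ s≡0 D≡0))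
  ...   | inj₂ le  = inj₂ (≤-trans (≤-reflexive (pick-length i))
            (≤-trans (s≤s le) (≤-reflexive (cong (3 +_) (sym (≡.trans (D-pick p i) (≡.trans (cong (S p w k +_) D≡0) (+-identityʳ _))))))))

  -- By the equation, exactly two points of k are collinear with p and w.
  record Opposite (p w : X) (k : List X) : Set where
    field
      free  : D p k ≡ 0
      exact : length k ≡ 2 + S p w k
  open Opposite public

  exact-replace : ∀ {p w x y k k′} r → k ↭ x ∷ r → k′ ↭ y ∷ r → Collinear p w x → Collinear p w y →
                  length k ≡ 2 + S p w k → length k′ ≡ 2 + S p w k′
  exact-replace {p} {w} {x} {y} {k} {k′} r σ σ′ cx cy eq = begin
    length k′                    ≡⟨ Perm.↭-length σ′ ⟩
    suc (length r)               ≡⟨ Perm.↭-length σ ⟨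
    length k                     ≡⟨ eq ⟩
    2 + S p w k                  ≡⟨ cong (2 +_) (S-↭ p w σ) ⟩
    2 + (χ p w x + S p w r)      ≡⟨ cong (λ n → 2 + (n + S p w r)) (≡.trans (χ-col cx) (sym (χ-col cy))) ⟩
    2 + (χ p w y + S p w r)      ≡⟨ cong (2 +_) (S-↭ p w σ′) ⟨
    2 + S p w k′                 ∎
    where open ≡-Reasoning

  -- The point x leaves the line and y enters. Both are collinear with p and w, so still exactly two
  -- points are, and y brings no new non-collinear pair. Hence `centre` applies to p and w on the
  -- new line as well.
  opposite-replace : ∀ {p w x y k k′} r → k ↭ x ∷ r → k′ ↭ y ∷ r → Collinear p w x → Collinear p w y →
                     AllCol p y r → Opposite p w k → Opposite p w k′
  opposite-replace {p} {w} {x} {y} r σ σ′ cx cy all o = record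
    { free  = ≡.trans (D-↭ p σ′) (cong₂ _+_ (S-col r all) (m+n≡0⇒n≡0 (S p x r) (≡.trans (sym (D-↭ p σ)) (free o))))
    ; exact = exact-replace r σ σ′ cx cy (exact o)
    }

  centre : ∀ {p w} u v → 4 ≤ length (u ++ v) → Line (u ++ w ∷ v) → Fresh p (u ++ v) → Opposite p w (u ++ v) → Centre p w u v
  centre {p} {w} u v 4≤ L f o
    with star u v (≤-trans (s≤s (s≤s z≤n)) 4≤) L
           (insert (u ++ v) 4≤ (line-⊆ (++⁺ ⊆-refl (w ∷ʳ ⊆-refl)) L) f (D⇒colWith (u ++ v) (free o)))
  ... | inj₁ s≡0            = contradiction 4≤ (<⇒≱ (≤-trans (s≤s (≤-reflexive (≡.trans (exact o) (cong (2 +_) s≡0)))) (n≤1+n 3)))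
  ... | inj₂ (inj₁ (c , _)) = c
  ... | inj₂ (inj₂ le)      = contradiction le (<⇒≱ (≤-reflexive (sym (exact o))))

  -- u a is x₁ … xᵢ, b v is xᵢ₊₁ … xₙ₋₄, and w, p and w′, q are the pairs y, z and u, v of T.
  record Twins (l : List X) : Set where
    field
      {u v}         : List X
      {a w w′ b}    : X
      {p q}         : X
      cover         : l ↭ p ∷ q ∷ u ++ a ∷ w ∷ w′ ∷ b ∷ v
      line          : Line (u ++ a ∷ w ∷ w′ ∷ b ∷ v)
      lineₚ         : Line (u ++ a ∷ p ∷ w′ ∷ b ∷ v)
      line-q        : Line (u ++ a ∷ w ∷ q ∷ b ∷ v)
      lineₚ-q       : Line (u ++ a ∷ p ∷ q ∷ b ∷ v)
      wap           : β w a p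
      ww′p          : β w w′ p
      wqp           : β w q p
      w′wq          : β w′ w q
      w′pq          : β w′ p q
      w′bq          : β w′ b q
      farₚ-left     : NoneCol p w u
      farₚ-right    : NoneCol p w (b ∷ v)
      far-q-left    : NoneCol q w′ (u ++ a ∷ [])
      far-q-right   : NoneCol q w′ v

  mid-∈ : ∀ {A : Set} (t : List A) {x s b z v} → t ++ x ∷ z ∷ v ≡ s ++ b ∷ [] → x ∈ s
  mid-∈ []      {s = y ∷ s} eq = here (∷-injectiveˡ eq)
  mid-∈ []      {s = []}    eq with () ← ∷-injectiveʳ eq
  mid-∈ (y ∷ t) {s = y′ ∷ s} eq = there (mid-∈ t (∷-injectiveʳ eq))
  mid-∈ (y ∷ [])    {s = []} eq with () ← ∷-injectiveʳ eq
  mid-∈ (y ∷ _ ∷ _) {s = []} eq with () ← ∷-injectiveʳ eq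

  module TwoCentres {u w t w′ v p q} (L : Line (u ++ w ∷ t ++ w′ ∷ v)) (5≤ : 5 ≤ length (u ++ w ∷ t ++ w′ ∷ v))
    (fₚ : Fresh p (u ++ w ∷ t ++ w′ ∷ v)) (f-q : Fresh q (u ++ w ∷ t ++ w′ ∷ v))
    (oₚ : Opposite p w (u ++ t ++ w′ ∷ v)) (o-q : Opposite q w′ ((u ++ w ∷ t) ++ v))
    (pww′ : Collinear p w w′) (qw′w : Collinear q w′ w)
    (pq : AllCol p q (u ++ w ∷ t ++ w′ ∷ v)) (p≢q : p ≢ q) where

    private
      c : List X
      c = u ++ w ∷ t ++ w′ ∷ v

      w∈ : w ∈ c
      w∈ = ∈-++⁺ʳ u (here refl)

      w′∈ : w′ ∈ c
      w′∈ = ∈-++⁺ʳ u (there (∈-++⁺ʳ t (here refl)))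

      qp : AllCol q p c
      qp i = col-swapˡ (pq i)

      pwq : Collinear p w q
      pwq = col-swapʳ (pq w∈)

      qw′p : Collinear q w′ p
      qw′p = col-swapʳ (qp w′∈)

      4≤ : ∀ {k x} → c ↭ x ∷ k → 4 ≤ length k
      4≤ σ = ≤-pred (≤-trans 5≤ (≤-reflexive (Perm.↭-length σ)))

      length-replace : ∀ {k k′ r : List X} {x y : X} → k ↭ x ∷ r → k′ ↭ y ∷ r → length k′ ≡ length k
      length-replace σ σ′ = ≡.trans (Perm.↭-length σ′) (sym (Perm.↭-length σ))

    centreₚ : Centre p w u (t ++ w′ ∷ v)
    centreₚ = centre u (t ++ w′ ∷ v) (4≤ (Perm.shift w u _)) L (λ i → fₚ (Any-resp-⊆ (++⁺ {as = u} ⊆-refl (w ∷ʳ ⊆-refl)) i)) oₚ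

    centre-q : Centre q w′ (u ++ w ∷ t) v
    centre-q = centre (u ++ w ∷ t) v (4≤ (↭-trans (↭-reflexive (sym (++-assoc u (w ∷ t) _))) (Perm.shift w′ (u ++ w ∷ t) v)))
      (subst Line (sym (++-assoc u (w ∷ t) _)) L)
      (λ i → f-q (Any-resp-⊆ (⊆-trans (++⁺ {as = u ++ w ∷ t} ⊆-refl (w′ ∷ʳ ⊆-refl)) (subst (λ l → (u ++ w ∷ t) ++ w′ ∷ v ⊆ l) (++-assoc u (w ∷ t) _) ⊆-refl)) i))
      o-q

    ∷ʳ-↭ : ∀ (x : X) l → l ++ x ∷ [] ↭ x ∷ l
    ∷ʳ-↭ x l = ↭-sym (Perm.∷↭∷ʳ x l)

    -- If w and p were at opposite ends, then the nearest neighbours of w′ on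
    -- t w′ v and on t w′ v p would put it in contradictory orders with q.
    no-cycleˡ : ∀ {a s b} → u ≡ [] → t ++ w′ ∷ v ≡ a ∷ s ++ b ∷ [] → NoneCol p w s →
                ¬ Line ((t ++ w′ ∷ v) ++ p ∷ [])
    no-cycleˡ u≡[] = go t v u≡[] refl refl
      where
      q-fresh : ∀ r → (∀ {x} → x ∈ r → x ∈ c) → Fresh q (r ++ p ∷ [])
      q-fresh r inc i with ∈-++⁻ r i
      ... | inj₁ j           = f-q (inc j)
      ... | inj₂ (here refl) = p≢q ∘ sym
      go : ∀ t₀ v₀ {a s b} → u ≡ [] → t₀ ≡ t → v₀ ≡ v → t ++ w′ ∷ v ≡ a ∷ s ++ b ∷ [] → NoneCol p w s →
           ¬ Line ((t ++ w′ ∷ v) ++ p ∷ [])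
      -- With neighbours on both sides, w′ is one of the points of s, none of which is collinear
      -- with p and w.
      go (_ ∷ t₀) (_ ∷ _) refl refl refl eq n L₂ = n (mid-∈ t₀ (∷-injectiveʳ eq)) pww′
      go [] [] refl refl refl eq n L₂ = contradiction 5≤ (<⇒≱ (s≤s (s≤s (s≤s z≤n))))
      go [] (z ∷ v₀) refl refl refl eq n L₂
        with centre [] (v ++ p ∷ []) (≤-trans (4≤ {x = w} refl) (≤-reflexive (sym (length-replace {k = w′ ∷ v} refl (∷ʳ-↭ p v))))) L₂
               (q-fresh v (λ i → there (there i)))
               (opposite-replace v refl (∷ʳ-↭ p v) qw′w qw′p (λ i → qp (there (there i))) o-q) | centre-q
      ... | twin {u₁ = []} () _ _ _ _ _ _ | _
      ... | twin {u₁ = _ ∷ _} () _ _ _ _ _ _ | _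
      ... | cycleʳ () _ _ _ _ _ | _
      ... | cycleˡ {a = a} _ eq₁ aw′q _ _ _ | cycleʳ _ () _ _ _ _
      ... | cycleˡ {a = a} _ eq₁ aw′q _ _ _ | cycleˡ () _ _ _ _ _
      ... | cycleˡ {a = a} _ eq₁ aw′q _ _ _ | twin _ eq₂ _ w′bq _ _ _
        with refl ← ∷-injectiveˡ eq₁ | refl ← ∷-injectiveˡ eq₂ =
        distinct L (w ∷ʳ refl ∷ refl ∷ minimum v₀) (middle-unique w′bq aw′q)
      go (y ∷ t₀) [] refl refl refl eq n L₂
        with centre t (p ∷ []) (≤-trans (4≤ {k = t ++ w′ ∷ []} {x = w} refl) (≤-reflexive (sym (length-replace (∷ʳ-↭ w′ t) (∷ʳ-↭ p t)))))
               (subst Line (++-assoc t (w′ ∷ []) (p ∷ [])) L₂)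
               (q-fresh t (λ i → there (∈-++⁺ˡ i)))
               (opposite-replace t (↭-reflexive (++-identityʳ (w ∷ t))) (∷ʳ-↭ p t) qw′w qw′p (λ i → qp (there (∈-++⁺ˡ i))) o-q) | centre-q
      ... | cycleˡ () _ _ _ _ _ | _
      ... | cycleʳ _ () _ _ _ _ | _
      ... | twin _ _ _ _ _ _ _ | twin _ () _ _ _ _ _
      ... | twin _ _ _ _ _ _ _ | cycleˡ () _ _ _ _ _
      ... | twin {u₁ = u₁} {a = a} t≡ _ w′aq _ _ _ _ | cycleʳ {b = b} {s} {a = a′} eq₂ _ a′w′q _ _ _
        with refl ← proj₂ (∷ʳ-injective (w ∷ u₁) (b ∷ s) (≡.trans (cong (w ∷_) (sym t≡)) eq₂)) =
        line-fresh′ (middle-unique w′aq a′w′q)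
        where
        line-fresh′ : w′ ≢ a
        line-fresh′ e = distinct L (w ∷ʳ ++⁺ {as = a ∷ []} (from∈ (subst (a ∈_) (sym t≡) (∈-++⁺ʳ u₁ (here refl)))) (refl ∷ [])) (sym e)

    snoc≢[] : ∀ (k : List X) {x} → k ++ x ∷ [] ≢ []
    snoc≢[] []      ()
    snoc≢[] (_ ∷ _) ()

    -- On the line q u w, where q has replaced w′, the centre w stands at the end. Its position
    -- there demands β a w p for the last point a of u, against β w a p.
    no-cycleʳ : ∀ {u₁ a} → t ≡ [] → v ≡ [] → u ≡ u₁ ++ a ∷ [] → β w a p → ¬ Line (q ∷ u ++ w ∷ [])
    no-cycleʳ {u₁} {a} refl refl u≡ wap L₂
      with centre (q ∷ u) [] (≤-trans (4≤ (Perm.shift w u (w′ ∷ []))) (≤-reflexive (sym (length-replace (∷ʳ-↭ w′ u) (↭-reflexive (++-identityʳ (q ∷ u)))))))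
             L₂ p-fresh
             (opposite-replace u (∷ʳ-↭ w′ u) (↭-reflexive (++-identityʳ (q ∷ u))) pww′ pwq (pq ∘ ∈-++⁺ˡ) oₚ)
      where
      p-fresh : Fresh p ((q ∷ u) ++ [])
      p-fresh i with ∈-++⁻ (q ∷ u) i
      ... | inj₁ (here refl) = p≢q
      ... | inj₁ (there j)   = fₚ (∈-++⁺ˡ j)
      ... | inj₂ ()
    ... | twin _ () _ _ _ _ _
    ... | cycleˡ () _ _ _ _ _
    ... | cycleʳ {b = b} {s} {a′} eq _ a′wp _ _ _
      with refl ← proj₂ (∷ʳ-injective (q ∷ u₁) (b ∷ s) (≡.trans (cong (q ∷_) (sym u≡)) eq)) =
      distinct L (++⁺ {as = a ∷ []} (from∈ (subst (a ∈_) (sym u≡) (∈-++⁺ʳ u₁ (here refl)))) (refl ∷ minimum _)) (sym (middle-unique wap a′wp))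

    -- Two further exchanges: p for w in the line, seen from q, and q for w′, seen from p. Neither
    -- centre stands at an end, so both are twins again; this gives `w′pq`, `wqp` and the fourth
    -- line.
    build-twins : ∀ {u₁ a b v₁} → t ≡ [] → u ≡ u₁ ++ a ∷ [] → v ≡ b ∷ v₁ → β w a p → β w w′ p → β w′ w q → β w′ b q →
                  NoneCol p w u₁ → NoneCol p w v → NoneCol q w′ u → NoneCol q w′ v₁ →
                  Line (u ++ p ∷ w′ ∷ v) → Line ((u ++ w ∷ []) ++ q ∷ v) → Twins (p ∷ q ∷ c)
    build-twins {u₁} {a} {b} {v₁} refl refl refl wap ww′p w′wq w′bq n₁ n₂ n₃ n₄ Lₚ L-q
      with centre (u ++ p ∷ []) v (≤-trans 4≤uv (≤-reflexive (sym (length-replace (∷ʳ-split w) (∷ʳ-split p)))))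
             (subst Line (sym (++-assoc u (p ∷ []) _)) Lₚ) q-fresh
             (opposite-replace (u ++ v) (∷ʳ-split w) (∷ʳ-split p) qw′w qw′p (qp ∘ uv∈) o-q)
         | centre u (q ∷ v) (≤-trans (4≤ (Perm.shift w u _)) (≤-reflexive (sym (length-replace (Perm.shift w′ u v) (Perm.shift q u v)))))
             (subst Line (++-assoc u (w ∷ []) _) L-q) p-fresh
             (opposite-replace (u ++ v) (Perm.shift w′ u v) (Perm.shift q u v) pww′ pwq (pq ∘ uv∈) oₚ)
      where
      ∷ʳ-split : ∀ x → (u ++ x ∷ []) ++ v ↭ x ∷ u ++ v
      ∷ʳ-split x = ↭-trans (↭-reflexive (++-assoc u (x ∷ []) v)) (Perm.shift x u v)
      4≤uv : 4 ≤ length ((u ++ w ∷ []) ++ v)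
      4≤uv = 4≤ (↭-trans (↭-reflexive (sym (++-assoc u (w ∷ []) _))) (Perm.shift w′ (u ++ w ∷ []) v))
      uv∈ : ∀ {x} → x ∈ u ++ v → x ∈ c
      uv∈ = Any-resp-⊆ (++⁺ {as = u} ⊆-refl (w ∷ʳ w′ ∷ʳ ⊆-refl))
      q-fresh : Fresh q ((u ++ p ∷ []) ++ v)
      q-fresh i with Perm.∈-resp-↭ (∷ʳ-split p) i
      ... | here refl = p≢q ∘ sym
      ... | there j   = f-q (uv∈ j)
      p-fresh : Fresh p (u ++ q ∷ v)
      p-fresh i with Perm.∈-resp-↭ (Perm.shift q u v) i
      ... | here refl = p≢q
      ... | there j   = fₚ (uv∈ j)
    ... | cycleˡ eq _ _ _ _ _ | _                   = contradiction eq (snoc≢[] u)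
    ... | cycleʳ _ () _ _ _ _ | _
    ... | twin _ _ _ _ _ _ _  | cycleˡ eq _ _ _ _ _ = contradiction eq (snoc≢[] u₁)
    ... | twin _ _ _ _ _ _ _  | cycleʳ _ () _ _ _ _
    ... | twin {u₁ = u₂} eq₂ _ w′a₂q _ _ _ Lₚ-q | twin _ eq₃ _ wqp _ _ _
      with refl ← proj₂ (∷ʳ-injective u u₂ eq₂) | refl ← ∷-injectiveˡ eq₃ = record
      { cover       = prep p (prep q (↭-reflexive (++-assoc u₁ (a ∷ []) _)))
      ; line        = regroup L
      ; lineₚ       = regroup Lₚ
      ; line-q      = regroup (subst Line (++-assoc u (w ∷ []) _) L-q)
      ; lineₚ-q     = regroup (subst Line (++-assoc u (p ∷ []) _) Lₚ-q)
      ; wap         = wap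
      ; ww′p        = ww′p
      ; wqp         = wqp
      ; w′wq        = w′wq
      ; w′pq        = w′a₂q
      ; w′bq        = w′bq
      ; farₚ-left   = n₁
      ; farₚ-right  = n₂
      ; far-q-left  = n₃
      ; far-q-right = n₄
      }
      where
      regroup : ∀ {r} → Line ((u₁ ++ a ∷ []) ++ r) → Line (u₁ ++ a ∷ r)
      regroup = subst Line (++-assoc u₁ (a ∷ []) _)

    twins : t ≡ [] × Twins (p ∷ q ∷ c)
    twins with centreₚ
    ... | cycleˡ u≡[] eq _ _ n L₂ = contradiction L₂ (no-cycleˡ u≡[] eq n)
    ... | cycleʳ _ eq _ _ _ _     = contradiction (sym (cong length eq)) (absurd t)
      where
      absurd : ∀ t → 0 ≢ length (t ++ w′ ∷ v)
      absurd []      ()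
      absurd (_ ∷ _) ()
    ... | twin {u₁ = u₁} {a} {b} {v₁} u≡ tw′v≡ wap wbp n₁ n₂ Lₚ = go t refl centre-q
      where
      go : ∀ t₀ → t₀ ≡ t → Centre q w′ (u ++ w ∷ t) v → t ≡ [] × Twins (p ∷ q ∷ c)
      -- To the right of w only its neighbour b is collinear with p and w; so w′ is that neighbour
      -- and t is empty.
      go (_ ∷ t₀) refl _ = contradiction pww′ (n₂ (subst (w′ ∈_) (∷-injectiveʳ tw′v≡) (∈-++⁺ʳ t₀ (here refl))))
      go [] refl (cycleˡ eq _ _ _ _ _)       = contradiction eq (snoc≢[] u)
      go [] refl (cycleʳ eq₁ eq₂ _ _ _ L₂)   = contradiction L₂ (no-cycleʳ refl eq₂ u≡ wap)
      go [] refl (twin {u₁ = u₂} eq₁ eq₂ w′a₂q w′b₂q n₃ n₄ L-q)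
        with refl ← ∷-injectiveˡ tw′v≡ | refl ← ∷-injectiveʳ tw′v≡
           | refl , refl ← ∷ʳ-injective u u₂ eq₁ =
        refl , build-twins refl u≡ eq₂ wap wbp w′a₂q w′b₂q n₁ n₂ n₃ n₄ Lₚ L-q

-- The lower bound for the co-size and the case of equality

module Structure (𝓑 : BetweennessStructure) where
  open BetweennessStructure 𝓑
  open Plane 𝓑
  open Star 𝓑
  open Link 𝓑
  open Degrees 𝓑
  open Pairs 𝓑

  -- A line with one point more than c: x leaves it, while p and q both enter.
  Longer : List X → X → X → Set
  Longer c p q = ∃[ x ] ∃[ k ] ∃[ d ] (c ↭ x ∷ k × Line d × d ↭ p ∷ q ∷ k)

  twins-↭ : ∀ {k l} → k ↭ l → Twins k → Twins l
  twins-↭ σ t = record { Twins t ; cover = ↭-trans (↭-sym σ) (Twins.cover t) }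

  -- Exchanging w for p in the line gives a line of the same length, so q sees
  -- as many non-collinear pairs in it as before, unless q extends it.
  exchange : ∀ {p q w} u v → 5 ≤ length (u ++ w ∷ v) → Line (u ++ w ∷ v) → Fresh p (u ++ w ∷ v) → Fresh q (u ++ w ∷ v) →
             p ≢ q → Opposite p w (u ++ v) → length (u ++ w ∷ v) ≡ 3 + D q (u ++ w ∷ v) → AllCol p q (u ++ w ∷ v) →
             Longer (u ++ w ∷ v) p q ⊎ AllCol q w (u ++ v)
  exchange {p} {q} {w} u v 5≤ L fₚ f-q p≢q o eq pq
    with insert (u ++ v) (≤-pred (≤-trans 5≤ (≤-reflexive (Perm.↭-length (Perm.shift w u v)))))
           (line-⊆ (++⁺ ⊆-refl (w ∷ʳ ⊆-refl)) L) (λ i → fₚ (uv∈ i)) (D⇒colWith (u ++ v) (free o))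
    where
    uv∈ : ∀ {x} → x ∈ u ++ v → x ∈ u ++ w ∷ v
    uv∈ = Any-resp-⊆ (++⁺ {as = u} ⊆-refl (w ∷ʳ ⊆-refl))
  ... | u₁ , v₁ , uv≡ , L₁ = decide (D-low (u₁ ++ p ∷ v₁) (≤-trans 5≤ (≤-reflexive same-length)) L₁ q-fresh)
    where
    uv∈ : ∀ {x} → x ∈ u ++ v → x ∈ u ++ w ∷ v
    uv∈ = Any-resp-⊆ (++⁺ {as = u} ⊆-refl (w ∷ʳ ⊆-refl))
    σ : u₁ ++ p ∷ v₁ ↭ p ∷ u ++ v
    σ = subst (λ l → u₁ ++ p ∷ v₁ ↭ p ∷ l) (sym uv≡) (Perm.shift p u₁ v₁)
    same-length : length (u ++ w ∷ v) ≡ length (u₁ ++ p ∷ v₁)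
    same-length = ≡.trans (Perm.↭-length (Perm.shift w u v)) (sym (Perm.↭-length σ))
    q-fresh : Fresh q (u₁ ++ p ∷ v₁)
    q-fresh i with Perm.∈-resp-↭ σ i
    ... | here refl = p≢q ∘ sym
    ... | there j   = f-q (uv∈ j)
    D-q : D q (u₁ ++ p ∷ v₁) ≡ D q (u ++ v)
    D-q = ≡.trans (D-↭ q σ) (cong (_+ D q (u ++ v)) (S-col (u ++ v) (λ i → col-swapˡ (pq (uv∈ i)))))
    decide : D q (u₁ ++ p ∷ v₁) ≡ 0 ⊎ length (u₁ ++ p ∷ v₁) ≤ 3 + D q (u₁ ++ p ∷ v₁) →
             Longer (u ++ w ∷ v) p q ⊎ AllCol q w (u ++ v)
    decide (inj₁ D≡0) with insert (u₁ ++ p ∷ v₁) (≤-trans (n≤1+n 4) (≤-trans 5≤ (≤-reflexive same-length))) L₁ q-fresh (D⇒colWith (u₁ ++ p ∷ v₁) D≡0)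
    ... | u₂ , v₂ , eq₂ , L₂ = inj₁ (w , u ++ v , u₂ ++ q ∷ v₂ , Perm.shift w u v , L₂ ,
          ↭-trans (subst (λ l → u₂ ++ q ∷ v₂ ↭ q ∷ l) (sym eq₂) (Perm.shift q u₂ v₂)) (trans (prep q σ) (swap q p refl)))
    decide (inj₂ le) = inj₂ (col-S (u ++ v) (n≤0⇒n≡0 (+-cancelʳ-≤ (D q (u ++ v)) (S q w (u ++ v)) 0 (+-cancelˡ-≤ 3 _ _ (begin
      3 + (S q w (u ++ v) + D q (u ++ v))  ≡⟨ cong (3 +_) (D-↭ q (Perm.shift w u v)) ⟨
      3 + D q (u ++ w ∷ v)                 ≡⟨ eq ⟨
      length (u ++ w ∷ v)                  ≡⟨ same-length ⟩
      length (u₁ ++ p ∷ v₁)                ≤⟨ le ⟩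
      3 + D q (u₁ ++ p ∷ v₁)               ≡⟨ cong (3 +_) D-q ⟩
      3 + (0 + D q (u ++ v))               ∎)))))
      where open ≤-Reasoning

  CentreAt : X → List X → ℕ → Set
  CentreAt p c n = ∃[ u ] ∃[ w ] ∃[ v ] (c ≡ u ++ w ∷ v × Opposite p w (u ++ v) × length u ≡ n)

  centre-exists : ∀ {p} c → 5 ≤ length c → Line c → Fresh p c → length c ≡ 3 + D p c → ∃[ n ] CentreAt p c n
  centre-exists {p} c 5≤ L f eq with dichotomy p (length c) 5≤ c refl L f
  ... | inj₂ heavy = contradiction
    (linear {C = 1} {D = 0} 0 (+-mono-≤ (≤-reflexive (sym eq)) (+-mono-≤ heavy 5≤)) (identity (length c) (D p c)))
    (<⇒≱ ≤-refl)
    where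
    identity : ∀ m d → 1 + (m + (d + 7 + m)) + 0 ≡ 0 + (3 + d + (2 * m + 5))
    identity = solve-∀
  ... | inj₁ (w , k , i , D≡0) with pick-split i
  ...   | u , v , refl , refl = length u , u , w , v , refl , record { free = D≡0 ; exact = exact′ } , refl
    where
    exact′ : length (u ++ v) ≡ 2 + S p w (u ++ v)
    exact′ = suc-injective (≡.trans (sym (pick-length i)) (≡.trans eq (cong (3 +_) (≡.trans (D-pick p i)
               (≡.trans (cong (S p w (u ++ v) +_) D≡0) (+-identityʳ _))))))

  Adjacent : ℕ → ℕ → Set
  Adjacent m n = n ≡ suc m ⊎ m ≡ suc n

  pair : ∀ {p q} c {m n} → 5 ≤ length c → Line c → Fresh p c → Fresh q c → p ≢ q →
         length c ≡ 3 + D p c → length c ≡ 3 + D q c → AllCol p q c → CentreAt p c m → CentreAt q c n →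
         Longer c p q ⊎ (Twins (p ∷ q ∷ c) × Adjacent m n)
  pair {p} {q} c 5≤ L fₚ f-q p≢q eₚ e-q pq (u , w , v , refl , oₚ , refl) (u′ , w′ , v′ , c≡ , o-q , refl)
    with exchange u v 5≤ L fₚ f-q p≢q oₚ e-q pq
       | exchange u′ v′ (subst (λ c → 5 ≤ length c) c≡ 5≤) (subst Line c≡ L) (subst (Fresh q) c≡ f-q) (subst (Fresh p) c≡ fₚ)
           (p≢q ∘ sym) o-q (subst (λ c → length c ≡ 3 + D p c) c≡ eₚ) (subst (AllCol q p) c≡ (λ i → col-swapˡ (pq i)))
  ... | inj₁ longer | _ = inj₁ longer
  ... | inj₂ _ | inj₁ (x , k , d , σ , L′ , σ′) =
    inj₁ (x , k , d , subst (_↭ x ∷ k) (sym c≡) σ , L′ , ↭-trans σ′ (swap q p refl))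
  ... | inj₂ qw | inj₂ pw′ with split-compare u u′ c≡
  -- The centres cannot coincide: q would be collinear with w and every other point of the line,
  -- whereas `exact` allows just two such points.
  ...   | inj₁ (refl , refl) = contradiction
    (≤-trans 5≤ (≤-reflexive (≡.trans (Perm.↭-length (Perm.shift w u v)) (cong suc (≡.trans (exact o-q) (cong (2 +_) (S-col (u ++ v) qw)))))))
    (<⇒≱ (n≤1+n 4))
  ...   | inj₂ (inj₁ (y , t , refl , wv≡)) with refl ← ∷-injectiveˡ wv≡ | refl ← ∷-injectiveʳ wv≡
    with TwoCentres.twins {u} {w} {t} {w′} {v′} {p} {q} L 5≤ fₚ f-q oₚ o-q
           (col-swapʳ (pw′ (∈-++⁺ˡ (∈-++⁺ʳ u (here refl))))) (col-swapʳ (qw (∈-++⁺ʳ u (∈-++⁺ʳ t (here refl))))) pq p≢q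
  ...     | refl , twins = inj₂ (twins , inj₁ (≡.trans (length-++ u) (+-comm (length u) 1)))
  pair {p} {q} c 5≤ L fₚ f-q p≢q eₚ e-q pq (u , w , v , refl , oₚ , refl) (u′ , w′ , v′ , c≡ , o-q , refl)
    | inj₂ qw | inj₂ pw′ | inj₂ (inj₂ (y , t , refl , wv≡)) with refl ← ∷-injectiveˡ wv≡ | refl ← ∷-injectiveʳ wv≡
    with TwoCentres.twins {u′} {w′} {t} {w} {v} {q} {p} (subst Line c≡ L) (subst (λ c → 5 ≤ length c) c≡ 5≤)
           (subst (Fresh q) c≡ f-q) (subst (Fresh p) c≡ fₚ) o-q oₚ
           (col-swapʳ (qw (∈-++⁺ˡ (∈-++⁺ʳ u′ (here refl))))) (col-swapʳ (pw′ (∈-++⁺ʳ u′ (∈-++⁺ʳ t (here refl)))))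
           (subst (AllCol q p) c≡ (λ i → col-swapˡ (pq i))) (p≢q ∘ sym)
  ...     | refl , twins = inj₂ (twins-↭ (trans (swap q p refl) (prep p (prep q (↭-reflexive (sym c≡))))) twins ,
                                 inj₂ (≡.trans (length-++ u′) (+-comm (length u′) 1)))

  HasFive : List X → Set
  HasFive l = ∃[ k ] ∃[ r ] (l ↭ k ++ r × length k ≡ 5 × τ k ≡ 0)

  five-step : ∀ {n c} → (∀ l → length l ≡ n → HasFive l ⊎ c ≤ τ l) →
              ∀ l → length l ≡ suc n → HasFive l ⊎ 3 * τ l + suc n * c ≤ suc n * τ l
  five-step {n} {c} ih l len with pick-or {P = λ _ k → HasFive k} {Q = λ _ k → c ≤ τ k} l
                                 (λ {x} {k} i → ih k (suc-injective (≡.trans (sym (pick-length i)) len)))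
  ... | inj₁ (x , k , i , h , r , σ , len₅ , τ≡0) = inj₁ (h , x ∷ r ,
          ↭-trans (pick-↭ i) (↭-trans (prep x σ) (↭-sym (Perm.shift x h r))) , len₅ , τ≡0)
  ... | inj₂ le = inj₂ (subst (λ n → 3 * τ l + n * c ≤ n * τ l) len (average l c le))

  five₅ : ∀ l → length l ≡ 5 → HasFive l ⊎ 1 ≤ τ l
  five₅ l len with τ l in eq
  ... | zero  = inj₁ (l , [] , ↭-reflexive (sym (++-identityʳ l)) , len , eq)
  ... | suc _ = inj₂ (s≤s z≤n)

  private
    improve : ∀ {t} k c d → 3 * t + k * c ≤ k * t → (∀ s → s < d → k * s < 3 * s + k * c) → d ≤ t
    improve {t} k c d le h with d ≤? t
    ... | yes d≤t = d≤t
    ... | no ¬le  = contradiction le (<⇒≱ (h t (≰⇒> ¬le)))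

    monotone : ∀ {s} j t k → suc ((3 + j) * s) ≤ 3 * s + k → t ≤ s → suc ((3 + j) * t) ≤ 3 * t + k
    monotone {s} j t k le t≤s = linear 0 (+-mono-≤ le (*-monoʳ-≤ j t≤s)) (eq j s t k)
      where
      eq : ∀ j s t k → suc ((3 + j) * t) + (3 * s + k + j * s) + 0 ≡ 3 * t + k + (suc ((3 + j) * s) + j * t)
      eq = solve-∀

  -- If all deletions of one point from n points have co-size at least c, `five-step` gives at least
  -- nc/(n - 3). Here this is 6 · 1/3 = 2; for seven points it is 7 · 2/4, rounded up to 4.
  five₆ : ∀ l → length l ≡ 6 → HasFive l ⊎ 2 ≤ τ l
  five₆ l len = Sum.map₂ (λ le → improve 6 1 2 le (λ s s< → monotone 3 s 6 (≤ᵇ⇒≤ 7 9 _) (≤-pred s<))) (five-step five₅ l len)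

  five₇ : ∀ l → length l ≡ 7 → HasFive l ⊎ 4 ≤ τ l
  five₇ l len = Sum.map₂ (λ le → improve 7 2 4 le (λ s s< → monotone 4 s 14 (≤ᵇ⇒≤ 22 23 _) (≤-pred s<))) (five-step five₆ l len)

  -- The start is 8 · 4/5, rounded up to 7. After that (9 + k)(7 + 2k)/(6 + k) exceeds 8 + 2k, so
  -- every further point adds two.
  five₈₊ : ∀ k l → length l ≡ 8 + k → HasFive l ⊎ 7 + 2 * k ≤ τ l
  five₈₊ zero    l len = Sum.map₂ (λ le → improve 8 4 7 le (λ s s< → monotone 5 s 32 (≤ᵇ⇒≤ 49 50 _) (≤-pred s<))) (five-step five₇ l len)
  five₈₊ (suc k) l len = Sum.map₂
    (λ le → improve (9 + k) (7 + 2 * k) (7 + 2 * suc k) le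
      (λ s s< → monotone (6 + k) s _ (linear (14 + 5 * k) z≤n (eq k)) (≤-pred s<)))
    (five-step (five₈₊ k) l len)
    where
    eq : ∀ k → suc ((9 + k) * (6 + 2 * suc k)) + 0 + (14 + 5 * k) ≡ 3 * (6 + 2 * suc k) + (9 + k) * (7 + 2 * k) + 0
    eq = solve-∀

  -- The co-sizes of a line, and of a line of n - 1 points with one point outside whose graph is a
  -- star with edges.
  Small : ℕ → ℕ → Set
  Small n t = t ≡ 0 ⊎ (n ≤ 4 + t × 2 + t ≤ n)

  Result : List X → Set
  Result l = Small (length l) (τ l) ⊎
             (2 * length l ≤ τ l + 10 × (9 ≤ length l → τ l + 10 ≡ 2 * length l → Twins l))

  D-++ : ∀ p r c → D p (r ++ c) ≡ D p c + (D p r + ∑ r (λ q → S p q c))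
  D-++ p []      c = sym (+-identityʳ _)
  D-++ p (q ∷ r) c = ≡.trans (cong₂ _+_ (S-++ p q r c) (D-++ p r c)) (eq (S p q r) (S p q c) (D p c) (D p r) (∑ r (λ q → S p q c)))
    where
    eq : ∀ a b d e f → a + b + (d + (e + f)) ≡ d + (a + e + (b + f))
    eq = solve-∀

  D-prefix : ∀ p r c → D p c ≤ D p (r ++ c)
  D-prefix p r c = ≤-trans (m≤m+n _ _) (≤-reflexive (sym (D-++ p r c)))

  -- Only triangles with one point outside and two on the line are counted, so no triangle is
  -- counted for two points p.
  τ-lower : ∀ r {c} → (∀ {p} → p ∈ r → length c ≤ 3 + D p c) → length r * length c ≤ 3 * length r + τ (r ++ c)
  τ-lower []      _  = z≤n
  τ-lower (p ∷ r) {c} le = linear 0 (+-mono-≤ (le (here refl)) (+-mono-≤ (D-prefix p r c) (τ-lower r (le ∘ there))))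
    (eq (length c) (length r * length c) (D p c) (D p (r ++ c)) (length r) (τ (r ++ c)))
    where
    eq : ∀ m km d d′ k t → m + km + (3 + d + (d′ + (3 * k + t))) + 0 ≡ 3 * suc k + (d′ + t) + (m + (d + km))
    eq = solve-∀

  record Split (l r c : List X) : Set where
    field
      arrangement : l ↭ r ++ c
      5≤          : 5 ≤ length c
      line-c      : Line c
      distinct-l  : Distinct l

    distinct-r++c : Distinct (r ++ c)
    distinct-r++c = distinct-↭ arrangement distinct-l

    fresh : ∀ {p} → p ∈ r → Fresh p c
    fresh i j = distinct-r++c (++⁺ (from∈ i) (from∈ j))

    total : length l ≡ length r + length c
    total = ≡.trans (Perm.↭-length arrangement) (length-++ r)

  open Split

  permute : ∀ {l r r′ c} → r ↭ r′ → Split l r c → Split l r′ c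
  permute {c = c} σ s = record { Split s ; arrangement = ↭-trans (arrangement s) (Perm.++⁺ʳ c σ) }

  -- By `D-low`, a point outside for which this fails has `D p c ≡ 0` and can be inserted into c.
  Blocked : List X → List X → Set
  Blocked r c = ∀ {p} → p ∈ r → length c ≤ 3 + D p c

  -- With k points outside a line of m points, k (m - 3) exceeds
  -- 2 (k + m) - 10 by (k - 2) (m - 5).
  two-outside : ∀ {l p q r c} → Split l (p ∷ q ∷ r) c → Blocked (p ∷ q ∷ r) c →
                ∃[ e ] ∃[ e₁ ] ∃[ e₂ ] (2 * length l + (e₁ + e₂ + S p q c + e) ≡ τ l + 10 ×
                  3 + D p c ≡ length c + e₁ × 3 + D q c ≡ length c + e₂)
  two-outside {l} {p} {q} {r} {c} s b =
    subst (λ n → ∃[ e ] ∃[ e₁ ] ∃[ e₂ ] (2 * n + (e₁ + e₂ + S p q c + e) ≡ τ l + 10 × 3 + D p c ≡ length c + e₁ × 3 + D q c ≡ length c + e₂))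
      (sym (total s)) (count {k = length r} (5≤ s) (b (here refl)) (b (there (here refl))) (τ-lower r (λ i → b (there (there i)))) τ-bound)
    where
    cross : D p c + S p q c ≤ D p (q ∷ r ++ c)
    cross = ≤-trans (≤-reflexive (+-comm (D p c) (S p q c)))
              (+-mono-≤ (≤-trans (m≤n+m _ _) (≤-reflexive (sym (S-++ p q r c)))) (D-prefix p r c))
    τ-bound : (D p c + S p q c) + (D q c + τ (r ++ c)) ≤ τ l
    τ-bound = ≤-trans (+-mono-≤ cross (+-monoˡ-≤ (τ (r ++ c)) (D-prefix q r c))) (≤-reflexive (sym (τ-↭ (arrangement s))))
    count : ∀ {m k d₁ d₂ s′ t t′} → 5 ≤ m → m ≤ 3 + d₁ → m ≤ 3 + d₂ → k * m ≤ 3 * k + t → (d₁ + s′) + (d₂ + t) ≤ t′ →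
            ∃[ e ] ∃[ e₁ ] ∃[ e₂ ] (2 * (2 + k + m) + (e₁ + e₂ + s′ + e) ≡ t′ + 10 × 3 + d₁ ≡ m + e₁ × 3 + d₂ ≡ m + e₂)
    count {m} {k} {d₁} {d₂} {s′} {t} {t′} h₅ h₁ h₂ h₃ h₄
      with m≤n⇒∃[o]m+o≡n h₅ | m≤n⇒∃[o]m+o≡n h₁ | m≤n⇒∃[o]m+o≡n h₂ | m≤n⇒∃[o]m+o≡n h₃ | m≤n⇒∃[o]m+o≡n h₄
    ... | j , refl | e₁ , eq₁ | e₂ , eq₂ | e₃ , eq₃ | e₄ , refl =
      -- Here k counts the points outside other than p and q, and m = 5 + j, so `k * j` is the
      -- product (k - 2)(m - 5) named above; `e₃` and `e₄` are the slacks of the last two bounds.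
      k * j + e₃ + e₄ , e₁ , e₂ , +-cancelˡ-≡ (6 + 3 * k) _ _ (≡.trans (identity k j e₁ e₂ s′ e₃ e₄)
        (≡.trans (cong₂ (λ a b → a + (b + s′ + e₄ + 10)) eq₃ (cong₂ _+_ eq₁ eq₂)) (identity′ k d₁ d₂ s′ t e₄))) , sym eq₁ , sym eq₂
      where
      identity : ∀ k j e₁ e₂ s e₃ e₄ → 6 + 3 * k + (2 * (2 + k + (5 + j)) + (e₁ + e₂ + s + (k * j + e₃ + e₄))) ≡
                 (k * (5 + j) + e₃) + ((5 + j + e₁) + (5 + j + e₂) + s + e₄ + 10)
      identity = solve-∀
      identity′ : ∀ k d₁ d₂ s t e₄ → (3 * k + t) + ((3 + d₁) + (3 + d₂) + s + e₄ + 10) ≡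
                  6 + 3 * k + (d₁ + s + (d₂ + t) + e₄ + 10)
      identity′ = solve-∀

  two-bound : ∀ {l p q r c} → Split l (p ∷ q ∷ r) c → Blocked (p ∷ q ∷ r) c → 2 * length l ≤ τ l + 10
  two-bound {l} s b = ≤-trans (m≤m+n (2 * length l) _) (≤-reflexive (proj₁ (proj₂ (proj₂ (proj₂ (two-outside s b))))))

  -- Equality annihilates every slack of `two-outside`: p and q both have the least number of edges,
  -- and no point of c forms a triangle with them.
  tight : ∀ {l p q r c} → Split l (p ∷ q ∷ r) c → Blocked (p ∷ q ∷ r) c → τ l + 10 ≡ 2 * length l →
          length c ≡ 3 + D p c × length c ≡ 3 + D q c × AllCol p q c
  tight {l} {p} {q} {r} {c} s b eq′ = go (two-outside s b)
    where
    zeros : ∀ {e e₁ e₂ s′ t′ n} → n + (e₁ + e₂ + s′ + e) ≡ t′ → t′ ≡ n → e₁ ≡ 0 × e₂ ≡ 0 × s′ ≡ 0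
    zeros {e} {e₁} {e₂} {s′} {n = n} eq eq′ = m+n≡0⇒m≡0 e₁ first₂≡0 , m+n≡0⇒n≡0 e₁ first₂≡0 , m+n≡0⇒n≡0 (e₁ + e₂) first₃≡0
      where
      first₃≡0 : e₁ + e₂ + s′ ≡ 0
      first₃≡0 = m+n≡0⇒m≡0 _ (+-cancelˡ-≡ n _ 0 (≡.trans (≡.trans eq eq′) (sym (+-identityʳ n))))
      first₂≡0 : e₁ + e₂ ≡ 0
      first₂≡0 = m+n≡0⇒m≡0 _ first₃≡0
    shift-zero : ∀ {e d m} → e ≡ 0 → d ≡ m + e → m ≡ d
    shift-zero refl eq = sym (≡.trans eq (+-identityʳ _))
    go : ∃[ e ] ∃[ e₁ ] ∃[ e₂ ] (2 * length l + (e₁ + e₂ + S p q c + e) ≡ τ l + 10 ×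
           3 + D p c ≡ length c + e₁ × 3 + D q c ≡ length c + e₂) →
         length c ≡ 3 + D p c × length c ≡ 3 + D q c × AllCol p q c
    go (e , e₁ , e₂ , eq , eqₚ , eq-q) with zeros {e} {e₁} {e₂} eq eq′
    ... | e₁≡0 , e₂≡0 , s≡0 = shift-zero e₁≡0 eqₚ , shift-zero e₂≡0 eq-q , col-S c s≡0

  -- Adjacent numbers have different parities, and there are only two parities.
  adjacent-triple : ∀ {i j k} → Adjacent i j → Adjacent i k → ¬ Adjacent j k
  adjacent-triple (inj₁ refl) (inj₁ refl) (inj₁ e) = 1+n≢n (sym e)
  adjacent-triple (inj₁ refl) (inj₁ refl) (inj₂ e) = 1+n≢n (sym e)
  adjacent-triple {k = k} (inj₁ refl) (inj₂ refl) (inj₁ e) = m≢1+n+m k {2} e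
  adjacent-triple {k = k} (inj₁ refl) (inj₂ refl) (inj₂ e) = 1+n≢n e
  adjacent-triple (inj₂ refl) (inj₁ refl) (inj₁ e) = 1+n≢n e
  adjacent-triple {j = j} (inj₂ refl) (inj₁ refl) (inj₂ e) = m≢1+n+m j {2} e
  adjacent-triple (inj₂ refl) (inj₂ refl) (inj₁ e) = 1+n≢n (sym e)
  adjacent-triple (inj₂ refl) (inj₂ refl) (inj₂ e) = 1+n≢n (sym e)

  -- All triangles contain p. A heavy graph lies strictly above 2n - 10, since 2(n - 1) - 7 = 2n -
  -- 9, and the stars are covered by `Small`.
  one-outside : ∀ {l p c} → Split l (p ∷ []) c → Result l
  one-outside {l} {p} {c} s = decide (dichotomy p (length c) (5≤ s) c refl (line-c s) (fresh s (here refl)))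
    where
    τ≡ : τ l ≡ D p c
    τ≡ = ≡.trans (τ-↭ (arrangement s)) (≡.trans (cong (D p c +_) (line-τ (line-c s))) (+-identityʳ _))
    identity : ∀ m d → 2 * (1 + m) + (d + 7) + 0 ≡ d + 9 + 2 * m
    identity = solve-∀
    decide : IsStar p c ⊎ 2 * length c ≤ D p c + 7 → Result l
    decide (inj₂ heavy) = inj₂ (≤-trans bound (+-monoʳ-≤ (τ l) (n≤1+n 9)) , λ _ eq →
      contradiction (≤-trans (≤-reflexive eq) bound) (<⇒≱ (≤-reflexive (sym (+-suc (τ l) 9)))))
      where
      bound : 2 * length l ≤ τ l + 9
      bound = subst₂ (λ n t → 2 * n ≤ t + 9) (sym (total s)) (sym τ≡) (linear 0 heavy (identity (length c) (D p c)))
    decide (inj₁ (w , k , i , D≡0)) with star-size (line-c s) (fresh s (here refl)) i D≡0 (≤-pred (≤-trans (5≤ s) (≤-reflexive (pick-length i))))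
    ... | inj₁ s≡0 = inj₁ (inj₁ (≡.trans τ≡ (≡.trans (D-pick p i) (cong₂ _+_ s≡0 D≡0))))
    ... | inj₂ le  = inj₁ (inj₂ (subst₂ (λ n t → n ≤ 4 + t × 2 + t ≤ n) (sym length≡) (sym τ≡S)
          (s≤s (s≤s le) , s≤s (s≤s (S≤length p w k)))))
      where
      τ≡S : τ l ≡ S p w k
      τ≡S = ≡.trans τ≡ (≡.trans (D-pick p i) (≡.trans (cong (S p w k +_) D≡0) (+-identityʳ _)))
      length≡ : length l ≡ 2 + length k
      length≡ = ≡.trans (total s) (cong suc (pick-length i))

  lengthen : ∀ {l p q r c} → Split l (p ∷ q ∷ r) c → Longer c p q → ∃[ x ] ∃[ d ] Split l (x ∷ r) d
  lengthen {p = p} {q} {r} s (x , k , d , σ , L , σ′) = x , d , record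
    { arrangement = ↭-trans (arrangement s) (↭-trans (Perm.++⁺ˡ (p ∷ q ∷ r) σ) (↭-trans move (prep x (Perm.++⁺ˡ r (↭-sym σ′)))))
    ; 5≤          = ≤-trans (5≤ s) (≤-trans (≤-reflexive (Perm.↭-length σ)) (≤-trans (n≤1+n _) (≤-reflexive (sym (Perm.↭-length σ′)))))
    ; line-c      = L
    ; distinct-l  = distinct-l s
    }
    where
    move : (p ∷ q ∷ r) ++ x ∷ k ↭ x ∷ r ++ p ∷ q ∷ k
    move = ↭-trans (Perm.shift x (p ∷ q ∷ r) k)
             (prep x (↭-trans (prep p (↭-sym (Perm.shift q r k))) (↭-sym (Perm.shift p r (q ∷ k)))))

  absorb : ∀ {l r c p} → Split l r c → p ∈ r → D p c ≡ 0 → ∃[ r′ ] ∃[ c′ ] (suc (length r′) ≡ length r × Split l r′ c′)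
  absorb {l} {r} {c} {p} s p∈ D≡0 with pick-∈ p∈ | insert c (≤-trans (n≤1+n 4) (5≤ s)) (line-c s) (fresh s p∈) (D⇒colWith c D≡0)
  ... | r′ , i | u , v , refl , L = r′ , u ++ p ∷ v , sym (pick-length i) , record
    { arrangement = ↭-trans (arrangement s) (↭-trans (Perm.++⁺ʳ (u ++ v) (pick-↭ i)) (↭-sym σ))
    ; 5≤          = ≤-trans (5≤ s) (≤-trans (n≤1+n _) (≤-reflexive (sym (Perm.↭-length (Perm.shift p u v)))))
    ; line-c      = L
    ; distinct-l  = distinct-l s
    }
    where
    σ : r′ ++ u ++ p ∷ v ↭ p ∷ r′ ++ u ++ v
    σ = ↭-trans (Perm.++⁺ˡ r′ (Perm.shift p u v)) (Perm.shift p r′ (u ++ v))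

  centred : ∀ {l p r c} → Split l r c → p ∈ r → length c ≡ 3 + D p c → ∃[ m ] CentreAt p c m
  centred {c = c} s i = centre-exists c (5≤ s) (line-c s) (fresh s i)

  couple : ∀ {l p q r c m k} → Split l (p ∷ q ∷ r) c → Blocked (p ∷ q ∷ r) c → τ l + 10 ≡ 2 * length l →
           CentreAt p c m → CentreAt q c k →
           (∃[ x ] ∃[ d ] Split l (x ∷ r) d) ⊎ (Twins (p ∷ q ∷ c) × Adjacent m k)
  couple {l} {p} {q} {r} {c} {m} {k} s b eq cₚ c-q = go (tight s b eq)
    where
    lengthened : Longer c p q ⊎ (Twins (p ∷ q ∷ c) × Adjacent m k) →
                 (∃[ x ] ∃[ d ] Split l (x ∷ r) d) ⊎ (Twins (p ∷ q ∷ c) × Adjacent m k)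
    lengthened (inj₁ longer) = inj₁ (lengthen s longer)
    lengthened (inj₂ t)      = inj₂ t
    go : length c ≡ 3 + D p c × length c ≡ 3 + D q c × AllCol p q c →
         (∃[ x ] ∃[ d ] Split l (x ∷ r) d) ⊎ (Twins (p ∷ q ∷ c) × Adjacent m k)
    go (eₚ , e-q , pq) = lengthened
      (pair c (5≤ s) (line-c s) (fresh s (here refl)) (fresh s (there (here refl)))
        (distinct-r++c s (refl ∷ refl ∷ minimum _)) eₚ e-q (λ {x} → pq {x}) cₚ c-q)

  swap₂₃ : ∀ {p q a : X} {r} → p ∷ q ∷ a ∷ r ↭ p ∷ a ∷ q ∷ r
  swap₂₃ = prep _ (swap _ _ refl)

  rotate : ∀ {p q a : X} {r} → p ∷ q ∷ a ∷ r ↭ q ∷ a ∷ p ∷ r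
  rotate = trans (swap _ _ refl) (prep _ (swap _ _ refl))

  blocked-↭ : ∀ {r r′} c → r ↭ r′ → Blocked r c → Blocked r′ c
  blocked-↭ c σ b i = b (Perm.∈-resp-↭ (↭-sym σ) i)

  -- Three points outside a line cannot all be in tight position, as the
  -- positions of their centres would have to be pairwise adjacent.
  triple : ∀ {l p q a r c} → Split l (p ∷ q ∷ a ∷ r) c → Blocked (p ∷ q ∷ a ∷ r) c → τ l + 10 ≡ 2 * length l →
           ∃[ n ] CentreAt p c n → ∃[ n ] CentreAt q c n → ∃[ n ] CentreAt a c n →
           ∃[ x ] ∃[ b ] ∃[ d ] Split l (x ∷ b ∷ r) d
  triple {l} {p} {q} {a} {r} {c} s b eq (i , cₚ) (j , c-q) (k , cₐ) =
    finish (couple s b eq cₚ c-q)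
           (couple (permute swap₂₃ s) (blocked-↭ c swap₂₃ b) eq cₚ cₐ)
           (couple (permute rotate s) (blocked-↭ c rotate b) eq c-q cₐ)
    where
    finish : ∀ {P Q R : Set} →
             (∃[ x ] ∃[ d ] Split l (x ∷ a ∷ r) d) ⊎ (P × Adjacent i j) →
             (∃[ x ] ∃[ d ] Split l (x ∷ q ∷ r) d) ⊎ (Q × Adjacent i k) →
             (∃[ x ] ∃[ d ] Split l (x ∷ p ∷ r) d) ⊎ (R × Adjacent j k) →
             ∃[ x ] ∃[ b ] ∃[ d ] Split l (x ∷ b ∷ r) d
    finish (inj₁ (x , d , s)) _ _ = x , a , d , s
    finish (inj₂ _) (inj₁ (x , d , s)) _ = x , q , d , s
    finish (inj₂ _) (inj₂ _) (inj₁ (x , d , s)) = x , p , d , s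
    finish (inj₂ (_ , e₁)) (inj₂ (_ , e₂)) (inj₂ (_ , e₃)) = contradiction e₃ (adjacent-triple e₁ e₂)

  Progress : List X → List X → Set
  Progress l r = Twins l ⊎ ∃[ x ] ∃[ r′ ] ∃[ d ] (length r′ ≡ length r × Split l (x ∷ r′) d)

  several : ∀ {l p q r c} → Split l (p ∷ q ∷ r) c → Blocked (p ∷ q ∷ r) c → τ l + 10 ≡ 2 * length l → Progress l r
  several {l} {p} {q} {[]} {c} s b eq =
    go (centred s (here refl) (proj₁ t)) (centred s (there (here refl)) (proj₁ (proj₂ t)))
    where
    t : length c ≡ 3 + D p c × length c ≡ 3 + D q c × AllCol p q c
    t = tight s b eq
    finish : ∀ {P : Set} → (∃[ x ] ∃[ d ] Split l (x ∷ []) d) ⊎ (Twins (p ∷ q ∷ c) × P) → Progress l []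
    finish (inj₁ (x , d , s′)) = inj₂ (x , [] , d , refl , s′)
    finish (inj₂ (twins , _))  = inj₁ (twins-↭ (↭-sym (arrangement s)) twins)
    go : ∃[ n ] CentreAt p c n → ∃[ n ] CentreAt q c n → Progress l []
    go (m , cₚ) (k , c-q) = finish (couple s b eq cₚ c-q)
  several {l} {p} {q} {a ∷ r} {c} s b eq = finish
    (triple s b eq (centred s (here refl) (proj₁ t)) (centred s (there (here refl)) (proj₁ (proj₂ t)))
      (centred s (there (there (here refl))) (proj₁ (proj₂ t′))))
    where
    t : length c ≡ 3 + D p c × length c ≡ 3 + D q c × AllCol p q c
    t = tight s b eq
    t′ : length c ≡ 3 + D p c × length c ≡ 3 + D a c × AllCol p a c
    t′ = tight (permute swap₂₃ s) (blocked-↭ c swap₂₃ b) eq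
    finish : ∃[ x ] ∃[ b ] ∃[ d ] Split l (x ∷ b ∷ r) d → Progress l (a ∷ r)
    finish (x , b , d , s′) = inj₂ (x , b ∷ r , d , refl , s′)

  blocked : ∀ {l r c} → Split l r c → ¬ Any (λ p → D p c ≡ 0) r → Blocked r c
  blocked {c = c} s ¬some i with D-low c (5≤ s) (line-c s) (fresh s i)
  ... | inj₁ D≡0 = contradiction (lose i D≡0) ¬some
  ... | inj₂ le  = le

  -- Induction on the number of points outside. A maximal line is not chosen but reached: `absorb`,
  -- and `several` unless it finds `Twins`, lead to a line with one more point.
  grow : ∀ n {l r c} → length r ≡ n → Split l r c → Result l
  grow zero    {r = []} refl s = inj₁ (inj₁ (≡.trans (τ-↭ (arrangement s)) (line-τ (line-c s))))
  grow (suc n) {l} {r} {c} len s with Any.any? (λ p → D p c ≟ 0) r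
  ... | yes some = absorbed (find some)
    where
    absorbed : ∃[ p ] (p ∈ r × D p c ≡ 0) → Result l
    absorbed (p , p∈ , D≡0) with absorb s p∈ D≡0
    ... | r′ , c′ , len′ , s′ = grow n (suc-injective (≡.trans len′ len)) s′
  grow (suc n) {l} {p ∷ []} len s | no _ = one-outside s
  grow (suc n) {l} {p ∷ q ∷ r} {c} len s | no ¬some with τ l + 10 ≟ 2 * length l
  ... | no ¬eq = inj₂ (two-bound s (blocked s ¬some) , λ _ eq → contradiction eq ¬eq)
  ... | yes eq with several s (blocked s ¬some) eq
  ...   | inj₁ twins = inj₂ (two-bound s (blocked s ¬some) , λ _ _ → twins)
  ...   | inj₂ (x , r′ , d , len′ , s′) = grow n (≡.trans (cong suc len′) (suc-injective len)) s′

  -- For six and seven points the averaging bounds 2 and 4 equal 2n - 10. From eight points on, 7 +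
  -- 2k is one above it.
  without-five : ∀ l → 6 ≤ length l → HasFive l ⊎ (2 * length l ≤ τ l + 10 × (9 ≤ length l → 2 * length l ≤ τ l + 9))
  without-five l 6≤ = go (length l) refl 6≤
    where
    go : ∀ n → length l ≡ n → 6 ≤ n → HasFive l ⊎ (2 * n ≤ τ l + 10 × (9 ≤ n → 2 * n ≤ τ l + 9))
    go 6 len _ = Sum.map₂ (λ le → +-monoˡ-≤ 10 le , λ 9≤ → contradiction 9≤ (<⇒≱ (≤ᵇ⇒≤ 7 9 _))) (five₆ l len)
    go 7 len _ = Sum.map₂ (λ le → +-monoˡ-≤ 10 le , λ 9≤ → contradiction 9≤ (<⇒≱ (≤ᵇ⇒≤ 8 9 _))) (five₇ l len)
    go (suc (suc (suc (suc (suc (suc (suc (suc k)))))))) len _ =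
      Sum.map₂ (λ le → ≤-trans (bound le) (+-monoʳ-≤ (τ l) (n≤1+n 9)) , λ _ → bound le) (five₈₊ k l len)
      where
      bound : 7 + 2 * k ≤ τ l → 2 * (8 + k) ≤ τ l + 9
      bound le = linear 0 le (eq k (τ l))
        where
        eq : ∀ k t → 2 * (8 + k) + t + 0 ≡ t + 9 + (7 + 2 * k)
        eq = solve-∀
    go 0 _ ()
    go 1 _ (s≤s ())
    go 2 _ (s≤s (s≤s ()))
    go 3 _ (s≤s (s≤s (s≤s ())))
    go 4 _ (s≤s (s≤s (s≤s (s≤s ()))))
    go 5 _ (s≤s (s≤s (s≤s (s≤s (s≤s ())))))

  result : ∀ l → 6 ≤ length l → Distinct l → Result l
  result l 6≤ dis with without-five l 6≤
  ... | inj₂ (bound , strict) = inj₂ (bound , λ 9≤ eq →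
          contradiction (≤-trans (≤-reflexive eq) (strict 9≤)) (<⇒≱ (≤-reflexive (sym (+-suc (τ l) 9)))))
  ... | inj₁ (k , r , σ , len₅ , τ≡0)
    with linear₅ k len₅ (distinct-⊆ (++⁺ʳ r ⊆-refl) (distinct-↭ σ dis)) τ≡0
  ...   | c , L , σ′ = grow (length r) refl (record
    { arrangement = ↭-trans σ (↭-trans (Perm.++-comm k r) (Perm.++⁺ˡ r (↭-sym σ′)))
    ; 5≤          = ≤-reflexive (≡.trans (sym len₅) (sym (Perm.↭-length σ′)))
    ; line-c      = L
    ; distinct-l  = dis
    })

-- Levels and the graph T

Consecutive : ℕ → ℕ → Set
Consecutive m n = n ≡ suc m ⊎ m ≡ suc n

-- A betweenness that is determined by levels: distinct levels are ordered
-- linearly, and two points of one level have between them the points of the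
-- two neighbouring levels.
record ByLevel {V : Set} (h : V → ℕ) (R : V → V → V → Set) : Set where
  field
    start   : ∀ a b → R a a b
    mirror  : ∀ {a b c} → R a b c → R c b a
    unique  : ∀ {a b c} → R a b c → R b a c → a ≡ b
    along   : ∀ {a b c} → h a < h b → h b < h c → R a b c
    near    : ∀ {a b c} → h a ≡ h c → a ≢ c → Consecutive (h a) (h b) → R a b c
    far     : ∀ {a b c} → h a ≡ h c → a ≢ c → h a ≢ h b → ¬ Consecutive (h a) (h b) →
              ¬ R a b c × ¬ R b a c × ¬ R a c b

consecutive? : ∀ m n → Dec (Consecutive m n)
consecutive? m n with n ≟ suc m | m ≟ suc n
... | yes p | _     = yes (inj₁ p)
... | no _  | yes q = yes (inj₂ q)
... | no ¬p | no ¬q = no [ ¬p , ¬q ]′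

AtMostTwo : {V : Set} → (V → ℕ) → Set
AtMostTwo {V} h = ∀ {a b c : V} → h a ≡ h b → h a ≡ h c → a ≢ b → a ≢ c → b ≡ c

-- Three distinct points have three levels, or two of them share a level to which the third is near
-- or far. One of the axioms settles each case; where it puts another point in the middle or denies
-- R, it contradicts R a b c.
byLevel-determined : ∀ {V : Set} {h : V → ℕ} {R R′} → DecidableEquality V → AtMostTwo h →
                     ByLevel h R → ByLevel h R′ → ∀ {a b c} → R a b c → R′ a b c
byLevel-determined {V} {h} {R} {R′} _≟ᵥ_ two B B′ {a} {b} {c} r with a ≟ᵥ b | b ≟ᵥ c
... | yes refl | _        = ByLevel.start B′ a c
... | no _     | yes refl = ByLevel.mirror B′ (ByLevel.start B′ b a)
... | no a≢b   | no b≢c   = levels (a ≟ᵥ c)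
  where
  open ByLevel
  uniqueʳ : R a c b → b ≡ c
  uniqueʳ s = unique B (mirror B s) (mirror B r)
  levels : Dec (a ≡ c) → R′ a b c
  levels (yes refl) = contradiction (unique B r (mirror B (start B a b))) a≢b
  levels (no a≢c) with <-cmp (h a) (h b) | <-cmp (h b) (h c) | <-cmp (h a) (h c)
  ... | tri< p _ _ | tri< q _ _ | _          = along B′ p q
  ... | tri> _ _ p | tri> _ _ q | _          = mirror B′ (along B′ q p)
  ... | tri< p _ _ | tri> _ _ q | tri< s _ _ = contradiction (uniqueʳ (along B s q)) b≢c
  ... | tri< p _ _ | tri> _ _ q | tri> _ _ s = contradiction (unique B r (mirror B (along B s p))) a≢b
  ... | tri> _ _ p | tri< q _ _ | tri< s _ _ = contradiction (unique B r (along B p s)) a≢b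
  ... | tri> _ _ p | tri< q _ _ | tri> _ _ s = contradiction (uniqueʳ (mirror B (along B q s))) b≢c
  ... | _ | _ | tri≈ _ e _ with consecutive? (h a) (h b) | h a ≟ h b
  ...   | yes n | _      = near B′ e a≢c n
  ...   | no _  | yes e′ = contradiction (two e′ e a≢b a≢c) b≢c
  ...   | no ¬n | no ¬e  = contradiction r (proj₁ (far B e a≢c ¬e ¬n))
  levels (no a≢c) | tri≈ _ e _ | _ | _ with consecutive? (h a) (h c) | h a ≟ h c
  ...   | yes n | _      = contradiction (uniqueʳ (near B e a≢b n)) b≢c
  ...   | no _  | yes e′ = contradiction (two e e′ a≢b a≢c) b≢c
  ...   | no ¬n | no ¬e  = contradiction r (proj₂ (proj₂ (far B e a≢b ¬e ¬n)))
  levels (no a≢c) | _ | tri≈ _ e _ | _ with consecutive? (h b) (h a) | h b ≟ h a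
  ...   | yes n | _      = contradiction (unique B r (near B e b≢c n)) a≢b
  ...   | no _  | yes e′ = contradiction (two e′ e (a≢b ∘ sym) b≢c) a≢c
  ...   | no ¬n | no ¬e  = contradiction r (proj₁ (proj₂ (far B e b≢c ¬e ¬n)))

-- `k` is the distance within a level. For k = 2 exactly the points of the neighbouring levels lie
-- halfway between two points of one level; for k = 1 no point of another level does.
record Levelled {V : Set} (h : V → ℕ) (k : ℕ) (d : V → V → ℕ) : Set where
  field
    d-level : ∀ {a b} → h a ≢ h b → d a b ≡ ∣ h a - h b ∣
    d-twin  : ∀ {a b} → h a ≡ h b → a ≢ b → d a b ≡ k

  private
    steps : ∀ {m n} → m < n → ∃[ i ] n ≡ m + suc i
    steps {m} m<n with m≤n⇒∃[o]m+o≡n m<n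
    ... | i , eq = i , ≡.trans (sym eq) (sym (+-suc m i))

  d-along : ∀ {a b c} → h a < h b → h b < h c → d a c ≡ d a b + d b c
  d-along {a} {b} {c} p q with steps p | steps q
  ... | i , b≡ | j , c≡ = begin
    d a c                                    ≡⟨ d-level (<⇒≢ (<-trans p q)) ⟩
    ∣ h a - h c ∣                            ≡⟨ cong (∣ h a -_∣) (≡.trans c≡ (≡.trans (cong (_+ suc j) b≡) (+-assoc (h a) _ _))) ⟩
    ∣ h a - h a + (suc i + suc j) ∣          ≡⟨ ∣m-m+n∣≡n (h a) _ ⟩
    suc i + suc j                            ≡⟨ cong₂ _+_ (∣m-m+n∣≡n (h a) _) (∣m-m+n∣≡n (h b) _) ⟨
    ∣ h a - h a + suc i ∣ + ∣ h b - h b + suc j ∣  ≡⟨ cong₂ (λ m n → ∣ h a - m ∣ + ∣ h b - n ∣) b≡ c≡ ⟨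
    ∣ h a - h b ∣ + ∣ h b - h c ∣            ≡⟨ cong₂ _+_ (d-level (<⇒≢ p)) (d-level (<⇒≢ q)) ⟨
    d a b + d b c                            ∎
    where open ≡-Reasoning

  gap : ∀ {a b c} → h a ≡ h c → h a ≢ h b → d a b ≡ ∣ h a - h b ∣ × d b c ≡ ∣ h a - h b ∣ × d b a ≡ ∣ h a - h b ∣ × d c b ≡ ∣ h a - h b ∣
  gap {a} {b} {c} e ne = d-level ne , ≡.trans (d-level (λ e′ → ne (≡.trans e (sym e′)))) (≡.trans (∣-∣-comm (h b) (h c)) (cong (∣_- h b ∣) (sym e))) ,
    ≡.trans (d-level (ne ∘ sym)) (∣-∣-comm (h b) (h a)) , ≡.trans (d-level (λ e′ → ne (≡.trans e e′))) (cong (∣_- h b ∣) (sym e))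

  d-near : k ≡ 2 → ∀ {a b c} → h a ≡ h c → a ≢ c → Consecutive (h a) (h b) → d a c ≡ d a b + d b c
  d-near refl {a} {b} {c} e ne n with gap e (apart n)
    where
    apart : ∀ {m n} → Consecutive m n → m ≢ n
    apart (inj₁ refl) = 1+n≢n ∘ sym
    apart (inj₂ refl) = 1+n≢n
  ... | ab , bc , _ = ≡.trans (d-twin e ne) (sym (cong₂ _+_ (≡.trans ab (one n)) (≡.trans bc (one n))))
    where
    one : ∀ {m n} → Consecutive m n → ∣ m - n ∣ ≡ 1
    one {m} (inj₁ refl) = ≡.trans (cong (∣ m -_∣) (sym (+-comm m 1))) (∣m-m+n∣≡n m 1)
    one {n = n} (inj₂ refl) = ≡.trans (∣-∣-comm (suc n) n) (one {n} (inj₁ refl))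

  d-far : k ≢ 0 → ∀ {a b c} → h a ≡ h c → a ≢ c → h a ≢ h b → k ≢ ∣ h a - h b ∣ + ∣ h a - h b ∣ →
          d a c ≢ d a b + d b c × d b c ≢ d b a + d a c × d a b ≢ d a c + d c b
  d-far k≢0 {a} {b} {c} e ne ne′ k≢ with gap {a} {b} {c} e ne′ | d-twin e ne
  ... | ab , bc , ba , cb | ac =
    (λ eq → k≢ (≡.trans (sym ac) (≡.trans eq (cong₂ _+_ ab bc)))) ,
    (λ eq → k≢0 (sym (+-cancelˡ-≡ ∣ h a - h b ∣ 0 k (≡.trans (+-identityʳ _) (≡.trans (sym bc) (≡.trans eq (cong₂ _+_ ba ac))))))) ,
    (λ eq → k≢0 (sym (+-cancelʳ-≡ ∣ h a - h b ∣ 0 k (≡.trans (sym ab) (≡.trans eq (cong₂ _+_ ac cb))))))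

  byLevel : k ≡ 2 → (∀ a → d a a ≡ 0) → (∀ {a b c} → d a c ≡ d a b + d b c → d c a ≡ d c b + d b a) →
            (∀ {a b c} → d a c ≡ d a b + d b c → d b c ≡ d b a + d a c → a ≡ b) →
            ByLevel h (λ a b c → d a c ≡ d a b + d b c)
  byLevel k≡2 d-zero d-swap d-unique = record
    { start  = λ a b → cong (_+ d a b) (sym (d-zero a))
    ; mirror = d-swap
    ; unique = d-unique
    ; along  = d-along
    ; near   = d-near k≡2
    ; far    = λ e ne ne′ ¬n → d-far (λ k≡0 → case₂ (≡.trans (sym k≡2) k≡0)) e ne ne′ (λ k≡ → double (∣-∣-one ¬n) (≡.trans (sym k≡2) k≡))
    }
    where
    case₂ : 2 ≢ 0
    case₂ ()
    double : ∀ {m} → m ≢ 1 → 2 ≢ m + m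
    double {zero}        _  ()
    double {suc zero}    ne _  = ne refl
    double {suc (suc m)} _  eq with () ← ≡.trans (suc-injective (suc-injective eq)) (+-suc m (suc m))
    ∣-∣-one : ∀ {m n} → ¬ Consecutive m n → ∣ m - n ∣ ≢ 1
    ∣-∣-one {m} {n} ¬n eq with ≤-total m n
    ... | inj₁ m≤n = ¬n (inj₁ (≡.trans (sym (m+[n∸m]≡n m≤n)) (≡.trans (cong (m +_) (≡.trans (sym (m≤n⇒∣m-n∣≡n∸m m≤n)) eq)) (+-comm m 1))))
    ... | inj₂ n≤m = ¬n (inj₂ (≡.trans (sym (m+[n∸m]≡n n≤m)) (≡.trans (cong (n +_) (≡.trans (sym (m≤n⇒∣n-m∣≡n∸m n≤m)) eq)) (+-comm n 1))))

-- Levels count from 0: x₁, …, xᵢ, then y and z, then u and v, then xᵢ₊₁, ….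
xLevel : ℕ → ℕ → ℕ
xLevel i j with j <? i
... | yes _ = j
... | no _  = 2 + j

xLevel-< : ∀ {i j} → j < i → xLevel i j ≡ j
xLevel-< {i} {j} lt with j <? i
... | yes _ = refl
... | no ¬p = contradiction lt ¬p

xLevel-≥ : ∀ {i j} → i ≤ j → xLevel i j ≡ 2 + j
xLevel-≥ {i} {j} le with j <? i
... | yes p = contradiction p (≤⇒≯ le)
... | no _  = refl

xLevel-injective : ∀ {i j k} → xLevel i j ≡ xLevel i k → j ≡ k
xLevel-injective {i} {j} {k} eq with j <? i | k <? i
... | yes _ | yes _ = eq
... | no _  | no _  = suc-injective (suc-injective eq)
... | yes p | no ¬q = contradiction (≤-<-trans (≤-trans (m≤n+m k 2) (≤-reflexive (sym eq))) p) ¬q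
... | no ¬p | yes q = contradiction (≤-<-trans (≤-trans (m≤n+m j 2) (≤-reflexive eq)) q) ¬p

level : ∀ {n} → ℕ → TVertex n → ℕ
level i (xᵥ j) = xLevel i (toℕ j)
level i yᵥ     = i
level i zᵥ     = i
level i uᵥ     = suc i
level i vᵥ     = suc i

data SameLevel {n} : TVertex n → TVertex n → Set where
  yz : SameLevel yᵥ zᵥ
  zy : SameLevel zᵥ yᵥ
  uv : SameLevel uᵥ vᵥ
  vu : SameLevel vᵥ uᵥ

xLevel≢ : ∀ i j → xLevel i j ≢ i × xLevel i j ≢ suc i
xLevel≢ i j with j <? i
... | yes p = <⇒≢ p , <⇒≢ (<-trans p (n<1+n i))
... | no ¬p = (<⇒≢ (≤-trans (s≤s (≮⇒≥ ¬p)) (n≤1+n _)) ∘ sym) , (<⇒≢ (s≤s (s≤s (≮⇒≥ ¬p))) ∘ sym)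

sameLevel : ∀ {n} i {a b : TVertex n} → level i a ≡ level i b → a ≢ b → SameLevel a b
sameLevel i {xᵥ j} {xᵥ k} eq ne = contradiction (cong xᵥ (Fin.toℕ-injective (xLevel-injective {i} eq))) ne
sameLevel i {xᵥ j} {yᵥ}   eq ne = contradiction eq (proj₁ (xLevel≢ i (toℕ j)))
sameLevel i {xᵥ j} {zᵥ}   eq ne = contradiction eq (proj₁ (xLevel≢ i (toℕ j)))
sameLevel i {xᵥ j} {uᵥ}   eq ne = contradiction eq (proj₂ (xLevel≢ i (toℕ j)))
sameLevel i {xᵥ j} {vᵥ}   eq ne = contradiction eq (proj₂ (xLevel≢ i (toℕ j)))
sameLevel i {yᵥ}   {xᵥ j} eq ne = contradiction (sym eq) (proj₁ (xLevel≢ i (toℕ j)))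
sameLevel i {yᵥ}   {yᵥ}   eq ne = contradiction refl ne
sameLevel i {yᵥ}   {zᵥ}   eq ne = yz
sameLevel i {yᵥ}   {uᵥ}   eq ne = contradiction (sym eq) 1+n≢n
sameLevel i {yᵥ}   {vᵥ}   eq ne = contradiction (sym eq) 1+n≢n
sameLevel i {zᵥ}   {xᵥ j} eq ne = contradiction (sym eq) (proj₁ (xLevel≢ i (toℕ j)))
sameLevel i {zᵥ}   {yᵥ}   eq ne = zy
sameLevel i {zᵥ}   {zᵥ}   eq ne = contradiction refl ne
sameLevel i {zᵥ}   {uᵥ}   eq ne = contradiction (sym eq) 1+n≢n
sameLevel i {zᵥ}   {vᵥ}   eq ne = contradiction (sym eq) 1+n≢n
sameLevel i {uᵥ}   {xᵥ j} eq ne = contradiction (sym eq) (proj₂ (xLevel≢ i (toℕ j)))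
sameLevel i {uᵥ}   {yᵥ}   eq ne = contradiction eq 1+n≢n
sameLevel i {uᵥ}   {zᵥ}   eq ne = contradiction eq 1+n≢n
sameLevel i {uᵥ}   {uᵥ}   eq ne = contradiction refl ne
sameLevel i {uᵥ}   {vᵥ}   eq ne = uv
sameLevel i {vᵥ}   {xᵥ j} eq ne = contradiction (sym eq) (proj₂ (xLevel≢ i (toℕ j)))
sameLevel i {vᵥ}   {yᵥ}   eq ne = contradiction eq 1+n≢n
sameLevel i {vᵥ}   {zᵥ}   eq ne = contradiction eq 1+n≢n
sameLevel i {vᵥ}   {uᵥ}   eq ne = vu
sameLevel i {vᵥ}   {vᵥ}   eq ne = contradiction refl ne

level-atMostTwo : ∀ {n} i → AtMostTwo (level {n} i)
level-atMostTwo i e₁ e₂ ne₁ ne₂ with sameLevel i e₁ ne₁ | sameLevel i e₂ ne₂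
... | yz | yz = refl
... | zy | zy = refl
... | uv | uv = refl
... | vu | vu = refl

edge-level : ∀ {n i a b} → TEdge n i a b → level i b ≡ suc (level i a)
edge-level {i = i} (xx {j} {k} e ne) with toℕ j <? i | toℕ k <? i
... | yes p | yes _ = suc-injective e
... | no _  | no _  = cong (2 +_) (suc-injective e)
... | yes p | no ¬q = contradiction (≤-antisym p (≤-trans (≮⇒≥ ¬q) (≤-reflexive (suc-injective e)))) ne
... | no ¬p | yes q = contradiction (<-trans (≤-reflexive (sym (suc-injective e))) q) ¬p
edge-level (xy e) = ≡.trans (sym e) (cong suc (sym (xLevel-< (≤-reflexive e))))
edge-level (xz e) = ≡.trans (sym e) (cong suc (sym (xLevel-< (≤-reflexive e))))
edge-level yu     = refl
edge-level yv     = refl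
edge-level zu     = refl
edge-level zv     = refl
edge-level (ux e) = ≡.trans (xLevel-≥ (≤-reflexive (sym (suc-injective e)))) (cong (2 +_) (suc-injective e))
edge-level (vx e) = ≡.trans (xLevel-≥ (≤-reflexive (sym (suc-injective e)))) (cong (2 +_) (suc-injective e))

level-edge : ∀ {n i} a b → level {n} i b ≡ suc (level i a) → TEdge n i a b
level-edge {i = i} (xᵥ j) (xᵥ k) e with toℕ j <? i | toℕ k <? i
... | yes p | yes q = xx (cong suc e) (λ eq → <⇒≢ q (≡.trans e eq))
... | no ¬p | no _  = xx (cong suc (suc-injective (suc-injective e))) (λ eq → ¬p (≤-reflexive eq))
... | yes p | no ¬q = contradiction (≤-trans (≤-reflexive (suc-injective e)) (≤-trans (n≤1+n _) p)) ¬q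
... | no ¬p | yes q = contradiction (≤-<-trans (≤-trans (m≤n+m _ 3) (≤-reflexive (sym e))) q) ¬p
level-edge {i = i} (xᵥ j) yᵥ e with toℕ j <? i
... | yes p = xy (sym e)
... | no ¬p = contradiction (≤-trans (s≤s (m≤n+m _ 2)) (≤-reflexive (sym e))) ¬p
level-edge {i = i} (xᵥ j) zᵥ e with toℕ j <? i
... | yes p = xz (sym e)
... | no ¬p = contradiction (≤-trans (s≤s (m≤n+m _ 2)) (≤-reflexive (sym e))) ¬p
level-edge {i = i} (xᵥ j) uᵥ e = contradiction (sym (suc-injective e)) (proj₁ (xLevel≢ i (toℕ j)))
level-edge {i = i} (xᵥ j) vᵥ e = contradiction (sym (suc-injective e)) (proj₁ (xLevel≢ i (toℕ j)))
level-edge {i = i} yᵥ (xᵥ k) e = contradiction e (proj₂ (xLevel≢ i (toℕ k)))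
level-edge yᵥ yᵥ e = contradiction (sym e) 1+n≢n
level-edge yᵥ zᵥ e = contradiction (sym e) 1+n≢n
level-edge yᵥ uᵥ e = yu
level-edge yᵥ vᵥ e = yv
level-edge {i = i} zᵥ (xᵥ k) e = contradiction e (proj₂ (xLevel≢ i (toℕ k)))
level-edge zᵥ yᵥ e = contradiction (sym e) 1+n≢n
level-edge zᵥ zᵥ e = contradiction (sym e) 1+n≢n
level-edge zᵥ uᵥ e = zu
level-edge zᵥ vᵥ e = zv
level-edge {i = i} uᵥ (xᵥ k) e with toℕ k <? i
... | yes p = contradiction (≤-trans (m≤n+m i 2) (≤-reflexive (sym e))) (<⇒≱ p)
... | no ¬p = ux (cong suc (suc-injective (suc-injective e)))
level-edge {i = i} uᵥ yᵥ e = contradiction e (m≢1+n+m i {1})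
level-edge {i = i} uᵥ zᵥ e = contradiction e (m≢1+n+m i {1})
level-edge uᵥ uᵥ e = contradiction (sym e) 1+n≢n
level-edge uᵥ vᵥ e = contradiction (sym e) 1+n≢n
level-edge {i = i} vᵥ (xᵥ k) e with toℕ k <? i
... | yes p = contradiction (≤-trans (m≤n+m i 2) (≤-reflexive (sym e))) (<⇒≱ p)
... | no ¬p = vx (cong suc (suc-injective (suc-injective e)))
level-edge {i = i} vᵥ yᵥ e = contradiction e (m≢1+n+m i {1})
level-edge {i = i} vᵥ zᵥ e = contradiction e (m≢1+n+m i {1})
level-edge vᵥ uᵥ e = contradiction (sym e) 1+n≢n
level-edge vᵥ vᵥ e = contradiction (sym e) 1+n≢n

module TDistance (n i : ℕ) (1≤i : 1 ≤ i) (i≤ : i ≤ ⌈ n ∸ 5 /2⌉) where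
  open Graph (T n i) hiding (V)
  open Distance (T n i) (T-connected n i 1≤i i≤)

  private
    h : TVertex n → ℕ
    h = level i

    i< : i < n ∸ 4
    i< = i<n∸4 n i 1≤i i≤

  -- Every edge changes the level by exactly one, so the level difference bounds the distance from
  -- below. `climb` attains it, because all vertices of consecutive levels are joined.
  walk-level : ∀ {a b k} → Walk a b k → h a ≤ h b + k × h b ≤ h a + k
  walk-level []                         = m≤m+n _ 0 , m≤m+n _ 0
  walk-level {a} {b} (_∷_ {y = c} {k = k} e p) with walk-level p
  ... | c≤ , b≤ = up e , down e
    where
    up : a ~ c → h a ≤ h b + suc k
    up (inj₁ e) = ≤-trans (n≤1+n _) (≤-trans (≤-reflexive (sym (edge-level e))) (≤-trans c≤ (+-monoʳ-≤ (h b) (n≤1+n k))))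
    up (inj₂ e) = ≤-trans (≤-reflexive (edge-level e)) (≤-trans (s≤s c≤) (≤-reflexive (sym (+-suc (h b) k))))
    down : a ~ c → h b ≤ h a + suc k
    down (inj₁ e) = ≤-trans b≤ (≤-reflexive (≡.trans (cong (_+ k) (edge-level e)) (sym (+-suc (h a) k))))
    down (inj₂ e) = ≤-trans b≤ (≤-trans (+-monoˡ-≤ k (≤-trans (n≤1+n _) (≤-reflexive (sym (edge-level e))))) (+-monoʳ-≤ (h a) (n≤1+n k)))

  level-bound : ∀ a → h a < 2 + (n ∸ 4)
  level-bound (xᵥ j) with toℕ j <? i
  ... | yes p = <-trans p (<-trans i< (≤-trans (n<1+n _) (n≤1+n _)))
  ... | no _  = s≤s (s≤s (Fin.toℕ<n j))
  level-bound yᵥ = <-trans i< (≤-trans (n<1+n _) (n≤1+n _))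
  level-bound zᵥ = <-trans i< (≤-trans (n<1+n _) (n≤1+n _))
  level-bound uᵥ = s≤s (<-trans i< (n<1+n _))
  level-bound vᵥ = s≤s (<-trans i< (n<1+n _))

  at-level : ∀ m → m < 2 + (n ∸ 4) → ∃[ a ] h a ≡ m
  at-level m m< with m <? i
  ... | yes p = xᵥ (fromℕ< (<-trans p i<)) , ≡.trans (cong (xLevel i) (Fin.toℕ-fromℕ< (<-trans p i<))) (xLevel-< p)
  ... | no ¬p with m ≟ i
  ...   | yes refl = yᵥ , refl
  ...   | no ¬q with m ≟ suc i
  ...     | yes refl = uᵥ , refl
  ...     | no ¬r with steps (≤∧≢⇒< (≤∧≢⇒< (≮⇒≥ ¬p) (¬q ∘ sym)) (¬r ∘ sym))
    where
    steps : ∀ {m} → 2 + i ≤ m → ∃[ j ] (m ≡ 2 + j × i ≤ j)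
    steps {suc (suc j)} (s≤s (s≤s le)) = j , refl , le
  ...       | j , refl , i≤j = xᵥ (fromℕ< j<) , ≡.trans (cong (xLevel i) (Fin.toℕ-fromℕ< j<)) (xLevel-≥ i≤j)
    where
    j< : j < n ∸ 4
    j< = ≤-pred (≤-pred m<)

  climb : ∀ k {a b} → h b ≡ h a + suc k → Walk a b (suc k)
  climb zero    {a} {b} eq = inj₁ (level-edge a b (≡.trans eq (+-comm (h a) 1))) ∷ []
  climb (suc k) {a} {b} eq with at-level (suc (h a)) (≤-<-trans (≤-trans (≤-reflexive (+-comm 1 (h a))) (+-monoʳ-≤ (h a) (s≤s z≤n))) (subst (_< 2 + (n ∸ 4)) eq (level-bound b)))
  ... | c , c≡ = inj₁ (level-edge a c c≡) ∷ climb k (≡.trans eq (≡.trans (+-suc (h a) (suc k)) (cong (_+ suc k) (sym c≡))))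

  d-up : ∀ {a b} → h a < h b → d a b ≡ ∣ h a - h b ∣
  d-up {a} {b} lt with m≤n⇒∃[o]m+o≡n lt
  ... | k , eq = ≡.trans (≤-antisym (d-min a b (climb k b≡)) (+-cancelˡ-≤ (h a) _ _ (≤-trans (≤-reflexive (sym b≡)) (proj₂ (walk-level (d-walk a b))))))
                   (sym (≡.trans (cong (∣ h a -_∣) b≡) (∣m-m+n∣≡n (h a) (suc k))))
    where
    b≡ : h b ≡ h a + suc k
    b≡ = ≡.trans (sym eq) (sym (+-suc (h a) k))

  two-walk : ∀ {a b} → SameLevel a b → Walk a b 2
  two-walk yz = inj₁ yu ∷ inj₂ zu ∷ []
  two-walk zy = inj₁ zu ∷ inj₂ yu ∷ []
  two-walk uv = inj₂ yu ∷ inj₁ yv ∷ []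
  two-walk vu = inj₂ yv ∷ inj₁ yu ∷ []

  long-walk : ∀ {a b k} → h a ≡ h b → a ≢ b → Walk a b k → 2 ≤ k
  long-walk e ne []                = contradiction refl ne
  long-walk e ne (inj₁ x ∷ [])     = contradiction (≡.trans e (edge-level x)) (1+n≢n ∘ sym)
  long-walk e ne (inj₂ x ∷ [])     = contradiction (≡.trans (sym e) (edge-level x)) (1+n≢n ∘ sym)
  long-walk e ne (_ ∷ _ ∷ p)       = s≤s (s≤s z≤n)

  levelled : Levelled h 2 d
  levelled = record { d-level = d-level ; d-twin = d-twin }
    where
    d-level : ∀ {a b} → h a ≢ h b → d a b ≡ ∣ h a - h b ∣
    d-level {a} {b} ne with <-cmp (h a) (h b)
    ... | tri< lt _ _ = d-up lt
    ... | tri≈ _ e _  = contradiction e ne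
    ... | tri> _ _ gt = ≡.trans (d-sym a b) (≡.trans (d-up gt) (∣-∣-comm (h b) (h a)))
    d-twin : ∀ {a b} → h a ≡ h b → a ≢ b → d a b ≡ 2
    d-twin {a} {b} e ne = ≤-antisym (d-min a b (two-walk (sameLevel i e ne))) (long-walk e ne (d-walk a b))

  T-byLevel : ByLevel h Between
  T-byLevel = Levelled.byLevel levelled refl d-refl (λ {a} {b} {c} → between-sym a b c) (λ {a} {b} {c} → between-antisym a b c)

  T-determined : ∀ {R : TVertex n → TVertex n → TVertex n → Set} → ByLevel h R →
                 ∀ {a b c} → (R a b c → Between a b c) × (Between a b c → R a b c)
  T-determined B = byLevel-determined _≟ⱽ_ (level-atMostTwo i) B T-byLevel ,
                   byLevel-determined _≟ⱽ_ (level-atMostTwo i) T-byLevel B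

-- The isomorphism between a structure with twins and the structure of T

nth : ∀ {A : Set} → A → List A → ℕ → A
nth d []      _       = d
nth d (a ∷ l) zero    = a
nth d (a ∷ l) (suc k) = nth d l k

module _ {A : Set} {d : A} where

  nth-∈ : ∀ l {k} → k < length l → nth d l k ∈ l
  nth-∈ (a ∷ l) {zero}  _        = here refl
  nth-∈ (a ∷ l) {suc k} (s≤s k<) = there (nth-∈ l k<)

  nth-⊆₂ : ∀ l {j k} → j < k → k < length l → nth d l j ∷ nth d l k ∷ [] ⊆ l
  nth-⊆₂ (a ∷ l) {zero}  {suc k} _         (s≤s k<) = refl ∷ from∈ (nth-∈ l k<)
  nth-⊆₂ (a ∷ l) {suc j} {suc k} (s≤s j<k) (s≤s k<) = a ∷ʳ nth-⊆₂ l j<k k<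

  nth-⊆₃ : ∀ l {i j k} → i < j → j < k → k < length l → nth d l i ∷ nth d l j ∷ nth d l k ∷ [] ⊆ l
  nth-⊆₃ (a ∷ l) {zero}  {suc j} {suc k} _         (s≤s j<k) (s≤s k<) = refl ∷ nth-⊆₂ l j<k k<
  nth-⊆₃ (a ∷ l) {suc i} {suc j} {suc k} (s≤s i<j) (s≤s j<k) (s≤s k<) = a ∷ʳ nth-⊆₃ l i<j j<k k<

  nth-+ : ∀ u {r} k → nth d (u ++ r) (length u + k) ≡ nth d r k
  nth-+ []      k = refl
  nth-+ (a ∷ u) k = nth-+ u k

  nth-++ : ∀ u {r k} → k < length u → nth d (u ++ r) k ≡ nth d u k
  nth-++ (a ∷ u) {k = zero}  _        = refl
  nth-++ (a ∷ u) {k = suc k} (s≤s k<) = nth-++ u k<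

  ∈-nth : ∀ {l x} → x ∈ l → ∃[ k ] (k < length l × nth d l k ≡ x)
  ∈-nth (here refl) = 0 , s≤s z≤n , refl
  ∈-nth (there i) with ∈-nth i
  ... | k , k< , eq = suc k , s≤s k< , eq

module Recognition (𝓑 : BetweennessStructure) where
  open BetweennessStructure 𝓑
  open Plane 𝓑
  open Star 𝓑
  open Pairs 𝓑

  line-reverse : ∀ {l} → Line l → Line (reverse l)
  line-reverse {l} L .distinct τ = distinct L (⊆-unreverse l τ) ∘ sym
  line-reverse {l} L .between τ  = P2 _ _ _ (between L (subst (_ ⊆_) (reverse-involutive l) (reverse⁺ τ)))

  -- The bound on i allows only the case in which u is at most as long as v; reading the line
  -- backwards, with the two pairs interchanged, provides for the other.
  twins-reverse : ∀ {l} (t : Twins l) → ∃[ t′ ] (length (Twins.u {l = l} t′) ≡ length (Twins.v t) ×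
                                                length (Twins.v {l = l} t′) ≡ length (Twins.u t))
  twins-reverse {l} t = record
    { u = reverse v ; v = reverse u ; a = b ; w = w′ ; w′ = w ; b = a ; p = q ; q = p
    ; cover       = ↭-trans cover (trans (swap p q refl) (prep q (prep p
                      (↭-trans (↭-sym (Perm.↭-reverse _)) (↭-reflexive (flip w w′))))))
    ; line        = reversed line
    ; lineₚ       = reversed line-q
    ; line-q      = reversed lineₚ
    ; lineₚ-q     = reversed lineₚ-q
    ; wap         = w′bq
    ; ww′p        = w′wq
    ; wqp         = w′pq
    ; w′wq        = ww′p
    ; w′pq        = wqp
    ; w′bq        = wap
    ; farₚ-left   = λ i → far-q-right (reverse-∈ v i)
    ; farₚ-right  = λ { (here refl) → far-q-left (∈-++⁺ʳ u (here refl)) ; (there i) → far-q-left (∈-++⁺ˡ (reverse-∈ u i)) }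
    ; far-q-left  = λ i → [ (λ j → farₚ-right (there (reverse-∈ v j))) , (λ { (here refl) → farₚ-right (here refl) }) ]′ (∈-++⁻ (reverse v) i)
    ; far-q-right = λ i → farₚ-left (reverse-∈ u i)
    } , length-reverse v , length-reverse u
    where
    open Twins t
    flip : ∀ s r → reverse (u ++ a ∷ s ∷ r ∷ b ∷ v) ≡ reverse v ++ b ∷ r ∷ s ∷ a ∷ reverse u
    flip s r = begin
      reverse (u ++ a ∷ s ∷ r ∷ b ∷ v)                  ≡⟨ reverse-++ u _ ⟩
      reverse (a ∷ s ∷ r ∷ b ∷ v) ++ reverse u          ≡⟨ cong (_++ reverse u) (reverse-++ (a ∷ s ∷ r ∷ b ∷ []) v) ⟩
      (reverse v ++ b ∷ r ∷ s ∷ a ∷ []) ++ reverse u    ≡⟨ ++-assoc (reverse v) _ _ ⟩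
      reverse v ++ b ∷ r ∷ s ∷ a ∷ reverse u            ∎
      where open ≡-Reasoning
    reversed : ∀ {s r} → Line (u ++ a ∷ s ∷ r ∷ b ∷ v) → Line (reverse v ++ b ∷ r ∷ s ∷ a ∷ reverse u)
    reversed {s} {r} L = subst Line (flip s r) (line-reverse L)

  module _ {l : List X} (t : Twins l) (u≤v : length (Twins.u t) ≤ length (Twins.v t)) (all∈ : ∀ e → e ∈ l) where
    open Twins t

    private
      n i : ℕ
      n = 6 + (length u + length v)
      i = suc (length u)

      i≤ : i ≤ ⌈ n ∸ 5 /2⌉
      -- With k the total length of u and v, n - 5 is 1 + k, and ⌈(1 + k)/2⌉ computes to 1 + ⌊k/2⌋.
      i≤ = s≤s (≤-trans (≤-reflexive (n≡⌊n+n/2⌋ (length u))) (⌊n/2⌋-mono (+-monoʳ-≤ (length u) u≤v)))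

      open TDistance n i (s≤s z≤n) i≤

      upper : Bool → X
      upper true  = w
      upper false = p

      lower : Bool → X
      lower true  = w′
      lower false = q

      C : Bool → Bool → List X
      C σ τ = u ++ a ∷ upper σ ∷ lower τ ∷ b ∷ v

      C-line : ∀ σ τ → Line (C σ τ)
      C-line true  true  = line
      C-line false true  = lineₚ
      C-line true  false = line-q
      C-line false false = lineₚ-q

      f : TVertex n → X
      -- `xLevel` skips the two positions in which the four lines differ, so any of them would do.
      -- By `h<` the default `w` is never taken.
      f (xᵥ j) = nth w (C true true) (xLevel i (toℕ j))
      f yᵥ     = w
      f zᵥ     = p
      f uᵥ     = w′
      f vᵥ     = q

      h : TVertex n → ℕ
      h = level i

      Upper Lower : TVertex n → Bool → Set
      Upper yᵥ σ = σ ≡ true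
      Upper zᵥ σ = σ ≡ false
      Upper _         σ = ⊤
      Lower uᵥ τ = τ ≡ true
      Lower vᵥ τ = τ ≡ false
      Lower _         τ = ⊤

      upper-choice : ∀ A → (h A ≡ i × ∃[ σ ] Upper A σ) ⊎ (∀ σ → Upper A σ)
      upper-choice (xᵥ j) = inj₂ _
      upper-choice yᵥ     = inj₁ (refl , true , refl)
      upper-choice zᵥ     = inj₁ (refl , false , refl)
      upper-choice uᵥ     = inj₂ _
      upper-choice vᵥ     = inj₂ _

      lower-choice : ∀ A → (h A ≡ suc i × ∃[ τ ] Lower A τ) ⊎ (∀ τ → Lower A τ)
      lower-choice (xᵥ j) = inj₂ _
      lower-choice yᵥ     = inj₂ _
      lower-choice zᵥ     = inj₂ _
      lower-choice uᵥ     = inj₁ (refl , true , refl)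
      lower-choice vᵥ     = inj₁ (refl , false , refl)

      -- Three vertices on distinct levels include at most one of level m, so one Boolean suits them
      -- all. Applied to both levels, this finds a line `C σ τ` that carries all three images.
      choose : ∀ {m} (K : TVertex n → Bool → Set) → (∀ A → (h A ≡ m × ∃[ σ ] K A σ) ⊎ (∀ σ → K A σ)) →
               ∀ {A B C} → h A < h B → h B < h C → ∃[ σ ] (K A σ × K B σ × K C σ)
      choose K ch {A} {B} {C} A<B B<C with ch A | ch B | ch C
      ... | inj₂ a | inj₂ b | inj₂ c = true , a true , b true , c true
      ... | inj₁ (_ , σ , a) | inj₂ b | inj₂ c = σ , a , b σ , c σ
      ... | inj₂ a | inj₁ (_ , σ , b) | inj₂ c = σ , a σ , b , c σ
      ... | inj₂ a | inj₂ b | inj₁ (_ , σ , c) = σ , a σ , b σ , c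
      ... | inj₁ (e , _) | inj₁ (e′ , _) | _ = contradiction (≡.trans e (sym e′)) (<⇒≢ A<B)
      ... | inj₁ (e , _) | inj₂ _ | inj₁ (e′ , _) = contradiction (≡.trans e (sym e′)) (<⇒≢ (<-trans A<B B<C))
      ... | inj₂ _ | inj₁ (e , _) | inj₁ (e′ , _) = contradiction (≡.trans e (sym e′)) (<⇒≢ B<C)

      choose₂ : ∀ {m} (K : TVertex n → Bool → Set) → (∀ A → (h A ≡ m × ∃[ σ ] K A σ) ⊎ (∀ σ → K A σ)) →
               ∀ {A B} → h A < h B → ∃[ σ ] (K A σ × K B σ)
      choose₂ K ch {A} {B} A<B with ch A | ch B
      ... | inj₂ a | inj₂ b = true , a true , b true
      ... | inj₁ (_ , σ , a) | inj₂ b = σ , a , b σ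
      ... | inj₂ a | inj₁ (_ , σ , b) = σ , a σ , b
      ... | inj₁ (e , _) | inj₁ (e′ , _) = contradiction (≡.trans e (sym e′)) (<⇒≢ A<B)

      nth-C : ∀ {s s′ r r′} (u : List X) k → k ≢ suc (length u) → k ≢ 2 + length u →
              nth w (u ++ a ∷ s ∷ r ∷ b ∷ v) k ≡ nth w (u ++ a ∷ s′ ∷ r′ ∷ b ∷ v) k
      nth-C []      zero                ne₁ ne₂ = refl
      nth-C []      (suc zero)          ne₁ ne₂ = contradiction refl ne₁
      nth-C []      (suc (suc zero))    ne₁ ne₂ = contradiction refl ne₂
      nth-C []      (suc (suc (suc k))) ne₁ ne₂ = refl
      nth-C (c ∷ u) zero                ne₁ ne₂ = refl
      nth-C (c ∷ u) (suc k)             ne₁ ne₂ = nth-C u k (ne₁ ∘ cong suc) (ne₂ ∘ cong suc)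

      nth-at : ∀ {s r} k m → k ≡ length u + m → nth w (u ++ a ∷ s ∷ r ∷ b ∷ v) k ≡ nth w (a ∷ s ∷ r ∷ b ∷ v) m
      nth-at k m refl = nth-+ u m

      i≡ : i ≡ length u + 1
      i≡ = +-comm 1 (length u)

      f-nth : ∀ A {σ τ} → Upper A σ → Lower A τ → f A ≡ nth w (C σ τ) (h A)
      f-nth (xᵥ j) _ _    = nth-C u _ (proj₁ (xLevel≢ i (toℕ j))) (proj₂ (xLevel≢ i (toℕ j)))
      f-nth yᵥ     refl _ = sym (nth-at i 1 i≡)
      f-nth zᵥ     refl _ = sym (nth-at i 1 i≡)
      f-nth uᵥ     _ refl = sym (nth-at (suc i) 2 (≡.trans (cong suc i≡) (sym (+-suc (length u) 1))))
      f-nth vᵥ     _ refl = sym (nth-at (suc i) 2 (≡.trans (cong suc i≡) (sym (+-suc (length u) 1))))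

      length-C : ∀ σ τ → length (C σ τ) ≡ 2 + (n ∸ 4)
      length-C σ τ = ≡.trans (length-++ u) (eq (length u) (length v))
        where
        eq : ∀ m k → m + (4 + k) ≡ 4 + (m + k)
        eq = solve-∀

      h< : ∀ A σ τ → h A < length (C σ τ)
      h< A σ τ = ≤-trans (level-bound A) (≤-reflexive (sym (length-C σ τ)))

      f-along : ∀ {A B C} → h A < h B → h B < h C → β (f A) (f B) (f C)
      f-along {A} {B} {C′} A<B B<C with choose Upper upper-choice {A} {B} {C′} A<B B<C | choose Lower lower-choice {A} {B} {C′} A<B B<C
      ... | σ , a₁ , b₁ , c₁ | τ , a₂ , b₂ , c₂
        rewrite f-nth A a₁ a₂ | f-nth B b₁ b₂ | f-nth C′ c₁ c₂ =
        between (C-line σ τ) (nth-⊆₃ (C σ τ) A<B B<C (h< C′ σ τ))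

      x-left : ∀ j → xLevel i (toℕ j) < length u → f (xᵥ j) ∈ u
      x-left j lt = subst (_∈ u) (sym (nth-++ u lt)) (nth-∈ u lt)

      x-at : ∀ j m → xLevel i (toℕ j) ≡ length u + m → f (xᵥ j) ≡ nth w (a ∷ w ∷ w′ ∷ b ∷ v) m
      x-at j m = nth-at _ m

      x-right : ∀ j → 4 + length u ≤ xLevel i (toℕ j) → f (xᵥ j) ∈ v
      x-right j le with m≤n⇒∃[o]m+o≡n le
      ... | m , eq = subst (_∈ v) (sym (x-at j (4 + m) (≡.trans (sym eq) (eq′ (length u) m)))) (nth-∈ v (+-cancelˡ-< (4 + length u) m (length v) (≤-trans (s≤s (≤-reflexive eq)) (≤-trans (h< (xᵥ j) true true) (≤-reflexive (length-C true true))))))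
        where
        eq′ : ∀ k m → 4 + k + m ≡ k + (4 + m)
        eq′ = solve-∀

      off-by-one : ∀ {m} → ¬ Consecutive m m
      off-by-one (inj₁ e) = 1+n≢n (sym e)
      off-by-one (inj₂ e) = 1+n≢n (sym e)

      near-upper : ∀ B → Consecutive i (h B) → β w (f B) p
      near-upper (xᵥ j) (inj₁ e) = contradiction e (proj₂ (xLevel≢ i (toℕ j)))
      near-upper (xᵥ j) (inj₂ e) = subst (λ e → β w e p) (sym (x-at j 0 (≡.trans (sym (suc-injective e)) (sym (+-identityʳ _))))) wap
      near-upper yᵥ     c        = contradiction c off-by-one
      near-upper zᵥ     c        = contradiction c off-by-one
      near-upper uᵥ     c        = ww′p
      near-upper vᵥ     c        = wqp

      near-lower : ∀ B → Consecutive (suc i) (h B) → β w′ (f B) q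
      near-lower (xᵥ j) (inj₁ e) = subst (λ e → β w′ e q) (sym (x-at j 3 (≡.trans e (+-comm 3 (length u))))) w′bq
      near-lower (xᵥ j) (inj₂ e) = contradiction (sym (suc-injective e)) (proj₁ (xLevel≢ i (toℕ j)))
      near-lower yᵥ     c        = w′wq
      near-lower zᵥ     c        = w′pq
      near-lower uᵥ     c        = contradiction c off-by-one
      near-lower vᵥ     c        = contradiction c off-by-one

      f-near : ∀ {A B C} → h A ≡ h C → A ≢ C → Consecutive (h A) (h B) → β (f A) (f B) (f C)
      f-near {A} {B} {C} e ne c with sameLevel i e ne
      ... | yz = near-upper B c
      ... | zy = P2 _ _ _ (near-upper B c)
      ... | uv = near-lower B c
      ... | vu = P2 _ _ _ (near-lower B c)

      far-upper : ∀ B → i ≢ h B → ¬ Consecutive i (h B) → ¬ Collinear p w (f B)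
      far-upper (xᵥ j) ne ¬c with <-cmp (xLevel i (toℕ j)) i
      ... | tri≈ _ e _ = contradiction (sym e) ne
      ... | tri< lt _ _ = farₚ-left (x-left j (≤-pred (≤∧≢⇒< lt (λ e → ¬c (inj₂ (sym e))))))
      ... | tri> _ _ gt with m≤n⇒m<n∨m≡n (≤∧≢⇒< gt (λ e → ¬c (inj₁ (sym e))))
      ...   | inj₁ lt = farₚ-right (there (x-right j lt))
      ...   | inj₂ e  = farₚ-right (here (x-at j 3 (≡.trans (sym e) (+-comm 3 (length u)))))
      far-upper yᵥ ne ¬c = contradiction refl ne
      far-upper zᵥ ne ¬c = contradiction refl ne
      far-upper uᵥ ne ¬c = contradiction (inj₁ refl) ¬c
      far-upper vᵥ ne ¬c = contradiction (inj₁ refl) ¬c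

      far-lower : ∀ B → suc i ≢ h B → ¬ Consecutive (suc i) (h B) → ¬ Collinear q w′ (f B)
      far-lower (xᵥ j) ne ¬c with <-cmp (xLevel i (toℕ j)) (suc i)
      ... | tri≈ _ e _ = contradiction (sym e) ne
      ... | tri> _ _ gt = far-q-right (x-right j (≤∧≢⇒< gt (λ e → ¬c (inj₁ (sym e)))))
      ... | tri< lt _ _ with m≤n⇒m<n∨m≡n (≤-pred (≤∧≢⇒< lt (λ e → ¬c (inj₂ (sym e)))))
      ...   | inj₁ lt′ = far-q-left (∈-++⁺ˡ (x-left j (≤-pred lt′)))
      ...   | inj₂ e   = far-q-left (∈-++⁺ʳ u (here (x-at j 0 (≡.trans (suc-injective e) (sym (+-identityʳ _))))))
      far-lower yᵥ ne ¬c = contradiction (inj₂ refl) ¬c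
      far-lower zᵥ ne ¬c = contradiction (inj₂ refl) ¬c
      far-lower uᵥ ne ¬c = contradiction refl ne
      far-lower vᵥ ne ¬c = contradiction refl ne

      noncollinear : ∀ {x y z} → ¬ Collinear x y z → ¬ β y z x × ¬ β z y x × ¬ β y x z
      noncollinear ¬c = (λ b → ¬c (inj₂ (inj₂ (inj₂ (inj₁ b))))) , (λ b → ¬c (inj₂ (inj₂ (inj₂ (inj₂ (inj₂ b)))))) , (λ b → ¬c (inj₂ (inj₂ (inj₁ b))))

      f-far : ∀ {A B C} → h A ≡ h C → A ≢ C → h A ≢ h B → ¬ Consecutive (h A) (h B) →
              ¬ β (f A) (f B) (f C) × ¬ β (f B) (f A) (f C) × ¬ β (f A) (f C) (f B)
      f-far {A} {B} {C} e ne ne′ ¬c with sameLevel i e ne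
      ... | yz = noncollinear (far-upper B ne′ ¬c)
      ... | zy = noncollinear (λ c → far-upper B ne′ ¬c (col-swapˡ c))
      ... | uv = noncollinear (far-lower B ne′ ¬c)
      ... | vu = noncollinear (λ c → far-lower B ne′ ¬c (col-swapˡ c))

      w≢p : w ≢ p
      w≢p refl = farₚ-right (here refl) col-degenerate

      w′≢q : w′ ≢ q
      w′≢q refl = far-q-left (∈-++⁺ʳ u (here refl)) col-degenerate

      f-< : ∀ A B → h A < h B → f A ≢ f B
      f-< A B A<B with choose₂ Upper upper-choice {A} {B} A<B | choose₂ Lower lower-choice {A} {B} A<B
      ... | σ , a₁ , b₁ | τ , a₂ , b₂ rewrite f-nth A a₁ a₂ | f-nth B b₁ b₂ =
        distinct (C-line σ τ) (nth-⊆₂ (C σ τ) A<B (h< B σ τ))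

      f-injective : ∀ {A B} → f A ≡ f B → A ≡ B
      f-injective {A} {B} eq with Graph._≟ⱽ_ (T n i) A B
      ... | yes e = e
      ... | no ne with <-cmp (h A) (h B)
      ...   | tri< lt _ _ = contradiction eq (f-< A B lt)
      ...   | tri> _ _ gt = contradiction (sym eq) (f-< B A gt)
      ...   | tri≈ _ e _ with sameLevel i e ne
      ...     | yz = contradiction eq w≢p
      ...     | zy = contradiction (sym eq) w≢p
      ...     | uv = contradiction eq w′≢q
      ...     | vu = contradiction (sym eq) w′≢q

      f-byLevel : ByLevel h (λ A B C → β (f A) (f B) (f C))
      f-byLevel = record
        { start  = λ A B → P1 _ _
        ; mirror = P2 _ _ _
        ; unique = λ r s → f-injective (P3 _ _ _ r s)
        ; along  = λ {A} {B} {C} → f-along {A} {B} {C}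
        ; near   = λ {A} {B} {C} → f-near {A} {B} {C}
        ; far    = λ {A} {B} {C} → f-far {A} {B} {C}
        }

      f-surjective : ∀ e → ∃[ A ] f A ≡ e
      f-surjective e with Perm.∈-resp-↭ cover (all∈ e)
      ... | here refl         = zᵥ , refl
      ... | there (here refl) = vᵥ , refl
      ... | there (there j) with ∈-nth {d = w} j
      ...   | k , k< , eq with at-level k (≤-trans k< (≤-reflexive (length-C true true)))
      ...     | xᵥ j , refl = xᵥ j , eq
      ...     | yᵥ , refl   = yᵥ , ≡.trans (f-nth yᵥ {true} {true} refl _) eq
      ...     | zᵥ , refl   = yᵥ , ≡.trans (f-nth yᵥ {true} {true} refl _) eq
      ...     | uᵥ , refl   = uᵥ , ≡.trans (f-nth uᵥ {true} {true} _ refl) eq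
      ...     | vᵥ , refl   = uᵥ , ≡.trans (f-nth uᵥ {true} {true} _ refl) eq

      g : X → TVertex n
      g e = proj₁ (f-surjective e)

      f∘g : ∀ e → f (g e) ≡ e
      f∘g e = proj₂ (f-surjective e)

    twins-≃ : ∃[ k ] Σ[ 1≤k ∈ 1 ≤ k ] Σ[ k≤ ∈ k ≤ ⌈ n ∸ 5 /2⌉ ] 𝓑 ≃ 𝓣 n k 1≤k k≤
    twins-≃ = i , s≤s z≤n , i≤ , mk↔ₛ′ g f (λ A → f-injective (f∘g (f A))) f∘g , λ x y z → mk⇔
      (λ b → proj₁ (T-determined f-byLevel {g x} {g y} {g z}) (subst (λ e → β e (f (g y)) (f (g z))) (sym (f∘g x)) (subst₂ (β x) (sym (f∘g y)) (sym (f∘g z)) b)))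
      (λ b → subst (λ e → β e y z) (f∘g x) (subst₂ (β (f (g x))) (f∘g y) (f∘g z) (proj₂ (T-determined f-byLevel {g x} {g y} {g z}) b)))

open import Data.Fin.Base using (zero; suc)

-- Structures of small co-size

module Metric {V : Set} (d : V → V → ℕ) (d-refl : ∀ a → d a a ≡ 0) (d≡0⇒≡ : ∀ a b → d a b ≡ 0 → a ≡ b)
  (d-sym : ∀ a b → d a b ≡ d b a) (d-triangle : ∀ a b c → d a c ≤ d a b + d b c) where

  Between : V → V → V → Set
  Between a b c = d a c ≡ d a b + d b c

  between-swap : ∀ a b c → Between a b c → Between c b a
  between-swap a b c p = ≡.trans (d-sym c a) (≡.trans p (≡.trans (+-comm (d a b) _) (cong₂ _+_ (d-sym b c) (d-sym a b))))

  between-antisym : ∀ a b c → Between a b c → Between b a c → a ≡ b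
  between-antisym a b c p q = d≡0⇒≡ a b (m+n≡0⇒m≡0 (d a b) (+-cancelʳ-≡ (d a c) _ 0
    (≡.trans (+-assoc (d a b) _ _) (≡.trans (cong (d a b +_) (sym q)) (sym p)))))

  between-trans : ∀ a b c e → Between a b c → Between a e b → Between a e c × Between e b c
  between-trans a b c e p q =
    ≤-antisym (d-triangle a e c) (≤-trans (+-monoʳ-≤ (d a e) (d-triangle e b c)) (≤-reflexive (sym split))) ,
    ≤-antisym (d-triangle e b c) (+-cancelˡ-≤ (d a e) _ _ (≤-trans (≤-reflexive (sym split)) (d-triangle a e c)))
    where
    split : d a c ≡ d a e + (d e b + d b c)
    split = ≡.trans p (≡.trans (cong (_+ d b c) q) (+-assoc (d a e) _ _))

module LevelMetric {n : ℕ} (h : Fin n → ℕ) (k : ℕ) where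

  δ : Fin n → Fin n → ℕ
  δ a b with a Fin.≟ b
  ... | yes _ = 0
  ... | no _ with h a ≟ h b
  ...   | yes _ = k
  ...   | no _  = ∣ h a - h b ∣

  δ-refl : ∀ a → δ a a ≡ 0
  δ-refl a with a Fin.≟ a
  ... | yes _ = refl
  ... | no ne = contradiction refl ne

  levelled : Levelled h k δ
  levelled = record { d-level = δ-level ; d-twin = δ-twin }
    where
    δ-level : ∀ {a b} → h a ≢ h b → δ a b ≡ ∣ h a - h b ∣
    δ-level {a} {b} ne with a Fin.≟ b
    ... | yes refl = contradiction refl ne
    ... | no _ with h a ≟ h b
    ...   | yes e = contradiction e ne
    ...   | no _  = refl
    δ-twin : ∀ {a b} → h a ≡ h b → a ≢ b → δ a b ≡ k
    δ-twin {a} {b} e ne with a Fin.≟ b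
    ... | yes e′ = contradiction e′ ne
    ... | no _ with h a ≟ h b
    ...   | yes _ = refl
    ...   | no ne′ = contradiction e ne′

  open Levelled levelled

  δ-cases : ∀ a b → a ≡ b ⊎ (a ≢ b × h a ≡ h b) ⊎ h a ≢ h b
  δ-cases a b with a Fin.≟ b | h a ≟ h b
  ... | yes e | _     = inj₁ e
  ... | no ne | yes e = inj₂ (inj₁ (ne , e))
  ... | no _  | no ne = inj₂ (inj₂ ne)

  δ-sym : ∀ a b → δ a b ≡ δ b a
  δ-sym a b with δ-cases a b
  ... | inj₁ refl            = refl
  ... | inj₂ (inj₁ (ne , e)) = ≡.trans (d-twin e ne) (sym (d-twin (sym e) (ne ∘ sym)))
  ... | inj₂ (inj₂ ne)       = ≡.trans (d-level ne) (≡.trans (∣-∣-comm (h a) (h b)) (sym (d-level (ne ∘ sym))))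

  level≤δ : ∀ a b → ∣ h a - h b ∣ ≤ δ a b
  level≤δ a b with δ-cases a b
  ... | inj₁ refl            = ≤-trans (≤-reflexive (∣n-n∣≡0 (h a))) z≤n
  ... | inj₂ (inj₁ (ne , e)) = ≤-trans (≤-reflexive (m≡n⇒∣m-n∣≡0 e)) z≤n
  ... | inj₂ (inj₂ ne)       = ≤-reflexive (sym (d-level ne))

  module _ (1≤k : 1 ≤ k) (k≤2 : k ≤ 2) where

    δ-positive : ∀ a b → a ≢ b → 1 ≤ δ a b
    δ-positive a b ne with δ-cases a b
    ... | inj₁ e              = contradiction e ne
    ... | inj₂ (inj₁ (_ , e)) = ≤-trans 1≤k (≤-reflexive (sym (d-twin e ne)))
    ... | inj₂ (inj₂ ne′)     = ≤-trans (n≢0⇒n>0 (ne′ ∘ ∣m-n∣≡0⇒m≡n)) (≤-reflexive (sym (d-level ne′)))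

    δ≡0⇒≡ : ∀ a b → δ a b ≡ 0 → a ≡ b
    δ≡0⇒≡ a b eq with δ-cases a b
    ... | inj₁ e              = e
    ... | inj₂ (inj₁ (ne , _)) = contradiction (δ-positive a b ne) (<⇒≱ (s≤s (≤-reflexive eq)))
    ... | inj₂ (inj₂ ne)       = contradiction (δ-positive a b (ne ∘ cong h)) (<⇒≱ (s≤s (≤-reflexive eq)))

    -- A third point has distance at least 1 from each of two points on one level, which is enough
    -- for k ≤ 2. On different levels the level differences obey the triangle inequality and bound
    -- `δ` from below.
    δ-triangle : ∀ a b c → δ a c ≤ δ a b + δ b c
    δ-triangle a b c = go (a Fin.≟ b) (b Fin.≟ c)
      where
      go : Dec (a ≡ b) → Dec (b ≡ c) → δ a c ≤ δ a b + δ b c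
      go (yes refl) _          = m≤n+m (δ a c) _
      go (no _)     (yes refl) = m≤m+n (δ a b) _
      go (no ab)    (no bc) with δ-cases a c
      ... | inj₁ refl            = ≤-trans (≤-reflexive (δ-refl a)) z≤n
      ... | inj₂ (inj₁ (ne , e)) = ≤-trans (≤-reflexive (d-twin e ne)) (≤-trans k≤2 (+-mono-≤ (δ-positive a b ab) (δ-positive b c bc)))
      ... | inj₂ (inj₂ ne)       = ≤-trans (≤-reflexive (d-level ne))
              (≤-trans (∣-∣-triangle (h a) (h b) (h c)) (+-mono-≤ (level≤δ a b) (level≤δ b c)))

    open Metric δ δ-refl δ≡0⇒≡ δ-sym δ-triangle

    structure : NonZero n → BetweennessStructure
    structure nz = record
      { X        = Fin n
      ; order    = n
      ; enum     = ↔-id _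
      ; nonEmpty = nz
      ; β        = Between
      ; β?       = λ a b c → δ a c ≟ δ a b + δ b c
      ; P1       = λ a c → cong (_+ δ a c) (sym (δ-refl a))
      ; P2       = between-swap
      ; P3       = between-antisym
      ; P4       = between-trans
      }

    module Counting (nz : NonZero n) where
      open BetweennessStructure (structure nz) using (Collinear)
      open Plane (structure nz) using (S; D; τ; coSize≡τ; col-cases; col-swapˡ; col-swapʳ)
      open Star (structure nz) using (S-col; S-¬col)

      coSize≡ : BetweennessStructure.coSize (structure nz) ≡ τ (allFin n)
      coSize≡ = ≡.trans coSize≡τ (cong τ (map-id (allFin n)))

      Ascending : List (Fin n) → Set
      Ascending = AllPairs (λ a b → h a < h b)

      Above : Fin n → List (Fin n) → Set
      Above a = All (λ b → h a < h b)

      S-ascending : ∀ {a b} l → h a < h b → Above b l → S a b l ≡ 0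
      S-ascending {a} {b} l a<b b< = S-col {a} {b} l (λ {c} i → inj₁ (d-along {a} {b} {c} a<b (All.lookup b< i)))

      D-ascending : ∀ {a} l → Above a l → Ascending l → D a l ≡ 0
      D-ascending []      _          _         = refl
      D-ascending (b ∷ l) (a<b ∷ a<) (b< ∷ l<) = cong₂ _+_ (S-ascending l a<b b<) (D-ascending l a< l<)

      τ-ascending : ∀ l → Ascending l → τ l ≡ 0
      τ-ascending []      _         = refl
      τ-ascending (a ∷ l) (a< ∷ l<) = cong₂ _+_ (D-ascending l a< l<) (τ-ascending l l<)

      col-near : k ≡ 2 → ∀ {a b c} → h a ≡ h b → a ≢ b → Consecutive (h a) (h c) → Collinear a b c
      col-near k≡2 {a} {b} {c} e ne n = inj₂ (inj₁ (d-near k≡2 {a} {c} {b} e ne n))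

      ¬col-far : ∀ {a b c} → h a ≡ h b → a ≢ b → h a ≢ h c → k ≢ ∣ h a - h c ∣ + ∣ h a - h c ∣ → ¬ Collinear a b c
      ¬col-far {a} {b} {c} e ne ne′ k≢ col
        with d-far (λ k≡0 → <⇒≱ 1≤k (≤-reflexive k≡0)) {a} {c} {b} e ne ne′ k≢ | col-cases {a} {b} {c} col
      ... | ¬acb , ¬cab , ¬abc | inj₁ abc        = ¬abc abc
      ... | ¬acb , ¬cab , ¬abc | inj₂ (inj₁ bac) = ¬cab (between-swap b a c bac)
      ... | ¬acb , ¬cab , ¬abc | inj₂ (inj₂ acb) = ¬acb acb

      S-far : ∀ {a b} l → h a ≡ h b → a ≢ b → (∀ {c} → c ∈ l → h a ≢ h c × k ≢ ∣ h a - h c ∣ + ∣ h a - h c ∣) → S a b l ≡ length l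
      S-far {a} {b} l e ne far = S-¬col {a} {b} l (λ {c} i → ¬col-far {a} {b} {c} e ne (proj₁ (far i)) (proj₂ (far i)))

module Path (m : ℕ) where
  open LevelMetric {suc m} toℕ 2
  open Counting (s≤s z≤n) ≤-refl _

  path : BetweennessStructure
  path = structure (s≤s z≤n) ≤-refl _

  path-coSize : BetweennessStructure.coSize path ≡ 0
  path-coSize = ≡.trans coSize≡ (τ-ascending _ (AllPairs.tabulate⁺-< id))

-- Levels 0, 0, 1, 2, ...: with k = 2 a path with a doubled end, with k = 1 a triangle with a path
-- attached.
forkLevel : ℕ → ℕ
forkLevel zero    = 0
forkLevel (suc j) = j

module Fork (m : ℕ) where
  open LevelMetric {3 + m} (forkLevel ∘ toℕ) 2
  open Counting (s≤s z≤n) ≤-refl _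

  fork : BetweennessStructure
  fork = structure (s≤s z≤n) ≤-refl _

  open Plane fork using (χ-col)

  private
    a b c : Fin (3 + m)
    a = zero
    b = suc zero
    c = suc (suc zero)

    tail : List (Fin (3 + m))
    tail = tabulate (λ j → suc (suc (suc j)))

    far : ∀ {e} → e ∈ tail → 0 ≢ forkLevel (toℕ e) × 2 ≢ forkLevel (toℕ e) + forkLevel (toℕ e)
    far i with ∈-tabulate⁻ i
    ... | j , refl = (λ ()) , λ eq → 1+n≢0 (sym (≡.trans (suc-injective (suc-injective eq)) (+-suc (toℕ j) _)) )

  fork-coSize : BetweennessStructure.coSize fork ≡ m
  fork-coSize = ≡.trans coSize≡ (≡.trans
    (cong₂ _+_
      (cong₂ _+_
        (cong₂ _+_ (χ-col {a} {b} {c} (col-near refl {a} {b} {c} refl (λ ()) (inj₁ refl)))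
                   (S-far {a} {b} tail refl (λ ()) far))
        (D-ascending {a} (c ∷ tail) (s≤s z≤n ∷ All.tabulate⁺ (λ _ → s≤s z≤n)) ascending))
      (cong₂ _+_ (D-ascending {b} (c ∷ tail) (s≤s z≤n ∷ All.tabulate⁺ (λ _ → s≤s z≤n)) ascending)
                 (τ-ascending (c ∷ tail) ascending)))
    (≡.trans (+-identityʳ _) (≡.trans (+-identityʳ _) (length-tabulate _))))
    where
    ascending : Ascending (c ∷ tail)
    ascending = All.tabulate⁺ (λ _ → s≤s (s≤s z≤n)) ∷ AllPairs.tabulate⁺-< (λ lt → s≤s (s≤s lt))

module Prongs (m : ℕ) where
  open LevelMetric {2 + m} (forkLevel ∘ toℕ) 1
  open Counting ≤-refl (s≤s z≤n) _

  prongs : BetweennessStructure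
  prongs = structure ≤-refl (s≤s z≤n) _

  private
    a b : Fin (2 + m)
    a = zero
    b = suc zero

    tail : List (Fin (2 + m))
    tail = tabulate (λ j → suc (suc j))

    far : ∀ {e} → e ∈ tail → 0 ≢ forkLevel (toℕ e) × 1 ≢ forkLevel (toℕ e) + forkLevel (toℕ e)
    far i with ∈-tabulate⁻ i
    ... | j , refl = (λ ()) , λ eq → 1+n≢0 (sym (≡.trans (suc-injective eq) (+-suc (toℕ j) _)))

  prongs-coSize : BetweennessStructure.coSize prongs ≡ m
  prongs-coSize = ≡.trans coSize≡ (≡.trans
    (cong₂ _+_
      (cong₂ _+_ (S-far {a} {b} tail refl (λ ()) far) (D-ascending {a} tail (All.tabulate⁺ (λ _ → s≤s z≤n)) ascending))
      (cong₂ _+_ (D-ascending {b} tail (All.tabulate⁺ (λ _ → s≤s z≤n)) ascending) (τ-ascending tail ascending)))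
    (≡.trans (+-identityʳ _) (≡.trans (+-identityʳ _) (length-tabulate _))))
    where
    ascending : Ascending tail
    ascending = AllPairs.tabulate⁺-< s≤s

-- Levels 0, 1, 1, 2, 3, ...: with k = 2 a 4-cycle with a path attached.
cycleLevel : ℕ → ℕ
cycleLevel zero          = 0
cycleLevel (suc zero)    = 1
cycleLevel (suc (suc j)) = suc j

module FourCycle (m : ℕ) where
  open LevelMetric {4 + m} (cycleLevel ∘ toℕ) 2
  open Counting (s≤s z≤n) ≤-refl _

  fourCycle : BetweennessStructure
  fourCycle = structure (s≤s z≤n) ≤-refl _

  open Plane fourCycle using (χ-col; col-swapˡ; col-swapʳ)

  private
    o a b c : Fin (4 + m)
    o = zero
    a = suc zero
    b = suc (suc zero)
    c = suc (suc (suc zero))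

    tail : List (Fin (4 + m))
    tail = tabulate (λ j → suc (suc (suc (suc j))))

    far : ∀ {e} → e ∈ tail → 1 ≢ cycleLevel (toℕ e) × 2 ≢ ∣ 1 - cycleLevel (toℕ e) ∣ + ∣ 1 - cycleLevel (toℕ e) ∣
    far i with ∈-tabulate⁻ i
    ... | j , refl = (λ ()) , λ eq → 1+n≢0 (sym (≡.trans (suc-injective (suc-injective eq)) (+-suc (toℕ j) _)))

  fourCycle-coSize : BetweennessStructure.coSize fourCycle ≡ m
  fourCycle-coSize = ≡.trans coSize≡ (≡.trans
    (cong₂ _+_
      (cong₂ _+_ (cong₂ _+_ (χ-col {o} {a} {b} (col-swapˡ {a} {o} {b} (col-swapʳ {a} {b} {o} (col-near refl {a} {b} {o} refl (λ ()) (inj₂ refl)))))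
                            (S-ascending {o} {a} (c ∷ tail) ≤-refl (≤-refl ∷ All.tabulate⁺ (λ _ → s≤s (s≤s z≤n)))))
                 (cong₂ _+_ (S-ascending {o} {b} (c ∷ tail) ≤-refl (≤-refl ∷ All.tabulate⁺ (λ _ → s≤s (s≤s z≤n))))
                            (D-ascending {o} (c ∷ tail) (s≤s z≤n ∷ All.tabulate⁺ (λ _ → s≤s z≤n)) ascending)))
      (cong₂ _+_
        (cong₂ _+_ (cong₂ _+_ (χ-col {a} {b} {c} (col-near refl {a} {b} {c} refl (λ ()) (inj₁ refl)))
                              (S-far {a} {b} tail refl (λ ()) far))
                   (D-ascending {a} (c ∷ tail) (≤-refl ∷ All.tabulate⁺ (λ _ → s≤s (s≤s z≤n))) ascending))
        (cong₂ _+_ (D-ascending {b} (c ∷ tail) (≤-refl ∷ All.tabulate⁺ (λ _ → s≤s (s≤s z≤n))) ascending)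
                   (τ-ascending (c ∷ tail) ascending))))
    (≡.trans (+-identityʳ _) (≡.trans (+-identityʳ _) (length-tabulate _))))
    where
    ascending : Ascending (c ∷ tail)
    ascending = All.tabulate⁺ (λ _ → s≤s (s≤s (s≤s z≤n))) ∷ AllPairs.tabulate⁺-< (λ lt → s≤s (s≤s (s≤s lt)))

-- The levels of the graph T with i = 1.
doubleLevel : ℕ → ℕ
doubleLevel 0                                 = 0
doubleLevel 1                                 = 1
doubleLevel 2                                 = 1
doubleLevel 3                                 = 2
doubleLevel 4                                 = 2
doubleLevel (suc (suc (suc (suc (suc j))))) = 3 + j

module DoubleCycle (m : ℕ) where
  open LevelMetric {6 + m} (doubleLevel ∘ toℕ) 2
  open Counting (s≤s z≤n) ≤-refl _

  doubleCycle : BetweennessStructure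
  doubleCycle = structure (s≤s z≤n) ≤-refl _

  open Plane doubleCycle using (χ; S; D; χ-col; χ-¬col; col-swapˡ; col-swapʳ)

  private
    o a b c d e : Fin (6 + m)
    o = zero
    a = suc zero
    b = suc (suc zero)
    c = suc (suc (suc zero))
    d = suc (suc (suc (suc zero)))
    e = suc (suc (suc (suc (suc zero))))

    tail : List (Fin (6 + m))
    tail = tabulate (λ j → suc (suc (suc (suc (suc (suc j))))))

    far₁ : ∀ {f} → f ∈ e ∷ tail → 1 ≢ doubleLevel (toℕ f) × 2 ≢ ∣ 1 - doubleLevel (toℕ f) ∣ + ∣ 1 - doubleLevel (toℕ f) ∣
    far₁ i with ∈-tabulate⁻ {f = λ j → suc (suc (suc (suc (suc j))))} i
    ... | j , refl = (λ ()) , λ eq → 1+n≢0 (sym (≡.trans (suc-injective (suc-injective eq)) (+-suc (toℕ j) _)))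

    far₂ : ∀ {f} → f ∈ tail → 2 ≢ doubleLevel (toℕ f) × 2 ≢ ∣ 2 - doubleLevel (toℕ f) ∣ + ∣ 2 - doubleLevel (toℕ f) ∣
    far₂ i with ∈-tabulate⁻ i
    ... | j , refl = (λ ()) , λ eq → 1+n≢0 (sym (≡.trans (suc-injective (suc-injective eq)) (+-suc (toℕ j) _)))

    ascending : Ascending (e ∷ tail)
    ascending = AllPairs.tabulate⁺-< {f = λ j → suc (suc (suc (suc (suc j))))} (λ lt → s≤s (s≤s (s≤s lt)))

    above : ∀ {f} → doubleLevel (toℕ f) ≤ 2 → Above f (e ∷ tail)
    above {f} le = All.tabulate⁺ {f = λ j → suc (suc (suc (suc (suc j))))} (λ _ → s≤s (≤-trans le (s≤s (s≤s z≤n))))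

    D-above : ∀ {f} → doubleLevel (toℕ f) ≤ 2 → D f (e ∷ tail) ≡ 0
    D-above {f} le = D-ascending {f} (e ∷ tail) (above {f} le) ascending

    S-above : ∀ {f g} → doubleLevel (toℕ f) < doubleLevel (toℕ g) → doubleLevel (toℕ g) ≤ 2 → S f g (e ∷ tail) ≡ 0
    S-above {f} {g} lt le = S-ascending {f} {g} (e ∷ tail) lt (above {g} le)

    oab : χ o a b ≡ 0
    oab = χ-col {o} {a} {b} (col-swapˡ {a} {o} {b} (col-swapʳ {a} {b} {o} (col-near refl {a} {b} {o} refl (λ ()) (inj₂ refl))))

    ocd : χ o c d ≡ 1
    ocd = χ-¬col {o} {c} {d} (λ q → ¬col-far {c} {d} {o} refl (λ ()) (λ ()) (λ ()) (col-swapʳ {c} {o} {d} (col-swapˡ {o} {c} {d} q)))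

    fcd : ∀ {f} → doubleLevel (toℕ f) ≡ 1 → χ f c d ≡ 0
    fcd {f} eq = χ-col {f} {c} {d} (col-swapˡ {c} {f} {d} (col-swapʳ {c} {d} {f} (col-near refl {c} {d} {f} refl (λ ()) (inj₂ (cong suc (sym eq))))))

    D-o : D o (a ∷ b ∷ c ∷ d ∷ e ∷ tail) ≡ 1
    D-o = cong₂ _+_ (cong₂ _+_ oab (S-ascending {o} {a} (c ∷ d ∷ e ∷ tail) ≤-refl (≤-refl ∷ ≤-refl ∷ above {a} (s≤s z≤n))))
         (cong₂ _+_ (S-ascending {o} {b} (c ∷ d ∷ e ∷ tail) ≤-refl (≤-refl ∷ ≤-refl ∷ above {b} (s≤s z≤n)))
         (cong₂ _+_ (cong₂ _+_ ocd (S-above {o} {c} (s≤s z≤n) ≤-refl))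
         (cong₂ _+_ (S-above {o} {d} (s≤s z≤n) ≤-refl) (D-above {o} z≤n))))

    D-a : D a (b ∷ c ∷ d ∷ e ∷ tail) ≡ 1 + m
    D-a = ≡.trans (cong₂ _+_ (cong₂ _+_ (χ-col {a} {b} {c} (col-near refl {a} {b} {c} refl (λ ()) (inj₁ refl)))
                             (cong₂ _+_ (χ-col {a} {b} {d} (col-near refl {a} {b} {d} refl (λ ()) (inj₁ refl)))
                                        (≡.trans (S-far {a} {b} (e ∷ tail) refl (λ ()) far₁) (cong suc (length-tabulate _)))))
            (cong₂ _+_ (cong₂ _+_ (fcd {a} refl) (S-above {a} {c} ≤-refl ≤-refl))
            (cong₂ _+_ (S-above {a} {d} ≤-refl ≤-refl) (D-above {a} (s≤s z≤n)))))
          (+-identityʳ _)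

    D-b : D b (c ∷ d ∷ e ∷ tail) ≡ 0
    D-b = cong₂ _+_ (cong₂ _+_ (fcd {b} refl) (S-above {b} {c} ≤-refl ≤-refl))
         (cong₂ _+_ (S-above {b} {d} ≤-refl ≤-refl) (D-above {b} (s≤s z≤n)))

    D-c : D c (d ∷ e ∷ tail) ≡ m
    D-c = ≡.trans (cong₂ _+_ (cong₂ _+_ (χ-col {c} {d} {e} (col-near refl {c} {d} {e} refl (λ ()) (inj₁ refl)))
                                        (≡.trans (S-far {c} {d} tail refl (λ ()) far₂) (length-tabulate _)))
                             (D-above {c} ≤-refl)) (+-identityʳ _)

  -- The triangles are o c d, a b e, and both a b and c d with each of the m points of `tail`.
  doubleCycle-coSize : BetweennessStructure.coSize doubleCycle ≡ 2 + 2 * m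
  doubleCycle-coSize = ≡.trans coSize≡ (≡.trans
    (cong₂ _+_ D-o (cong₂ _+_ D-a (cong₂ _+_ D-b (cong₂ _+_ D-c (cong₂ _+_ (D-above {d} ≤-refl) (τ-ascending (e ∷ tail) ascending))))))
    (eq m))
    where
    eq : ∀ m → 1 + (1 + m + (0 + (m + 0))) ≡ 2 + 2 * m
    eq = solve-∀

-- The classification applied to all points, and structures other than that of T

module Classification (𝓑 : BetweennessStructure) where
  open BetweennessStructure 𝓑
  open Plane 𝓑
  open Star 𝓑
  open Pairs 𝓑
  open Structure 𝓑
  open Recognition 𝓑

  length-points : length points ≡ order
  length-points = ≡.trans (length-map point (allFin order)) (length-tabulate {n = order} id)

  points-complete : ∀ e → e ∈ points
  points-complete e = subst (_∈ points) (Inverse.strictlyInverseʳ enum e) (∈-map⁺ point (∈-allFin (Inverse.to enum e)))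

  points-distinct : Distinct points
  points-distinct = allPairs (AllPairs.map⁺ (AllPairs.tabulate⁺ {f = id} (λ ne eq → ne (point-injective eq))))
    where
    point-injective : ∀ {i j} → point i ≡ point j → i ≡ j
    point-injective {i} {j} eq = ≡.trans (sym (Inverse.strictlyInverseˡ enum i))
      (≡.trans (cong (Inverse.to enum) eq) (Inverse.strictlyInverseˡ enum j))
    allPairs : ∀ {l} → AllPairs _≢_ l → Distinct l
    allPairs (a≢ ∷ _) (refl ∷ τ) = All.lookup a≢ (to∈ τ)
    allPairs (_ ∷ l≢) (_ ∷ʳ τ)   = allPairs l≢ τ

  classify : 6 ≤ order → Small order (BetweennessStructure.coSize 𝓑) ⊎
             (2 * order ≤ BetweennessStructure.coSize 𝓑 + 10 ×
              (9 ≤ order → BetweennessStructure.coSize 𝓑 + 10 ≡ 2 * order → Twins points))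
  classify 6≤ = subst₂ (λ n t → Small n t ⊎ (2 * n ≤ t + 10 × (9 ≤ n → t + 10 ≡ 2 * n → Twins points)))
    length-points (sym coSize≡τ) (result points (subst (6 ≤_) (sym length-points) 6≤) points-distinct)

  recognise : Twins points → ∃[ k ] Σ[ 1≤k ∈ 1 ≤ k ] Σ[ k≤ ∈ k ≤ ⌈ order ∸ 5 /2⌉ ] 𝓑 ≃ 𝓣 order k 1≤k k≤
  recognise t = [ ordered-case t , reversed-case (twins-reverse t) ]′ (≤-total (length (Twins.u t)) (length (Twins.v t)))
    where
    Goal : ℕ → Set
    Goal n = ∃[ k ] Σ[ 1≤k ∈ 1 ≤ k ] Σ[ k≤ ∈ k ≤ ⌈ n ∸ 5 /2⌉ ] 𝓑 ≃ 𝓣 n k 1≤k k≤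
    ordered-case : (t : Twins points) → length (Twins.u t) ≤ length (Twins.v t) → Goal order
    ordered-case t u≤v = subst Goal size (twins-≃ t u≤v points-complete)
      where
      open Twins t
      eq : ∀ m k → 6 + (m + k) ≡ 2 + (m + (4 + k))
      eq = solve-∀
      size : 6 + (length u + length v) ≡ order
      size = ≡.trans (≡.trans (eq (length u) (length v))
        (sym (≡.trans (Perm.↭-length cover) (cong (2 +_) (length-++ u))))) length-points
    reversed-case : ∃[ t′ ] (length (Twins.u {l = points} t′) ≡ length (Twins.v t) ×
                             length (Twins.v {l = points} t′) ≡ length (Twins.u t)) →
                    length (Twins.v t) ≤ length (Twins.u t) → Goal order
    reversed-case (t′ , u≡ , v≡) v≤u = ordered-case t′ (subst₂ _≤_ (sym u≡) (sym v≡) v≤u)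

-- 𝓣 has disjoint triangles y z xᵢ₊₁ and u v xᵢ.
module Disjoint (𝓑 : BetweennessStructure) where
  open BetweennessStructure 𝓑

  Piercing : X → Set
  Piercing a = ∀ x y z → Collinear x y z ⊎ (a ≡ x ⊎ a ≡ y ⊎ a ≡ z)

  not-𝓣 : ∀ {a} → Piercing a → ∀ n i (1≤i : 1 ≤ i) (i≤ : i ≤ ⌈ n ∸ 5 /2⌉) → ¬ (𝓑 ≃ 𝓣 n i 1≤i i≤)
  not-𝓣 {a} pierce n (suc i) 1≤i i≤ (F , F-β) = apart (hit {yᵥ} {zᵥ} {x⁺} yzx) (hit {uᵥ} {vᵥ} {x⁻} uvx)
    where
    open TDistance n (suc i) 1≤i i≤
    module 𝓣′ = BetweennessStructure (𝓣 n (suc i) 1≤i i≤)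
    i< : suc i < n ∸ 4
    i< = i<n∸4 n (suc i) 1≤i i≤
    x⁺ x⁻ : TVertex n
    x⁺ = xᵥ (fromℕ< i<)
    x⁻ = xᵥ (fromℕ< (<-trans (n<1+n i) i<))
    h : TVertex n → ℕ
    h = level (suc i)
    h⁺ : h x⁺ ≡ 3 + i
    h⁺ = ≡.trans (cong (xLevel (suc i)) (Fin.toℕ-fromℕ< i<)) (xLevel-≥ ≤-refl)
    h⁻ : h x⁻ ≡ i
    h⁻ = ≡.trans (cong (xLevel (suc i)) (Fin.toℕ-fromℕ< (<-trans (n<1+n i) i<))) (xLevel-< ≤-refl)
    ¬col : ∀ {A B C} → h A ≡ h B → A ≢ B → h A ≢ h C → ¬ Consecutive (h A) (h C) → ¬ 𝓣′.Collinear A B C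
    ¬col {A} {B} {C} e ne ne′ ¬c col with ByLevel.far T-byLevel {A} {C} {B} e ne ne′ ¬c | Plane.col-cases (𝓣 n (suc i) 1≤i i≤) {A} {B} {C} col
    ... | ¬acb , ¬cab , ¬abc | inj₁ abc        = ¬abc abc
    ... | ¬acb , ¬cab , ¬abc | inj₂ (inj₁ bac) = ¬cab (𝓣′.P2 B A C bac)
    ... | ¬acb , ¬cab , ¬abc | inj₂ (inj₂ acb) = ¬acb acb
    yzx : ¬ 𝓣′.Collinear yᵥ zᵥ x⁺
    yzx = ¬col {yᵥ} {zᵥ} {x⁺} refl (λ ()) (λ e → m≢1+n+m (suc i) {1} (≡.trans e h⁺)) (λ c → not-consecutive (subst (Consecutive (suc i)) h⁺ c))
      where
      not-consecutive : ¬ Consecutive (suc i) (3 + i)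
      not-consecutive (inj₁ e) = 1+n≢n e
      not-consecutive (inj₂ e) = m≢1+n+m (suc i) {2} e
    uvx : ¬ 𝓣′.Collinear uᵥ vᵥ x⁻
    uvx = ¬col {uᵥ} {vᵥ} {x⁻} refl (λ ()) (λ e → m≢1+n+m i {1} (sym (≡.trans e h⁻))) (λ c → not-consecutive (subst (Consecutive (2 + i)) h⁻ c))
      where
      not-consecutive : ¬ Consecutive (2 + i) i
      not-consecutive (inj₁ e) = m≢1+n+m i {2} e
      not-consecutive (inj₂ e) = 1+n≢n e
    image : ∀ {A B C} → Collinear (Inverse.from F A) (Inverse.from F B) (Inverse.from F C) → 𝓣′.Collinear A B C
    image {A} {B} {C} = Sum.map (β-image A B C) (Sum.map (β-image A C B) (Sum.map (β-image B A C)
      (Sum.map (β-image B C A) (Sum.map (β-image C A B) (β-image C B A)))))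
      where
      β-image : ∀ A B C → β (Inverse.from F A) (Inverse.from F B) (Inverse.from F C) → 𝓣′.β A B C
      β-image A B C b = subst (λ e → 𝓣′.β e B C) (back A) (subst₂ (𝓣′.β (Inverse.to F (Inverse.from F A))) (back B) (back C) (Equivalence.to (F-β _ _ _) b))
        where
        back : ∀ A → Inverse.to F (Inverse.from F A) ≡ A
        back = Inverse.strictlyInverseˡ F
    hit : ∀ {A B C} → ¬ 𝓣′.Collinear A B C → Inverse.to F a ≡ A ⊎ Inverse.to F a ≡ B ⊎ Inverse.to F a ≡ C
    hit {A} {B} {C} ¬c with pierce (Inverse.from F A) (Inverse.from F B) (Inverse.from F C)
    ... | inj₁ c = contradiction (image {A} {B} {C} c) ¬c
    ... | inj₂ s = Sum.map via (Sum.map via via) s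
      where
      via : ∀ {A} → a ≡ Inverse.from F A → Inverse.to F a ≡ A
      via e = ≡.trans (cong (Inverse.to F) e) (Inverse.strictlyInverseˡ F _)
    x⁺≢x⁻ : x⁺ ≢ x⁻
    x⁺≢x⁻ e = m≢1+n+m i {2} (≡.trans (sym h⁻) (≡.trans (cong h (sym e)) h⁺))
    apart : ∀ {e : TVertex n} → e ≡ yᵥ ⊎ e ≡ zᵥ ⊎ e ≡ x⁺ → ¬ (e ≡ uᵥ ⊎ e ≡ vᵥ ⊎ e ≡ x⁻)
    apart (inj₁ refl)        (inj₂ (inj₂ ()))
    apart (inj₂ (inj₁ refl)) (inj₂ (inj₂ ()))
    apart (inj₂ (inj₂ refl)) (inj₂ (inj₂ e)) = x⁺≢x⁻ e

-- In this example and the next two, every triangle contains both points of the doubled level, so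
-- either of them pierces. The finitely many triples are checked by evaluation.
fourCycle-pierced : Disjoint.Piercing (FourCycle.fourCycle 2) (suc zero)
fourCycle-pierced = toWitness {a? = Fin.all? λ x → Fin.all? λ y → Fin.all? λ z →
  collinear? x y z ⊎-dec (suc zero Fin.≟ x) ⊎-dec (suc zero Fin.≟ y) ⊎-dec (suc zero Fin.≟ z)} _
  where open BetweennessStructure (FourCycle.fourCycle 2)

fork-pierced : Disjoint.Piercing (Fork.fork 4) zero
fork-pierced = toWitness {a? = Fin.all? λ x → Fin.all? λ y → Fin.all? λ z →
  collinear? x y z ⊎-dec (zero Fin.≟ x) ⊎-dec (zero Fin.≟ y) ⊎-dec (zero Fin.≟ z)} _
  where open BetweennessStructure (Fork.fork 4)

prongs-pierced : Disjoint.Piercing (Prongs.prongs 6) zero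
prongs-pierced = toWitness {a? = Fin.all? λ x → Fin.all? λ y → Fin.all? λ z →
  collinear? x y z ⊎-dec (zero Fin.≟ x) ⊎-dec (zero Fin.≟ y) ⊎-dec (zero Fin.≟ z)} _
  where open BetweennessStructure (Prongs.prongs 6)

-- Integer co-sizes and the three claims

open import Data.Integer.Base using (+_; _-_)
import Data.Integer.Base as ℤ
import Data.Integer.Properties as ℤ

difference : ∀ {k c a} → k + c ≡ a → + k ≡ + a - + c
difference {k} {c} refl = sym (≡.trans (ℤ.m-n≡m⊖n (k + c) c)
  (≡.trans (ℤ.⊖-≥ (m≤n+m c k)) (cong +_ (m+n∸n≡m k c))))

difference⁻¹ : ∀ {k c a} → + k ≡ + a - + c → k + c ≡ a
difference⁻¹ {k} {c} {a} eq = ℤ.+-injective (begin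
  + k ℤ.+ + c                      ≡⟨ cong (ℤ._+ + c) eq ⟩
  (+ a - + c) ℤ.+ + c              ≡⟨ ℤ.+-assoc (+ a) (ℤ.- + c) (+ c) ⟩
  + a ℤ.+ (ℤ.- + c ℤ.+ + c)        ≡⟨ cong (ℤ._+_ (+ a)) (ℤ.+-inverseˡ (+ c)) ⟩
  + a ℤ.+ + 0                      ≡⟨ ℤ.+-identityʳ (+ a) ⟩
  + a                              ∎)
  where open ≡-Reasoning

private
  six : ∀ {n c} → 11 ≤ c → c ≤ 2 * n → 6 ≤ n
  six {n} 11≤c c≤ = ≮⇒≥ λ n<6 → <⇒≱ (≤ᵇ⇒≤ 11 11 _) (≤-trans 11≤c (≤-trans c≤ (*-monoʳ-≤ 2 (≤-pred n<6))))

  module _ {n c t : ℕ} (eq : t + c ≡ 2 * n) where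

    lower-end : n ≤ 4 + t → c ∸ 4 ≤ n
    lower-end le = m≤n+o⇒m∸n≤o c 4 (linear 0 (+-mono-≤ (≤-reflexive eq) le) (identity n c t))
      where
      identity : ∀ n c t → c + (2 * n + (4 + t)) + 0 ≡ 4 + n + (t + c + n)
      identity = solve-∀

    upper-end : 2 + t ≤ n → n ≤ c ∸ 2
    upper-end le = m+n≤o⇒m≤o∸n n {2} {c} (linear 0 (+-mono-≤ (≤-reflexive (sym eq)) le) (identity n c t))
      where
      identity : ∀ n c t → n + 2 + (t + c + n) + 0 ≡ c + (2 * n + (2 + t))
      identity = solve-∀

  offset : ∀ {n c} → 11 ≤ c → c ∸ 4 ≤ n → n ≤ c ∸ 2 → c ≡ 2 + n ⊎ c ≡ 3 + n ⊎ c ≡ 4 + n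
  offset {n} {suc (suc (suc (suc c)))} _ lo hi with m≤n⇒m<n∨m≡n hi
  ... | inj₂ refl = inj₁ refl
  ... | inj₁ lt with m≤n⇒m<n∨m≡n (≤-pred lt)
  ...   | inj₂ refl = inj₂ (inj₁ refl)
  ...   | inj₁ lt′  = inj₂ (inj₂ (cong (λ k → 4 + k) (≤-antisym lo (≤-pred lt′))))
  offset {c = suc zero}             (s≤s ())
  offset {c = suc (suc zero)}       (s≤s (s≤s ()))
  offset {c = suc (suc (suc zero))} (s≤s (s≤s (s≤s ())))

  two-n : ∀ n k j → n ≡ k + j → k + (j + n) ≡ 2 * n
  two-n n k j refl = identity k j
    where
    identity : ∀ k j → k + (j + (k + j)) ≡ 2 * (k + j)
    identity = solve-∀

coSize-values : ∀ (c n : ℕ) → 11 ≤ c → 1 ≤ n → B n (+ (2 * n) - + c) ⇔ (2 * n ≡ c ⊎ (c ∸ 4 ≤ n × n ≤ c ∸ 2))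
coSize-values c n 11≤c 1≤n = mk⇔ ⇒ (⇐ n 1≤n)
  where
  ⇒ : B n (+ (2 * n) - + c) → 2 * n ≡ c ⊎ (c ∸ 4 ≤ n × n ≤ c ∸ 2)
  ⇒ (𝓑 , refl , eq) = decide (Classification.classify 𝓑 (six 11≤c (≤-trans (m≤n+m c t) (≤-reflexive total))))
    where
    t : ℕ
    t = BetweennessStructure.coSize 𝓑
    total : t + c ≡ 2 * n
    total = difference⁻¹ eq
    decide : ∀ {P : Set} → (t ≡ 0 ⊎ (n ≤ 4 + t × 2 + t ≤ n)) ⊎ (2 * n ≤ t + 10 × P) →
             2 * n ≡ c ⊎ (c ∸ 4 ≤ n × n ≤ c ∸ 2)
    decide (inj₁ (inj₁ t≡0))       = inj₁ (≡.trans (sym total) (cong (_+ c) t≡0))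
    decide (inj₁ (inj₂ (lo , hi))) = inj₂ (lower-end {n} {c} {t} total lo , upper-end {n} {c} {t} total hi)
    decide (inj₂ (le , _))         = contradiction (+-cancelˡ-≤ t c 10 (≤-trans (≤-reflexive total) le)) (<⇒≱ 11≤c)
  ⇐ : ∀ n → 1 ≤ n → 2 * n ≡ c ⊎ (c ∸ 4 ≤ n × n ≤ c ∸ 2) → B n (+ (2 * n) - + c)
  ⇐ (suc m) _ (inj₁ eq) = Path.path m , refl , difference {c = c} (≡.trans (cong (_+ c) (Path.path-coSize m)) (sym eq))
  -- 2n - c is n - 2, n - 3 or n - 4, the respective co-sizes of the triangle, the fork and the
  -- 4-cycle with a path.
  ⇐ n _ (inj₂ (lo , hi)) with offset {n} {c} 11≤c lo hi
  ... | inj₁ refl        = two (≤-pred (≤-pred 11≤c))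
    where
    two : ∀ {n} → 9 ≤ n → B n (+ (2 * n) - + (2 + n))
    two {suc (suc m)} _ = Prongs.prongs m , refl ,
      difference {c = 4 + m} (≡.trans (cong (_+ (4 + m)) (Prongs.prongs-coSize m)) (two-n (2 + m) m 2 (+-comm 2 m)))
    two {suc zero} (s≤s ())
  ... | inj₂ (inj₁ refl) = three (≤-pred (≤-pred (≤-pred 11≤c)))
    where
    three : ∀ {n} → 8 ≤ n → B n (+ (2 * n) - + (3 + n))
    three {suc (suc (suc m))} _ = Fork.fork m , refl ,
      difference {c = 6 + m} (≡.trans (cong (_+ (6 + m)) (Fork.fork-coSize m)) (two-n (3 + m) m 3 (+-comm 3 m)))
    three {suc zero} (s≤s ())
    three {suc (suc zero)} (s≤s (s≤s ()))
  ... | inj₂ (inj₂ refl) = four (≤-pred (≤-pred (≤-pred (≤-pred 11≤c))))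
    where
    four : ∀ {n} → 7 ≤ n → B n (+ (2 * n) - + (4 + n))
    four {suc (suc (suc (suc m)))} _ = FourCycle.fourCycle m , refl ,
      difference {c = 8 + m} (≡.trans (cong (_+ (8 + m)) (FourCycle.fourCycle-coSize m)) (two-n (4 + m) m 4 (+-comm 4 m)))
    four {suc zero} (s≤s ())
    four {suc (suc zero)} (s≤s (s≤s ()))
    four {suc (suc (suc zero))} (s≤s (s≤s (s≤s ())))

coSize-2n-10 : ∀ n → 1 ≤ n → B n (+ (2 * n) - + 10) ⇔ 5 ≤ n
coSize-2n-10 n _ = mk⇔ ⇒ (⇐ n)
  where
  ⇒ : B n (+ (2 * n) - + 10) → 5 ≤ n
  ⇒ (𝓑 , refl , eq) = *-cancelˡ-≤ 2 (≤-trans (m≤n+m 10 (BetweennessStructure.coSize 𝓑)) (≤-reflexive (difference⁻¹ eq)))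
  ⇐ : ∀ n → 5 ≤ n → B n (+ (2 * n) - + 10)
  ⇐ 5 _ = Path.path 4 , refl , difference {c = 10} (cong (_+ 10) (Path.path-coSize 4))
  ⇐ (suc (suc (suc (suc (suc (suc m)))))) _ = DoubleCycle.doubleCycle m , refl ,
    difference {c = 10} (≡.trans (cong (_+ 10) (DoubleCycle.doubleCycle-coSize m)) (identity m))
    where
    identity : ∀ m → 2 + 2 * m + 10 ≡ 2 * (6 + m)
    identity = solve-∀
  ⇐ 1 (s≤s ())
  ⇐ 2 (s≤s (s≤s ()))
  ⇐ 3 (s≤s (s≤s (s≤s ())))
  ⇐ 4 (s≤s (s≤s (s≤s (s≤s ()))))

extremal : ∀ n → 9 ≤ n → (𝓑 : B n (+ (2 * n) - + 10)) →
           ∃[ i ] Σ[ 1≤i ∈ 1 ≤ i ] Σ[ i≤ ∈ i ≤ ⌈ n ∸ 5 /2⌉ ] proj₁ 𝓑 ≃ 𝓣 n i 1≤i i≤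
extremal n 9≤n (𝓑 , refl , eq) = decide (Classification.classify 𝓑 (≤-trans (≤ᵇ⇒≤ 6 9 _) 9≤n))
  where
  t : ℕ
  t = BetweennessStructure.coSize 𝓑
  total : t + 10 ≡ 2 * n
  total = difference⁻¹ eq
  Goal : Set
  Goal = ∃[ i ] Σ[ 1≤i ∈ 1 ≤ i ] Σ[ i≤ ∈ i ≤ ⌈ n ∸ 5 /2⌉ ] 𝓑 ≃ 𝓣 n i 1≤i i≤
  decide : (t ≡ 0 ⊎ (n ≤ 4 + t × 2 + t ≤ n)) ⊎ (2 * n ≤ t + 10 × (9 ≤ n → t + 10 ≡ 2 * n → Pairs.Twins 𝓑 (Plane.points 𝓑))) → Goal
  decide (inj₁ (inj₁ t≡0)) = contradiction (≤-trans (*-monoʳ-≤ 2 9≤n) (≤-reflexive (≡.trans (sym total) (cong (_+ 10) t≡0)))) (<⇒≱ (≤ᵇ⇒≤ 11 18 _))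
  decide (inj₁ (inj₂ (_ , hi))) = contradiction
    (linear {C = 9} {D = 8} 0 (+-mono-≤ 9≤n (+-mono-≤ hi (≤-reflexive (sym total)))) (identity n t)) (<⇒≱ ≤-refl)
    where
    identity : ∀ n t → 9 + (n + (n + (t + 10))) + 0 ≡ 8 + (9 + (2 + t + 2 * n))
    identity = solve-∀
  decide (inj₂ (_ , twins)) = Classification.recognise 𝓑 (twins 9≤n total)

-- The star values n - 4, n - 3 and n - 2 meet 2n - 10 exactly at n = 6, 7 and 8.
others : ∀ n → 6 ≤ n → n < 9 → Σ[ 𝓑 ∈ B n (+ (2 * n) - + 10) ]
         (∀ i (1≤i : 1 ≤ i) (i≤ : i ≤ ⌈ n ∸ 5 /2⌉) → ¬ (proj₁ 𝓑 ≃ 𝓣 n i 1≤i i≤))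
others 6 _ _ = (FourCycle.fourCycle 2 , refl , difference {c = 10} (cong (_+ 10) (FourCycle.fourCycle-coSize 2))) ,
               Disjoint.not-𝓣 (FourCycle.fourCycle 2) fourCycle-pierced 6
others 7 _ _ = (Fork.fork 4 , refl , difference {c = 10} (cong (_+ 10) (Fork.fork-coSize 4))) ,
               Disjoint.not-𝓣 (Fork.fork 4) fork-pierced 7
others 8 _ _ = (Prongs.prongs 6 , refl , difference {c = 10} (cong (_+ 10) (Prongs.prongs-coSize 6))) ,
               Disjoint.not-𝓣 (Prongs.prongs 6) prongs-pierced 8
others (suc (suc (suc (suc (suc (suc (suc (suc (suc n))))))))) _ n<9 = contradiction n<9 (≤⇒≯ (m≤m+n 9 n))
others 1 (s≤s ()) _
others 2 (s≤s (s≤s ())) _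
others 3 (s≤s (s≤s (s≤s ()))) _
others 4 (s≤s (s≤s (s≤s (s≤s ())))) _
others 5 (s≤s (s≤s (s≤s (s≤s (s≤s ()))))) _

theorem6 :
    (∀ (c n : ℕ) → 11 ≤ c → 1 ≤ n →
       B n (+ (2 * n) - + c) ⇔ (2 * n ≡ c ⊎ (c ∸ 4 ≤ n × n ≤ c ∸ 2)))
    ×
    ((∀ (n : ℕ) → 1 ≤ n → B n (+ (2 * n) - + 10) ⇔ 5 ≤ n)
     ×
     (∀ (n : ℕ) → 9 ≤ n → (𝓑 : B n (+ (2 * n) - + 10)) →
        ∃[ i ] Σ[ 1≤i ∈ 1 ≤ i ] Σ[ i≤ ∈ i ≤ ⌈ n ∸ 5 /2⌉ ] proj₁ 𝓑 ≃ 𝓣 n i 1≤i i≤))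
    ×
    (∀ (n : ℕ) → 6 ≤ n → n < 9 →
       Σ[ 𝓑 ∈ B n (+ (2 * n) - + 10) ]
         (∀ i (1≤i : 1 ≤ i) (i≤ : i ≤ ⌈ n ∸ 5 /2⌉) → ¬ (proj₁ 𝓑 ≃ 𝓣 n i 1≤i i≤)))
theorem6 = coSize-values , (coSize-2n-10 , extremal) , others
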